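{- The reduction relation $\rightsquigarrow_{\mathrm{su}'}$ is confluent: writing $\rightsquigarrow^*$ for its reflexive transitive closure, for all terms $s,t,u$ with $s\rightsquigarrow^*t$ and $s\rightsquigarrow^*u$ there is a term $v$ with $t\rightsquigarrow^*v$ and $u\rightsquigarrow^*v$.
   Context: Syntax. Syntax is taken up to renaming of variables; $\equiv$ is syntactic equality, and syntax over $\Gamma$ is silently regarded as syntax over $\Gamma,(x:A)$ (weakening). By mutual induction: a context is a finite list $(x_1:A_1),\dots,(x_m:A_m)$ with $A_i$ a type over the preceding entries; a type over $\Gamma$ is $\star$ or $s\to_A t$ with $A$ a type and $s,t$ terms over $\Gamma$; a term over $\Gamma$ is a variable of $\Gamma$ or $\mathrm{Coh}_{(\Delta;A)}[\sigma]$ with $\Delta$ a context, $A$ a type over $\Delta$ and $\sigma:\Delta\to\Gamma$; a substitution $\sigma:\Delta\to\Gamma$ is a list of terms over $\Gamma$, one for each variable of $\Delta$. $x[\![\sigma]\!]$ is the entry of $\sigma$ at the variable $x$; $\mathrm{Coh}_{(\Theta;A)}[\tau][\![\sigma]\!]=\mathrm{Coh}_{(\Theta;A)}[\tau\bullet\sigma]$, where $\tau\bullet\sigma$ applies $[\![\sigma]\!]$ to each entry of $\tau$; $\star[\![\sigma]\!]=\star$; $(s\to_At)[\![\sigma]\!]=s[\![\sigma]\!]\to_{A[\![\sigma]\!]}t[\![\sigma]\!]$. $\dim\star=0$, $\dim(s\to_At)=\dim A+1$; the dimension of a context is the maximal dimension of its types. Ps-contexts. $(x:\star)\vdash_{ps}x:\star$;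 if $\Gamma\vdash_{ps}x:A$ then $\Gamma,(y:A),(f:x\to_Ay)\vdash_{ps}f:x\to_Ay$; if $\Gamma\vdash_{ps}x:s\to_At$ then $\Gamma\vdash_{ps}t:A$; if $\Gamma\vdash_{ps}x:\star$ then $\Gamma\vdash_{ps}$ ($\Gamma$ is a ps-context). For $i\in\mathbb N$, $\epsilon\in\{ -,+\}$: $\partial_i^\epsilon((x:\star))=\{x\}$, and for $\Delta=\Gamma,(y:A),(f:x\to_Ay)$, $\partial^\epsilon_i(\Delta)$ is $\partial_i^\epsilon(\Gamma)$ if $i<\dim A$; $\partial_i^-(\Gamma)$ if $i=\dim A$, $\epsilon=-$; $(\partial_i^+(\Gamma)\cup\{y\})\setminus\{x\}$ if $i=\dim A$, $\epsilon=+$; $\partial_i^\epsilon(\Gamma)\cup\{y,f\}$ if $i>\dim A$. Support. $\mathrm{FV}(x)=\{x\}$, $\mathrm{FV}(\mathrm{Coh}_{(\Delta;A)}[\sigma])=\mathrm{FV}(\sigma)$, $\mathrm{FV}(\star)=\emptyset$, and $\mathrm{FV}$ of arrow types and substitutions is the union over components. $\mathrm{Supp}$ of syntax over $\Gamma$ is the smallest set $U\supseteq\mathrm{FV}$ such that $x\in U$ and $(x:A)\in\Gamma$ imply $\mathrm{FV}(A)\subseteq U$. Typing and equality. Let $\mathcal O$ be the regular operation set: all triples $(\Delta,\partial_n^-(\Delta),\partial_n^+(\Delta))$ with $\Delta$ a ps-context, $n\in\mathbb N$, $n\ge\dim\Delta-1$. An equality rule set $\mathcal R$ is a set of triples $(\Gamma,s,t)$,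 $s,t$ terms over $\Gamma$. The theory $\mathrm{Catt}_{\mathcal R}$ is generated mutually by: $\emptyset\vdash$; $\Gamma\vdash$, $\Gamma\vdash A$ give $\Gamma,(x:A)\vdash$; $\Gamma\vdash\star$; $\Gamma\vdash A$, $\Gamma\vdash s:A$, $\Gamma\vdash t:A$ give $\Gamma\vdash s\to_At$; $\Gamma\vdash\langle\rangle:\emptyset$; $\Gamma\vdash\sigma:\Delta$, $\Gamma\vdash t:A[\![\sigma]\!]$ give $\Gamma\vdash\langle\sigma,t\rangle:\Delta,(x:A)$; $(x:A)\in\Gamma$ gives $\Gamma\vdash x:A$; $\Gamma\vdash t:A$, $\Gamma\vdash A=B$ give $\Gamma\vdash t:B$; $\Delta\vdash_{ps}$, $\Delta\vdash s\to_At$, $\Gamma\vdash\sigma:\Delta$, $(\Delta,\mathrm{Supp}(s),\mathrm{Supp}(t))\in\mathcal O$ give $\Gamma\vdash\mathrm{Coh}_{(\Delta;s\to_At)}[\sigma]:(s\to_At)[\![\sigma]\!]$; equality is a congruence for all constructors (for coherences: $\Delta\vdash A=B$, $\Gamma\vdash\sigma=\tau$ give $\Gamma\vdash\mathrm{Coh}_{(\Delta;A)}[\sigma]=\mathrm{Coh}_{(\Delta;B)}[\tau]$), reflexive on variables, symmetric and transitive on terms, and $\Gamma\vdash s=t$ whenever $(\Gamma,s,t)\in\mathcal R$ and $\Gamma\vdash s:A$ for some $A$. Discs. $U^0=\star$, $U^{k+1}=d_k^-\to_{U^k}d_k^+$; $D^n$ has variables $d_0^-,d_0^+,\dots,d_{n-1}^-,d_{n-1}^+,d_n$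 with $d_k^\pm:U^k$, $d_n:U^n$. For a type $A$ over $\Gamma$ with $\dim A=n$ and a term $t$, $\{A,t\}:D^n\to\Gamma$ is the substitution with $d_n\mapsto t$ and $U^n[\![\{A,t\}]\!]\equiv A$. $\mathrm{id}(A,t)=\mathrm{Coh}_{(D^n;d_n\to_{U^n}d_n)}[\{A,t\}]$; terms of this form are called identities. Dyck words and pruning. Dyck words $W\in\mathrm{Dyck}_d$: $\ominus\in\mathrm{Dyck}_0$; $W\in\mathrm{Dyck}_d$ gives $W\Uparrow\in\mathrm{Dyck}_{d+1}$; $W\in\mathrm{Dyck}_{d+1}$ gives $W\Downarrow\in\mathrm{Dyck}_d$. Associated context, type, term: $\lfloor\ominus\rfloor=(x:\star)$, $\mathrm{Ty}_\ominus=\star$, $\mathrm{Tm}_\ominus=x$; $\lfloor W\Uparrow\rfloor=\lfloor W\rfloor,(y_W:\mathrm{Ty}_W),(f_W:\mathrm{Tm}_W\to_{\mathrm{Ty}_W}y_W)$, $\mathrm{Ty}_{W\Uparrow}=\mathrm{Tm}_W\to_{\mathrm{Ty}_W}y_W$, $\mathrm{Tm}_{W\Uparrow}=f_W$; $\lfloor W\Downarrow\rfloor=\lfloor W\rfloor$ and, if $\mathrm{Ty}_W=s\to_At$, $\mathrm{Ty}_{W\Downarrow}=A$, $\mathrm{Tm}_{W\Downarrow}=t$. A peak $p$ of $W$ is an occurrence in $W$ of $\Uparrow$ immediately followed by $\Downarrow$; if $E$ is the prefix of $W$ before it, $\lfloor p\rfloor=f_E$, and $W/\!\!/p$ is $W$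 with these two letters deleted. $\pi_p:\lfloor W\rfloor\to\lfloor W/\!\!/p\rfloor$ sends $y_E\mapsto\mathrm{Tm}_E$, $f_E\mapsto\mathrm{id}(\mathrm{Ty}_E,\mathrm{Tm}_E)$ and each other variable to the corresponding variable. For $\sigma:\lfloor W\rfloor\to\Gamma$, $\sigma/\!\!/p$ is $\sigma$ with the entries at $y_E,f_E$ deleted. Rule sets. $\mathrm{dr}$: all $(\Gamma,\mathrm{Coh}_{(D^n;U^n)}[\{A,t\}],t)$, $n=\dim A$. $\mathrm{ecr}$: all $(\Gamma,\mathrm{Coh}_{(\Delta;s\to_As)}[\sigma],\mathrm{id}(A[\![\sigma]\!],s[\![\sigma]\!]))$. $\mathrm{prune}$: all $(\Gamma,\mathrm{Coh}_{(\lfloor W\rfloor;A)}[\sigma],\mathrm{Coh}_{(\lfloor W/\!\!/p\rfloor;A[\![\pi_p]\!])}[\sigma/\!\!/p])$ with $W\in\mathrm{Dyck}_0$, $p$ a peak of $W$ and $\lfloor p\rfloor[\![\sigma]\!]$ an identity. $\mathrm{ecr}'$ and $\mathrm{prune}'$ are the subsets of $\mathrm{ecr}$ and $\mathrm{prune}$ of triples whose first term is not an identity. $\mathrm{su}'=\mathrm{dr}\cup\mathrm{prune}'\cup\mathrm{ecr}'$. Reduction. For a rule set $\mathcal R$, $\rightsquigarrow_{\mathcal R}$ is the relation on well-formed terms, types and substitutions (of $\mathrm{Catt}_{\mathcal R}$) generated by: $s\rightsquigarrow t$ if $(\Gamma,s,t)\in\mathcal R$; $\mathrm{Coh}_{(\Delta;A)}[\sigma]\rightsquigarrow\mathrm{Coh}_{(\Delta;B)}[\sigma]$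 if $A\rightsquigarrow B$; $\mathrm{Coh}_{(\Delta;A)}[\sigma]\rightsquigarrow\mathrm{Coh}_{(\Delta;A)}[\tau]$ if $\sigma\rightsquigarrow\tau$; $s\to_At$ reduces by reducing exactly one of $s,A,t$; a substitution reduces by reducing exactly one entry. -}

module Defs where

open import Data.Bool.Base using (Bool; true; false)
open import Data.Fin.Base using (Fin; zero; suc)
open import Data.Fin.Subset using (Subset; inside; outside; ⊥; ⁅_⁆; _∪_; _─_; _∈_)
open import Data.Nat.Base using (ℕ; zero; suc; pred; _*_; _⊔_; _≤_)
open import Data.Nat.Properties using (<-cmp)
open import Data.Product.Base using (_×_; ∃-syntax)
open import Data.Sum.Base using (_⊎_)
open import Data.Vec.Base using ([]; _∷_)
open import Level using (0ℓ)
open import Relation.Binary.Core using (Rel)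
open import Relation.Binary.Definitions using (tri<; tri≈; tri>)
open import Relation.Binary.PropositionalEquality using (_≡_; refl; cong; trans)
open import Relation.Nullary.Negation.Core using (¬_)
open import Relation.Unary using (Pred; _≐_)

private
  variable
    d k l m n : ℕ

------------------------------------------------------------------------
-- Raw syntax
--
-- Contexts are indexed by their length, and types and terms by the number
-- of variables in scope, with de Bruijn indices for variables: `zero` is
-- the last variable of the context.  A substitution σ : Δ → Γ between
-- contexts of lengths m and n is an element of `Sub m n`.

infixl 5 _▸_
infix  6 _─⟨_⟩⟶_

data Ctx : ℕ → Set
data Ty (n : ℕ) : Set
data Tm (n : ℕ) : Set
data Sub : ℕ → ℕ → Set

data Ctx where
  ∅   : Ctx 0
  _▸_ : Ctx n → Ty n → Ctx (suc n)

data Ty n where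
  ⋆       : Ty n
  _─⟨_⟩⟶_ : (s : Tm n) (A : Ty n) (t : Tm n) → Ty n

data Tm n where
  var : Fin n → Tm n
  Coh : (Δ : Ctx m) (A : Ty m) (σ : Sub m n) → Tm n

data Sub where
  ⟨⟩    : Sub 0 n
  ⟨_,_⟩ : Sub m n → Tm n → Sub (suc m) n

-- The context and type annotating a coherence are closed by its
-- substitution, so weakening does not change them.

wkTy  : Ty n → Ty (suc n)
wkTm  : Tm n → Tm (suc n)
wkSub : Sub m n → Sub m (suc n)

wkTy ⋆              = ⋆
wkTy (s ─⟨ A ⟩⟶ t) = wkTm s ─⟨ wkTy A ⟩⟶ wkTm t

wkTm (var x)     = var (suc x)
wkTm (Coh Δ A σ) = Coh Δ A (wkSub σ)

wkSub ⟨⟩        = ⟨⟩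
wkSub ⟨ σ , t ⟩ = ⟨ wkSub σ , wkTm t ⟩

idSub : Sub n n
idSub {zero}  = ⟨⟩
idSub {suc n} = ⟨ wkSub idSub , var zero ⟩

infixl 8 _[_]ty _[_]tm _[_]var _∙_

_[_]var : Fin m → Sub m n → Tm n
zero  [ ⟨ σ , t ⟩ ]var = t
suc x [ ⟨ σ , t ⟩ ]var = x [ σ ]var

_[_]ty : Ty m → Sub m n → Ty n
_[_]tm : Tm m → Sub m n → Tm n
_∙_    : Sub l m → Sub m n → Sub l n

⋆              [ σ ]ty = ⋆
(s ─⟨ A ⟩⟶ t) [ σ ]ty = (s [ σ ]tm) ─⟨ A [ σ ]ty ⟩⟶ (t [ σ ]tm)

var x     [ σ ]tm = x [ σ ]var
Coh Δ A τ [ σ ]tm = Coh Δ A (τ ∙ σ)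

⟨⟩        ∙ σ = ⟨⟩
⟨ τ , t ⟩ ∙ σ = ⟨ τ ∙ σ , t [ σ ]tm ⟩

lookup : Ctx n → Fin n → Ty n
lookup (Γ ▸ A) zero    = wkTy A
lookup (Γ ▸ A) (suc x) = wkTy (lookup Γ x)

dim : Ty n → ℕ
dim ⋆              = 0
dim (s ─⟨ A ⟩⟶ t) = suc (dim A)

dimCtx : Ctx n → ℕ
dimCtx ∅       = 0
dimCtx (Γ ▸ A) = dimCtx Γ ⊔ dim A

------------------------------------------------------------------------
-- Support

FVTy  : Ty n → Subset n
FVTm  : Tm n → Subset n
FVSub : Sub m n → Subset n

FVTy ⋆              = ⊥
FVTy (s ─⟨ A ⟩⟶ t) = FVTm s ∪ FVTy A ∪ FVTm t

FVTm (var x)     = ⁅ x ⁆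
FVTm (Coh Δ A σ) = FVSub σ

FVSub ⟨⟩        = ⊥
FVSub ⟨ σ , t ⟩ = FVSub σ ∪ FVTm t

data Closure (Γ : Ctx n) (U : Subset n) : Pred (Fin n) 0ℓ where
  base : ∀ {x} → x ∈ U → Closure Γ U x
  step : ∀ {x y} → Closure Γ U x → y ∈ FVTy (lookup Γ x) → Closure Γ U y

Supp : Ctx n → Tm n → Pred (Fin n) 0ℓ
Supp Γ t = Closure Γ (FVTm t)

------------------------------------------------------------------------
-- Ps-contexts and their boundaries

infix 4 _⊢ps_∶_ _⊢ps

data _⊢ps_∶_ : Ctx n → Tm n → Ty n → Set where
  pss : ∅ ▸ ⋆ ⊢ps var zero ∶ ⋆
  pse : {Γ : Ctx n} {x : Tm n} {A : Ty n} →
        Γ ⊢ps x ∶ A →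
        Γ ▸ A ▸ (wkTm x ─⟨ wkTy A ⟩⟶ var zero)
          ⊢ps var zero ∶ wkTy (wkTm x ─⟨ wkTy A ⟩⟶ var zero)
  psd : {Γ : Ctx n} {x s t : Tm n} {A : Ty n} →
        Γ ⊢ps x ∶ s ─⟨ A ⟩⟶ t →
        Γ ⊢ps t ∶ A

data _⊢ps (Γ : Ctx n) : Set where
  ps : ∀ {x} → Γ ⊢ps x ∶ ⋆ → Γ ⊢ps

Sign : Set
Sign = Bool

pattern ⁻ = false
pattern ⁺ = true

-- By recursion on the derivation, which supplies the context Γ,(y:A),(f:x→y)
-- in the case `pse`; `psd` does not change the context.  A subset of that
-- context lists first whether f, and then whether y, belongs to it.

∂ : ℕ → Sign → {Γ : Ctx n} {x : Tm n} {A : Ty n} → Γ ⊢ps x ∶ A → Subset n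
∂ i ε pss = inside ∷ []
∂ i ε (pse {x = x} {A = A} p) with <-cmp i (dim A)
∂ i ε (pse {x = x} {A = A} p) | tri< _ _ _ = outside ∷ outside ∷ ∂ i ε p
∂ i ⁻ (pse {x = x} {A = A} p) | tri≈ _ _ _ = outside ∷ outside ∷ ∂ i ⁻ p
∂ i ⁺ (pse {x = x} {A = A} p) | tri≈ _ _ _ = outside ∷ inside ∷ (∂ i ⁺ p ─ FVTm x)
∂ i ε (pse {x = x} {A = A} p) | tri> _ _ _ = inside ∷ inside ∷ ∂ i ε p
∂ i ε (psd p) = ∂ i ε p

∂ps : ℕ → Sign → {Γ : Ctx n} → Γ ⊢ps → Subset n
∂ps i ε (ps p) = ∂ i ε p

-- The regular operation set.  The bound i ≥ dim Δ − 1 is stated without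
-- truncated subtraction.

data 𝒪 (Δ : Ctx n) (U V : Pred (Fin n) 0ℓ) : Set where
  regular : (p : Δ ⊢ps) (i : ℕ) → dimCtx Δ ≤ suc i →
            U ≐ (_∈ ∂ps i ⁻ p) → V ≐ (_∈ ∂ps i ⁺ p) → 𝒪 Δ U V

------------------------------------------------------------------------
-- The type theory generated by an equality rule set

RuleSet : Set₁
RuleSet = ∀ {n} → Ctx n → Tm n → Tm n → Set

module Catt (R : RuleSet) where

  infix 4 _⊢ _⊢ty_ _⊢tm_∶_ _⊢sub_∶_ _⊢ty_≈_ _⊢tm_≈_ _⊢sub_≈_

  data _⊢       : Ctx n → Set
  data _⊢ty_    : Ctx n → Ty n → Set
  data _⊢tm_∶_  : Ctx n → Tm n → Ty n → Set
  data _⊢sub_∶_ : Ctx n → Sub m n → Ctx m → Set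
  data _⊢ty_≈_  : Ctx n → Ty n → Ty n → Set
  data _⊢tm_≈_  : Ctx n → Tm n → Tm n → Set
  data _⊢sub_≈_ : Ctx n → Sub m n → Sub m n → Set

  data _⊢ where
    ctx-∅ : ∅ ⊢
    ctx-▸ : {Γ : Ctx n} {A : Ty n} → Γ ⊢ → Γ ⊢ty A → Γ ▸ A ⊢

  data _⊢ty_ where
    ty-⋆ : {Γ : Ctx n} → Γ ⊢ty ⋆
    ty-⟶ : {Γ : Ctx n} {A : Ty n} {s t : Tm n} →
           Γ ⊢ty A → Γ ⊢tm s ∶ A → Γ ⊢tm t ∶ A → Γ ⊢ty s ─⟨ A ⟩⟶ t

  data _⊢sub_∶_ where
    sub-⟨⟩ : {Γ : Ctx n} → Γ ⊢sub ⟨⟩ ∶ ∅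
    sub-,  : {Γ : Ctx n} {Δ : Ctx m} {σ : Sub m n} {A : Ty m} {t : Tm n} →
             Γ ⊢sub σ ∶ Δ → Γ ⊢tm t ∶ A [ σ ]ty → Γ ⊢sub ⟨ σ , t ⟩ ∶ Δ ▸ A

  data _⊢tm_∶_ where
    tm-var  : {Γ : Ctx n} (x : Fin n) → Γ ⊢tm var x ∶ lookup Γ x
    tm-conv : {Γ : Ctx n} {t : Tm n} {A B : Ty n} →
              Γ ⊢tm t ∶ A → Γ ⊢ty A ≈ B → Γ ⊢tm t ∶ B
    tm-coh  : {Γ : Ctx n} {Δ : Ctx m} {s t : Tm m} {A : Ty m} {σ : Sub m n} →
              Δ ⊢ps →
              Δ ⊢ty s ─⟨ A ⟩⟶ t →
              Γ ⊢sub σ ∶ Δ →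
              𝒪 Δ (Supp Δ s) (Supp Δ t) →
              Γ ⊢tm Coh Δ (s ─⟨ A ⟩⟶ t) σ ∶ (s ─⟨ A ⟩⟶ t) [ σ ]ty

  data _⊢ty_≈_ where
    ≈-⋆ : {Γ : Ctx n} → Γ ⊢ty ⋆ ≈ ⋆
    ≈-⟶ : {Γ : Ctx n} {A A′ : Ty n} {s s′ t t′ : Tm n} →
          Γ ⊢tm s ≈ s′ → Γ ⊢ty A ≈ A′ → Γ ⊢tm t ≈ t′ →
          Γ ⊢ty s ─⟨ A ⟩⟶ t ≈ s′ ─⟨ A′ ⟩⟶ t′

  data _⊢tm_≈_ where
    ≈-var   : {Γ : Ctx n} (x : Fin n) → Γ ⊢tm var x ≈ var x
    ≈-sym   : {Γ : Ctx n} {s t : Tm n} → Γ ⊢tm s ≈ t → Γ ⊢tm t ≈ s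
    ≈-trans : {Γ : Ctx n} {s t u : Tm n} →
              Γ ⊢tm s ≈ t → Γ ⊢tm t ≈ u → Γ ⊢tm s ≈ u
    ≈-coh   : {Γ : Ctx n} {Δ : Ctx m} {A B : Ty m} {σ τ : Sub m n} →
              Δ ⊢ty A ≈ B → Γ ⊢sub σ ≈ τ → Γ ⊢tm Coh Δ A σ ≈ Coh Δ B τ
    ≈-rule  : {Γ : Ctx n} {s t : Tm n} {A : Ty n} →
              R Γ s t → Γ ⊢tm s ∶ A → Γ ⊢tm s ≈ t

  data _⊢sub_≈_ where
    ≈-⟨⟩ : {Γ : Ctx n} → Γ ⊢sub ⟨⟩ ≈ ⟨⟩
    ≈-,  : {Γ : Ctx n} {σ τ : Sub m n} {s t : Tm n} →
           Γ ⊢sub σ ≈ τ → Γ ⊢tm s ≈ t → Γ ⊢sub ⟨ σ , s ⟩ ≈ ⟨ τ , t ⟩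

  WellFormed : Ctx n → Tm n → Set
  WellFormed Γ t = ∃[ A ] Γ ⊢tm t ∶ A

------------------------------------------------------------------------
-- Reduction

module Reduction (R : RuleSet) where

  open Catt R

  infix 4 _⊢ty_⇝_ _⊢tm_⇝_ _⊢sub_⇝_

  data _⊢ty_⇝_  : Ctx n → Ty n → Ty n → Set
  data _⊢tm_⇝_  : Ctx n → Tm n → Tm n → Set
  data _⊢sub_⇝_ : Ctx n → Sub m n → Sub m n → Set

  data _⊢ty_⇝_ where
    ⇝-src : {Γ : Ctx n} {A : Ty n} {s s′ t : Tm n} →
            Γ ⊢tm s ⇝ s′ → Γ ⊢ty s ─⟨ A ⟩⟶ t ⇝ s′ ─⟨ A ⟩⟶ t
    ⇝-ty  : {Γ : Ctx n} {A A′ : Ty n} {s t : Tm n} →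
            Γ ⊢ty A ⇝ A′ → Γ ⊢ty s ─⟨ A ⟩⟶ t ⇝ s ─⟨ A′ ⟩⟶ t
    ⇝-tgt : {Γ : Ctx n} {A : Ty n} {s t t′ : Tm n} →
            Γ ⊢tm t ⇝ t′ → Γ ⊢ty s ─⟨ A ⟩⟶ t ⇝ s ─⟨ A ⟩⟶ t′

  data _⊢tm_⇝_ where
    ⇝-rule   : {Γ : Ctx n} {s t : Tm n} → R Γ s t → Γ ⊢tm s ⇝ t
    ⇝-cohTy  : {Γ : Ctx n} {Δ : Ctx m} {A B : Ty m} {σ : Sub m n} →
               Δ ⊢ty A ⇝ B → Γ ⊢tm Coh Δ A σ ⇝ Coh Δ B σ
    ⇝-cohSub : {Γ : Ctx n} {Δ : Ctx m} {A : Ty m} {σ τ : Sub m n} →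
               Γ ⊢sub σ ⇝ τ → Γ ⊢tm Coh Δ A σ ⇝ Coh Δ A τ

  data _⊢sub_⇝_ where
    ⇝-init : {Γ : Ctx n} {σ τ : Sub m n} {t : Tm n} →
             Γ ⊢sub σ ⇝ τ → Γ ⊢sub ⟨ σ , t ⟩ ⇝ ⟨ τ , t ⟩
    ⇝-last : {Γ : Ctx n} {σ : Sub m n} {t t′ : Tm n} →
             Γ ⊢tm t ⇝ t′ → Γ ⊢sub ⟨ σ , t ⟩ ⇝ ⟨ σ , t′ ⟩

  -- Reduction as a relation on well-formed terms.  Requiring this of the
  -- two ends suffices: by inversion of typing, the annotating type and the
  -- substitution of a well-formed coherence are well-formed, as are the
  -- components of these.  Well-formedness is put into the relation, rather
  -- than into its carrier, so that terms are compared without regard to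
  -- their typing derivations.

  record Step (Γ : Ctx n) (s t : Tm n) : Set where
    constructor mkStep
    field
      source-wf : WellFormed Γ s
      target-wf : WellFormed Γ t
      reduces   : Γ ⊢tm s ⇝ t

------------------------------------------------------------------------
-- Discs and identities

-- Dⁿ⁺¹ is obtained from Dⁿ by renaming its last variable dₙ to dₙ⁻ and
-- adding dₙ⁺ and dₙ₊₁.  Uⁿ, as a type over Dⁿ, is the type of dₙ.

D : (n : ℕ) → Ctx (suc (n * 2))
U : (n : ℕ) → Ty (suc (n * 2))

D zero    = ∅ ▸ ⋆
D (suc n) = D n ▸ U n ▸ (var (suc zero) ─⟨ wkTy (U n) ⟩⟶ var zero)

U zero    = ⋆
U (suc n) = wkTy (var (suc zero) ─⟨ wkTy (U n) ⟩⟶ var zero)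

⦅_,_⦆ : (A : Ty n) → Tm n → Sub (suc (dim A * 2)) n
⦅ ⋆            , t ⦆ = ⟨ ⟨⟩ , t ⟩
⦅ s ─⟨ A ⟩⟶ u , t ⦆ = ⟨ ⟨ ⦅ A , s ⦆ , u ⟩ , t ⟩

idTm : Ty n → Tm n → Tm n
idTm A t = Coh (D (dim A)) (var zero ─⟨ U (dim A) ⟩⟶ var zero) ⦅ A , t ⦆

IsIdentity : Tm n → Set
IsIdentity t = ∃[ A ] ∃[ s ] t ≡ idTm A s

------------------------------------------------------------------------
-- Dyck words

infixl 7 _⇑ _⇓

data Dyck : ℕ → Set where
  ⊖  : Dyck 0
  _⇑ : Dyck d → Dyck (suc d)
  _⇓ : Dyck (suc d) → Dyck d

size : Dyck d → ℕ
size ⊖     = 1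
size (W ⇑) = suc (suc (size W))
size (W ⇓) = size W

-- The cases for ⋆ never arise from Dyck words: see `dim-⌊⌋ty`.

tyBase : Ty n → Ty n
tyBase ⋆              = ⋆
tyBase (s ─⟨ A ⟩⟶ t) = A

tyTarget : Ty n → Tm n → Tm n
tyTarget ⋆              u = u
tyTarget (s ─⟨ A ⟩⟶ t) u = t

⌊_⌋   : (W : Dyck d) → Ctx (size W)
⌊_⌋ty : (W : Dyck d) → Ty (size W)
⌊_⌋tm : (W : Dyck d) → Tm (size W)

⌊ ⊖ ⌋   = ∅ ▸ ⋆
⌊ W ⇑ ⌋ = ⌊ W ⌋ ▸ ⌊ W ⌋ty ▸ (wkTm ⌊ W ⌋tm ─⟨ wkTy ⌊ W ⌋ty ⟩⟶ var zero)
⌊ W ⇓ ⌋ = ⌊ W ⌋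

⌊ ⊖ ⌋ty   = ⋆
⌊ W ⇑ ⌋ty = wkTy (wkTm ⌊ W ⌋tm ─⟨ wkTy ⌊ W ⌋ty ⟩⟶ var zero)
⌊ W ⇓ ⌋ty = tyBase ⌊ W ⌋ty

⌊ ⊖ ⌋tm   = var zero
⌊ W ⇑ ⌋tm = var zero
⌊ W ⇓ ⌋tm = tyTarget ⌊ W ⌋ty ⌊ W ⌋tm

dim-wkTy : (A : Ty n) → dim (wkTy A) ≡ dim A
dim-wkTy ⋆              = refl
dim-wkTy (s ─⟨ A ⟩⟶ t) = cong suc (dim-wkTy A)

dim-tyBase : (A : Ty n) → dim (tyBase A) ≡ pred (dim A)
dim-tyBase ⋆              = refl
dim-tyBase (s ─⟨ A ⟩⟶ t) = refl

dim-⌊⌋ty : (W : Dyck d) → dim ⌊ W ⌋ty ≡ d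
dim-⌊⌋ty ⊖     = refl
dim-⌊⌋ty (W ⇑) =
  cong suc (trans (dim-wkTy (wkTy ⌊ W ⌋ty)) (trans (dim-wkTy ⌊ W ⌋ty) (dim-⌊⌋ty W)))
dim-⌊⌋ty (W ⇓) = trans (dim-tyBase ⌊ W ⌋ty) (cong pred (dim-⌊⌋ty W))

------------------------------------------------------------------------
-- Peaks and pruning

data Peak : Dyck d → Set where
  here : (E : Dyck d) → Peak (E ⇑ ⇓)
  _⇑ₚ  : {W : Dyck d} → Peak W → Peak (W ⇑)
  _⇓ₚ  : {W : Dyck (suc d)} → Peak W → Peak (W ⇓)

peakVar : {W : Dyck d} → Peak W → Fin (size W)
peakVar (here E) = zero
peakVar (p ⇑ₚ)   = suc (suc (peakVar p))
peakVar (p ⇓ₚ)   = peakVar p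

infix 6 _//_ _//ˢ_

_//_ : (W : Dyck d) → Peak W → Dyck d
.(E ⇑ ⇓) // here E = E
(W ⇑)    // (p ⇑ₚ) = (W // p) ⇑
(W ⇓)    // (p ⇓ₚ) = (W // p) ⇓

π : {W : Dyck d} (p : Peak W) → Sub (size W) (size (W // p))
π (here E) = ⟨ ⟨ idSub , ⌊ E ⌋tm ⟩ , idTm ⌊ E ⌋ty ⌊ E ⌋tm ⟩
π (p ⇑ₚ)   = ⟨ ⟨ wkSub (wkSub (π p)) , var (suc zero) ⟩ , var zero ⟩
π (p ⇓ₚ)   = π p

_//ˢ_ : {W : Dyck d} → Sub (size W) n → (p : Peak W) → Sub (size (W // p)) n
⟨ ⟨ σ , s ⟩ , t ⟩ //ˢ here E = σ
⟨ ⟨ σ , s ⟩ , t ⟩ //ˢ (p ⇑ₚ) = ⟨ ⟨ σ //ˢ p , s ⟩ , t ⟩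
σ                 //ˢ (p ⇓ₚ) = σ //ˢ p

------------------------------------------------------------------------
-- Equality rule sets

infixr 5 _∪ᴿ_

_∪ᴿ_ : RuleSet → RuleSet → RuleSet
(R ∪ᴿ S) Γ s t = R Γ s t ⊎ S Γ s t

NonIdentity : RuleSet → RuleSet
NonIdentity R Γ s t = R Γ s t × ¬ IsIdentity s

data dr {n} (Γ : Ctx n) : Rel (Tm n) 0ℓ where
  disc : (A : Ty n) (t : Tm n) →
         dr Γ (Coh (D (dim A)) (U (dim A)) ⦅ A , t ⦆) t

data ecr {n} (Γ : Ctx n) : Rel (Tm n) 0ℓ where
  endo : (Δ : Ctx m) (s : Tm m) (A : Ty m) (σ : Sub m n) →
         ecr Γ (Coh Δ (s ─⟨ A ⟩⟶ s) σ) (idTm (A [ σ ]ty) (s [ σ ]tm))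

data prune {n} (Γ : Ctx n) : Rel (Tm n) 0ℓ where
  prune-peak : (W : Dyck 0) (p : Peak W) (A : Ty (size W)) (σ : Sub (size W) n) →
               IsIdentity (peakVar p [ σ ]var) →
               prune Γ (Coh ⌊ W ⌋ A σ) (Coh ⌊ W // p ⌋ (A [ π p ]ty) (σ //ˢ p))

ecr′ prune′ su′ : RuleSet
ecr′   = NonIdentity ecr
prune′ = NonIdentity prune
su′    = dr ∪ᴿ prune′ ∪ᴿ ecr′

{-# OPTIONS --safe #-}
module Submission where

-- Confluence is proved by induction on the dimension N of the type of a
-- term, from termination and local confluence by Newman's lemma.
--
-- Termination: a coherence Coh Δ A σ terminates by lexicographic induction on
-- the length of Δ, the reductions of A and those of σ.  Pruning shortens Δ;
-- the rule ecr′ yields an identity on terms of lower dimension, and an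
-- identity reduces only inside its substitution.
--
-- Local confluence: the two results of a critical pair in general agree only
-- up to equality, for instance when the target of a peak is not the
-- syntactic target of the identity substituted for that peak.  These equations
-- follow from typing and relate terms of lower dimension, where confluence
-- makes equal terms joinable.
--
-- Reducts of well-formed terms are well-formed because reduction preserves
-- supports, and π p carries the boundaries of W onto those of W // p.

open import Defs
open import Data.Empty using (⊥-elim)
open import Data.Fin.Base using (Fin; zero; suc; toℕ)
import Data.Fin.Properties as Fin
open import Data.Fin.Subset using (Subset; inside; outside; ⁅_⁆; _∪_; _─_; _∈_)
open import Data.Fin.Subset.Properties
  using (∉⊥; x∈⁅x⁆; x∈⁅y⁆⇒x≡y; x∈p∪q⁻; x∈p∪q⁺; x∈p∧x∉q⇒x∈p─q)
open import Data.Maybe.Base using (Maybe; just; nothing)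
open import Data.Nat.Base using (ℕ; zero; suc; pred; _*_; _⊔_; _≤_; _<_; z≤n; s≤s)
open import Data.Nat.Induction using (<-wellFounded)
open import Data.Nat.Properties using
  ( ≤-refl; ≤-reflexive; ≤-trans; ≤-pred; ≤-<-trans; <-irrefl; <⇒≤; <⇒≱; ≮⇒≥; ≤∧≢⇒<
  ; n≤1+n; n<1+n; m<n⇒m<1+n; suc-injective; <-cmp; _<?_; _≟_
  ; m≤m⊔n; m≤n⊔m; m≤n⇒m≤n⊔o; m≤n⇒m≤o⊔n; ⊔-lub; ⊔-mono-≤)
open import Data.Product.Base using (∃-syntax; Σ-syntax; _×_; _,_; proj₁; proj₂)
open import Data.Sum.Base using (_⊎_; inj₁; inj₂)
open import Data.Unit.Base using (⊤; tt)
open import Data.Vec.Base using ([]; _∷_; here; there)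
open import Induction.WellFounded using (Acc; acc)
open import Relation.Binary.Construct.Closure.ReflexiveTransitive
  using (Star; _◅_; _◅◅_; gmap) renaming (ε to done)
open import Relation.Binary.Definitions using (tri<; tri≈; tri>)
open import Relation.Binary.PropositionalEquality
  using (_≡_; refl; sym; trans; cong; cong₂; subst; subst₂)
open import Relation.Binary.Rewriting using (Confluent)
open import Relation.Nullary.Decidable.Core using (Dec; yes; no; map′)
open import Relation.Nullary.Negation.Core using (¬_)

-- The induction on dimension rests on regularity of the operation set: the support of the source of
-- a coherence is a boundary of its context, which bounds the dimension of that context by the
-- dimension of the coherence. The components of the annotating type therefore have smaller
-- dimension, whereas the entries of the substitution may have the same dimension and are reached by
-- structural recursion. The restriction of `ecr′` and `prune′` to non-identities removes the loop
-- of `ecr` on an identity, but it also blocks the rule that would close a critical pair once a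
-- branch has become an identity. The unrestricted rules are recovered up to joinability: `ecr`
-- gives an identity back unchanged, and an identity and its pruning are joined through `ecr′`. As
-- joinability is not transitive, the overlap of two prunings needs in addition that their results
-- are never both identities.

private
  variable
    d k l m n : ℕ

-- Calculus of substitutions

cong-⟶ : {s s′ t t′ : Tm n} {A A′ : Ty n} → s ≡ s′ → A ≡ A′ → t ≡ t′ →
         s ─⟨ A ⟩⟶ t ≡ s′ ─⟨ A′ ⟩⟶ t′
cong-⟶ refl refl refl = refl

wkTy-⟨,⟩  : (A : Ty m) {σ : Sub m n} {u : Tm n} → wkTy A [ ⟨ σ , u ⟩ ]ty ≡ A [ σ ]ty
wkTm-⟨,⟩  : (t : Tm m) {σ : Sub m n} {u : Tm n} → wkTm t [ ⟨ σ , u ⟩ ]tm ≡ t [ σ ]tm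
wkSub-⟨,⟩ : (τ : Sub l m) {σ : Sub m n} {u : Tm n} → wkSub τ ∙ ⟨ σ , u ⟩ ≡ τ ∙ σ
wkTy-⟨,⟩ ⋆              = refl
wkTy-⟨,⟩ (s ─⟨ A ⟩⟶ t) = cong-⟶ (wkTm-⟨,⟩ s) (wkTy-⟨,⟩ A) (wkTm-⟨,⟩ t)
wkTm-⟨,⟩ (var x)     = refl
wkTm-⟨,⟩ (Coh Δ A τ) = cong (Coh Δ A) (wkSub-⟨,⟩ τ)
wkSub-⟨,⟩ ⟨⟩        = refl
wkSub-⟨,⟩ ⟨ τ , t ⟩ = cong₂ ⟨_,_⟩ (wkSub-⟨,⟩ τ) (wkTm-⟨,⟩ t)

var-wkSub : (x : Fin m) {σ : Sub m n} → x [ wkSub σ ]var ≡ wkTm (x [ σ ]var)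
var-wkSub zero    {⟨ σ , t ⟩} = refl
var-wkSub (suc x) {⟨ σ , t ⟩} = var-wkSub x

ty-wkSub : (A : Ty m) {σ : Sub m n} → A [ wkSub σ ]ty ≡ wkTy (A [ σ ]ty)
tm-wkSub : (t : Tm m) {σ : Sub m n} → t [ wkSub σ ]tm ≡ wkTm (t [ σ ]tm)
∙-wkSub  : (τ : Sub l m) {σ : Sub m n} → τ ∙ wkSub σ ≡ wkSub (τ ∙ σ)
ty-wkSub ⋆              = refl
ty-wkSub (s ─⟨ A ⟩⟶ t) = cong-⟶ (tm-wkSub s) (ty-wkSub A) (tm-wkSub t)
tm-wkSub (var x)     = var-wkSub x
tm-wkSub (Coh Δ A τ) = cong (Coh Δ A) (∙-wkSub τ)
∙-wkSub ⟨⟩        = refl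
∙-wkSub ⟨ τ , t ⟩ = cong₂ ⟨_,_⟩ (∙-wkSub τ) (tm-wkSub t)

var-∙ : (x : Fin l) (τ : Sub l m) {σ : Sub m n} → x [ τ ∙ σ ]var ≡ x [ τ ]var [ σ ]tm
var-∙ zero    ⟨ τ , t ⟩ = refl
var-∙ (suc x) ⟨ τ , t ⟩ = var-∙ x τ

ty-∙    : (A : Ty l) {τ : Sub l m} {σ : Sub m n} → A [ τ ∙ σ ]ty ≡ A [ τ ]ty [ σ ]ty
tm-∙    : (t : Tm l) {τ : Sub l m} {σ : Sub m n} → t [ τ ∙ σ ]tm ≡ t [ τ ]tm [ σ ]tm
∙-assoc : (ρ : Sub k l) {τ : Sub l m} {σ : Sub m n} → ρ ∙ (τ ∙ σ) ≡ ρ ∙ τ ∙ σ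
ty-∙ ⋆              = refl
ty-∙ (s ─⟨ A ⟩⟶ t) = cong-⟶ (tm-∙ s) (ty-∙ A) (tm-∙ t)
tm-∙ (var x) {τ}  = var-∙ x τ
tm-∙ (Coh Δ A ρ)  = cong (Coh Δ A) (∙-assoc ρ)
∙-assoc ⟨⟩        = refl
∙-assoc ⟨ ρ , t ⟩ = cong₂ ⟨_,_⟩ (∙-assoc ρ) (tm-∙ t)

var-idSub : (x : Fin n) → x [ idSub ]var ≡ var x
var-idSub zero    = refl
var-idSub (suc x) = trans (var-wkSub x) (cong wkTm (var-idSub x))

ty-idSub : (A : Ty n) → A [ idSub ]ty ≡ A
tm-idSub : (t : Tm n) → t [ idSub ]tm ≡ t
∙-idSub  : (σ : Sub m n) → σ ∙ idSub ≡ σ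
ty-idSub ⋆              = refl
ty-idSub (s ─⟨ A ⟩⟶ t) = cong-⟶ (tm-idSub s) (ty-idSub A) (tm-idSub t)
tm-idSub (var x)     = var-idSub x
tm-idSub (Coh Δ A σ) = cong (Coh Δ A) (∙-idSub σ)
∙-idSub ⟨⟩        = refl
∙-idSub ⟨ σ , t ⟩ = cong₂ ⟨_,_⟩ (∙-idSub σ) (tm-idSub t)

idSub-∙ : (σ : Sub m n) → idSub ∙ σ ≡ σ
idSub-∙ ⟨⟩        = refl
idSub-∙ ⟨ σ , t ⟩ = cong ⟨_, t ⟩ (trans (wkSub-⟨,⟩ idSub) (idSub-∙ σ))

ty-wk : (A : Ty n) → A [ wkSub idSub ]ty ≡ wkTy A
ty-wk A = trans (ty-wkSub A) (cong wkTy (ty-idSub A))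

tm-wk : (t : Tm n) → t [ wkSub idSub ]tm ≡ wkTm t
tm-wk t = trans (tm-wkSub t) (cong wkTm (tm-idSub t))

dim-[] : (A : Ty m) {σ : Sub m n} → dim (A [ σ ]ty) ≡ dim A
dim-[] ⋆              = refl
dim-[] (s ─⟨ A ⟩⟶ t) = cong suc (dim-[] A)

tyBase-[] : (A : Ty m) {σ : Sub m n} → tyBase (A [ σ ]ty) ≡ tyBase A [ σ ]ty
tyBase-[] ⋆              = refl
tyBase-[] (s ─⟨ A ⟩⟶ t) = refl

tyTarget-[] : (A : Ty m) {u : Tm m} {σ : Sub m n} →
              tyTarget (A [ σ ]ty) (u [ σ ]tm) ≡ tyTarget A u [ σ ]tm
tyTarget-[] ⋆              = refl
tyTarget-[] (s ─⟨ A ⟩⟶ t) = refl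

wkTm-var : {t : Tm n} {x : Fin (suc n)} → wkTm t ≡ var x → ∃[ y ] t ≡ var y × x ≡ suc y
wkTm-var {t = var y} refl = y , refl , refl

-- Discs and identities

-- `dim (A [ σ ]ty)` equals `dim A` only propositionally, so substitutions out of discs are compared
-- together with the dimension of the disc.
DiscSub : ℕ → Set
DiscSub n = Σ[ k ∈ ℕ ] Sub (suc (k * 2)) n

discSub : Ty n → Tm n → DiscSub n
discSub A t = dim A , ⦅ A , t ⦆

discCoh : (∀ k → Ty (suc (k * 2))) → DiscSub n → Tm n
discCoh B (k , σ) = Coh (D k) (B k) σ

idTy : ∀ k → Ty (suc (k * 2))
idTy k = var zero ─⟨ U k ⟩⟶ var zero

discSub-[] : (A : Ty m) (t : Tm m) {σ : Sub m n} →
             (dim A , ⦅ A , t ⦆ ∙ σ) ≡ discSub (A [ σ ]ty) (t [ σ ]tm)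
discSub-[] ⋆              t = refl
discSub-[] (s ─⟨ A ⟩⟶ u) t {σ} =
  cong (λ { (k , τ) → suc k , ⟨ ⟨ τ , u [ σ ]tm ⟩ , t [ σ ]tm ⟩ }) (discSub-[] A s)

idTm-[] : (A : Ty m) (t : Tm m) {σ : Sub m n} →
          idTm A t [ σ ]tm ≡ idTm (A [ σ ]ty) (t [ σ ]tm)
idTm-[] A t = cong (discCoh idTy) (discSub-[] A t)

U-[] : (A : Ty n) {t : Tm n} → U (dim A) [ ⦅ A , t ⦆ ]ty ≡ A
U-[] ⋆              = refl
U-[] (s ─⟨ A ⟩⟶ u) {t} = cong-⟶ (zero-[] A)
  (trans (wkTy-⟨,⟩ (wkTy (U (dim A)))) (trans (wkTy-⟨,⟩ (U (dim A))) (U-[] A)))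
  refl
  where
  zero-[] : (A : Ty _) {s : Tm _} → zero [ ⦅ A , s ⦆ ]var ≡ s
  zero-[] ⋆              = refl
  zero-[] (s ─⟨ A ⟩⟶ u) = refl

zero-[] : (A : Ty n) {t : Tm n} → zero [ ⦅ A , t ⦆ ]var ≡ t
zero-[] ⋆              = refl
zero-[] (s ─⟨ A ⟩⟶ u) = refl

idTy-[] : (A : Ty n) {t : Tm n} → idTy (dim A) [ ⦅ A , t ⦆ ]ty ≡ t ─⟨ A ⟩⟶ t
idTy-[] A = cong-⟶ (zero-[] A) (U-[] A) (zero-[] A)

-- Every substitution out of a disc is of the form ⦅ A , t ⦆, so that being
-- an identity is a property of the context and the type of a coherence only.
discSub-surjective : ∀ k (σ : Sub (suc (k * 2)) n) → ∃[ A ] ∃[ t ] (k , σ) ≡ discSub A t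
discSub-surjective zero    ⟨ ⟨⟩ , t ⟩ = ⋆ , t , refl
discSub-surjective (suc k) ⟨ ⟨ σ , u ⟩ , t ⟩ with discSub-surjective k σ
... | A , s , refl = s ─⟨ A ⟩⟶ u , t , refl

discCoh-identity : ∀ k (σ : Sub (suc (k * 2)) n) → IsIdentity (Coh (D k) (idTy k) σ)
discCoh-identity k σ with discSub-surjective k σ
... | A , t , refl = A , t , refl

-- Unification does not invert the sizes `suc (k * 2)` of discs; once `k ≡ l` is extracted,
-- equations between discs can be matched on.
double-injective : ∀ {k l} → k * 2 ≡ l * 2 → k ≡ l
double-injective {zero}  {zero}  _  = refl
double-injective {suc k} {suc l} eq = cong suc (double-injective (cong (λ n → pred (pred n)) eq))

-- A coherence hides the length of its context. Packing its data with that length makes an equality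
-- of coherences a single equation; variables get a dummy value so that the extraction is total.
CohData : ℕ → Set
CohData n = Σ[ m ∈ ℕ ] Ctx m × Ty m × Sub m n

cohData : Tm n → CohData n
cohData (var x)     = 0 , ∅ , ⋆ , ⟨⟩
cohData (Coh Δ A σ) = _ , Δ , A , σ

Coh-injective : {Δ : Ctx l} {Θ : Ctx m} {A : Ty l} {B : Ty m} {σ : Sub l n} {τ : Sub m n} →
                Coh Δ A σ ≡ Coh Θ B τ → (l , Δ , A , σ) ≡ (m , Θ , B , τ)
Coh-injective = cong cohData

-- The side conditions of `ecr′` and `prune′` are negative, so their stability under substitution
-- requires that substitution reflects identities, not only that it preserves them.
identity-stable : (Δ : Ctx l) (A : Ty l) {σ : Sub l m} {τ : Sub l n} →
                  IsIdentity (Coh Δ A σ) → IsIdentity (Coh Δ A τ)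
identity-stable Δ A {τ = τ} (B , t , eq) with Coh-injective eq
... | refl = discCoh-identity (dim B) τ

-- Stability of the rules under substitution

//ˢ-∙ : {W : Dyck d} (p : Peak W) (σ : Sub (size W) m) {τ : Sub m n} →
        (σ //ˢ p) ∙ τ ≡ (σ ∙ τ) //ˢ p
//ˢ-∙ (here E) ⟨ ⟨ σ , s ⟩ , t ⟩ = refl
//ˢ-∙ (p ⇑ₚ)   ⟨ ⟨ σ , s ⟩ , t ⟩ = cong (λ ρ → ⟨ ⟨ ρ , _ ⟩ , _ ⟩) (//ˢ-∙ p σ)
//ˢ-∙ (p ⇓ₚ)   σ = //ˢ-∙ p σ

identity-[] : {t : Tm m} {σ : Sub m n} → IsIdentity t → IsIdentity (t [ σ ]tm)
identity-[] (A , s , refl) = A [ _ ]ty , s [ _ ]tm , idTm-[] A s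

dr-[] : {Γ : Ctx m} {Δ : Ctx n} {s t : Tm m} (σ : Sub m n) →
        dr Γ s t → dr Δ (s [ σ ]tm) (t [ σ ]tm)
dr-[] {Δ = Δ} σ (disc A t) =
  subst (λ s → dr Δ s (t [ σ ]tm)) (cong (discCoh U) (sym (discSub-[] A t)))
    (disc (A [ σ ]ty) (t [ σ ]tm))

prune-[] : {Γ : Ctx m} {Δ : Ctx n} {s t : Tm m} (σ : Sub m n) →
           prune′ Γ s t → prune′ Δ (s [ σ ]tm) (t [ σ ]tm)
prune-[] {Δ = Δ} σ (prune-peak W p A τ isId , nonId) =
  subst (λ ρ → prune Δ (Coh ⌊ W ⌋ A (τ ∙ σ)) (Coh ⌊ W // p ⌋ (A [ π p ]ty) ρ))
    (sym (//ˢ-∙ p τ))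
    (prune-peak W p A (τ ∙ σ) (subst IsIdentity (sym (var-∙ (peakVar p) τ)) (identity-[] isId)))
  , λ q → nonId (identity-stable ⌊ W ⌋ A q)

ecr-[] : {Γ : Ctx m} {Δ : Ctx n} {s t : Tm m} (σ : Sub m n) →
         ecr′ Γ s t → ecr′ Δ (s [ σ ]tm) (t [ σ ]tm)
ecr-[] {Δ = Δ} σ (endo Θ s A τ , nonId) =
  subst (ecr Δ (Coh Θ (s ─⟨ A ⟩⟶ s) (τ ∙ σ)))
    (trans (cong₂ idTm (ty-∙ A) (tm-∙ s)) (sym (idTm-[] (A [ τ ]ty) (s [ τ ]tm))))
    (endo Θ s A (τ ∙ σ))
  , λ q → nonId (identity-stable Θ (s ─⟨ A ⟩⟶ s) q)

su′-[] : {Γ : Ctx m} {Δ : Ctx n} {s t : Tm m} (σ : Sub m n) →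
         su′ Γ s t → su′ Δ (s [ σ ]tm) (t [ σ ]tm)
su′-[] σ (inj₁ r)        = inj₁ (dr-[] σ r)
su′-[] σ (inj₂ (inj₁ r)) = inj₂ (inj₁ (prune-[] σ r))
su′-[] σ (inj₂ (inj₂ r)) = inj₂ (inj₂ (ecr-[] σ r))

-- Typing and equality over an arbitrary rule set

module Typing (R : RuleSet) where

  open Catt R

  ty-refl  : {Γ : Ctx n} (A : Ty n) → Γ ⊢ty A ≈ A
  tm-refl  : {Γ : Ctx n} (t : Tm n) → Γ ⊢tm t ≈ t
  sub-refl : {Γ : Ctx n} (σ : Sub m n) → Γ ⊢sub σ ≈ σ
  ty-refl ⋆              = ≈-⋆
  ty-refl (s ─⟨ A ⟩⟶ t) = ≈-⟶ (tm-refl s) (ty-refl A) (tm-refl t)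
  tm-refl (var x)     = ≈-var x
  tm-refl (Coh Δ A σ) = ≈-coh (ty-refl A) (sub-refl σ)
  sub-refl ⟨⟩        = ≈-⟨⟩
  sub-refl ⟨ σ , t ⟩ = ≈-, (sub-refl σ) (tm-refl t)

  ty-reflexive : {Γ : Ctx n} {A B : Ty n} → A ≡ B → Γ ⊢ty A ≈ B
  ty-reflexive refl = ty-refl _

  sub-reflexive : {Γ : Ctx n} {σ τ : Sub m n} → σ ≡ τ → Γ ⊢sub σ ≈ τ
  sub-reflexive refl = sub-refl _

  ty-sym : {Γ : Ctx n} {A B : Ty n} → Γ ⊢ty A ≈ B → Γ ⊢ty B ≈ A
  ty-sym ≈-⋆         = ≈-⋆
  ty-sym (≈-⟶ p q r) = ≈-⟶ (≈-sym p) (ty-sym q) (≈-sym r)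

  ty-trans : {Γ : Ctx n} {A B C : Ty n} → Γ ⊢ty A ≈ B → Γ ⊢ty B ≈ C → Γ ⊢ty A ≈ C
  ty-trans ≈-⋆         ≈-⋆            = ≈-⋆
  ty-trans (≈-⟶ p q r) (≈-⟶ p′ q′ r′) = ≈-⟶ (≈-trans p p′) (ty-trans q q′) (≈-trans r r′)

  sub-sym : {Γ : Ctx n} {σ τ : Sub m n} → Γ ⊢sub σ ≈ τ → Γ ⊢sub τ ≈ σ
  sub-sym ≈-⟨⟩       = ≈-⟨⟩
  sub-sym (≈-, p q)  = ≈-, (sub-sym p) (≈-sym q)

  dim-≈ : {Γ : Ctx n} {A B : Ty n} → Γ ⊢ty A ≈ B → dim A ≡ dim B
  dim-≈ ≈-⋆         = refl
  dim-≈ (≈-⟶ _ p _) = cong suc (dim-≈ p)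

  ty-[]-≈  : {Γ : Ctx n} (A : Ty m) {σ τ : Sub m n} → Γ ⊢sub σ ≈ τ → Γ ⊢ty A [ σ ]ty ≈ A [ τ ]ty
  tm-[]-≈  : {Γ : Ctx n} (t : Tm m) {σ τ : Sub m n} → Γ ⊢sub σ ≈ τ → Γ ⊢tm t [ σ ]tm ≈ t [ τ ]tm
  ∙-≈      : {Γ : Ctx n} (ρ : Sub l m) {σ τ : Sub m n} → Γ ⊢sub σ ≈ τ → Γ ⊢sub ρ ∙ σ ≈ ρ ∙ τ
  var-[]-≈ : {Γ : Ctx n} (x : Fin m) {σ τ : Sub m n} → Γ ⊢sub σ ≈ τ →
             Γ ⊢tm x [ σ ]var ≈ x [ τ ]var
  ty-[]-≈ ⋆              p = ≈-⋆
  ty-[]-≈ (s ─⟨ A ⟩⟶ t) p = ≈-⟶ (tm-[]-≈ s p) (ty-[]-≈ A p) (tm-[]-≈ t p)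
  tm-[]-≈ (var x)     p = var-[]-≈ x p
  tm-[]-≈ (Coh Δ A ρ) p = ≈-coh (ty-refl A) (∙-≈ ρ p)
  ∙-≈ ⟨⟩        p = ≈-⟨⟩
  ∙-≈ ⟨ ρ , t ⟩ p = ≈-, (∙-≈ ρ p) (tm-[]-≈ t p)
  var-[]-≈ zero    (≈-, p q) = q
  var-[]-≈ (suc x) (≈-, p q) = var-[]-≈ x p

  -- Matching on this relation identifies the two dimensions, which for discs of equal types agree
  -- only by a proof.
  data DiscSub≈ (Γ : Ctx n) : DiscSub n → DiscSub n → Set where
    discSub≈ : ∀ {k σ τ} → Γ ⊢sub σ ≈ τ → DiscSub≈ Γ (k , σ) (k , τ)

  discSub-≈ : {Γ : Ctx n} {A B : Ty n} {s t : Tm n} → Γ ⊢ty A ≈ B → Γ ⊢tm s ≈ t →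
              DiscSub≈ Γ (discSub A s) (discSub B t)
  discSub-≈ ≈-⋆ q = discSub≈ (≈-, ≈-⟨⟩ q)
  discSub-≈ {A = s ─⟨ A ⟩⟶ _} {B = s′ ─⟨ B ⟩⟶ _} (≈-⟶ p r p′) q
    with dim A | ⦅ A , s ⦆ | dim B | ⦅ B , s′ ⦆ | discSub-≈ r p
  ... | _ | _ | _ | _ | discSub≈ e = discSub≈ (≈-, (≈-, e p′) q)

  idTm-≈ : {Γ : Ctx n} {A B : Ty n} {s t : Tm n} → Γ ⊢ty A ≈ B → Γ ⊢tm s ≈ t →
           Γ ⊢tm idTm A s ≈ idTm B t
  idTm-≈ p q = go (discSub-≈ p q)
    where
    go : ∀ {x y} → DiscSub≈ _ x y → _ ⊢tm discCoh idTy x ≈ discCoh idTy y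
    go (discSub≈ e) = ≈-coh (ty-refl _) e

  record CohInv (Γ : Ctx n) (Δ : Ctx m) (A : Ty m) (σ : Sub m n) (B : Ty n) : Set where
    constructor cohInv
    field
      {src tgt}  : Tm m
      {arr}      : Ty m
      arrow      : A ≡ src ─⟨ arr ⟩⟶ tgt
      ps-ctx     : Δ ⊢ps
      ty-typed   : Δ ⊢ty A
      sub-typed  : Γ ⊢sub σ ∶ Δ
      operation  : 𝒪 Δ (Supp Δ src) (Supp Δ tgt)
      type-≈     : Γ ⊢ty A [ σ ]ty ≈ B

  coh-inv : {Γ : Ctx n} {Δ : Ctx m} {A : Ty m} {σ : Sub m n} {B : Ty n} →
            Γ ⊢tm Coh Δ A σ ∶ B → CohInv Γ Δ A σ B
  coh-inv (tm-conv p q) with coh-inv p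
  ... | cohInv e a b c o r = cohInv e a b c o (ty-trans r q)
  coh-inv (tm-coh a b c o) = cohInv refl a b c o (ty-refl _)

  var-inv : {Γ : Ctx n} {x : Fin n} {B : Ty n} → Γ ⊢tm var x ∶ B → Γ ⊢ty lookup Γ x ≈ B
  var-inv (tm-var x)    = ty-refl _
  var-inv (tm-conv p q) = ty-trans (var-inv p) q

  type-unique : {Γ : Ctx n} (t : Tm n) {A B : Ty n} → Γ ⊢tm t ∶ A → Γ ⊢tm t ∶ B → Γ ⊢ty A ≈ B
  type-unique (var x)     p q = ty-trans (ty-sym (var-inv p)) (var-inv q)
  type-unique (Coh _ _ _) p q =
    ty-trans (ty-sym (CohInv.type-≈ (coh-inv p))) (CohInv.type-≈ (coh-inv q))

  tm-cast : {Γ : Ctx n} {t : Tm n} {A B : Ty n} → A ≡ B → Γ ⊢tm t ∶ A → Γ ⊢tm t ∶ B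
  tm-cast refl p = p

  sub-var : {Γ : Ctx n} {Δ : Ctx m} {σ : Sub m n} → Γ ⊢sub σ ∶ Δ →
            ∀ x → Γ ⊢tm x [ σ ]var ∶ lookup Δ x [ σ ]ty
  sub-var {Δ = Δ ▸ A} (sub-, p q) zero    = tm-cast (sym (wkTy-⟨,⟩ A)) q
  sub-var {Δ = Δ ▸ A} (sub-, p q) (suc x) = tm-cast (sym (wkTy-⟨,⟩ (lookup Δ x))) (sub-var p x)

  disc-inv : {Γ : Ctx n} (A : Ty n) {t : Tm n} → Γ ⊢sub ⦅ A , t ⦆ ∶ D (dim A) →
             (Γ ⊢ty A) × (Γ ⊢tm t ∶ A)
  disc-inv ⋆              (sub-, sub-⟨⟩ p) = ty-⋆ , p
  disc-inv (s ─⟨ A ⟩⟶ u) (sub-, (sub-, p q) r) with disc-inv A p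
  ... | a , b = ty-⟶ a b (tm-cast (U-[] A) q) ,
    tm-cast (cong-⟶ (zero-[] A) (trans (wkTy-⟨,⟩ (U (dim A))) (U-[] A)) refl) r

  disc-typed : {Γ : Ctx n} (A : Ty n) {t : Tm n} → Γ ⊢ty A → Γ ⊢tm t ∶ A →
               Γ ⊢sub ⦅ A , t ⦆ ∶ D (dim A)
  disc-typed ⋆              a p = sub-, sub-⟨⟩ p
  disc-typed (s ─⟨ A ⟩⟶ u) (ty-⟶ a b c) p =
    sub-, (sub-, (disc-typed A a b) (tm-cast (sym (U-[] A)) c))
      (tm-cast (sym (cong-⟶ (zero-[] A) (trans (wkTy-⟨,⟩ (U (dim A))) (U-[] A)) refl)) p)

  id-inv : {Γ : Ctx n} (A : Ty n) {t : Tm n} {B : Ty n} → Γ ⊢tm idTm A t ∶ B →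
           (Γ ⊢ty A) × (Γ ⊢tm t ∶ A) × (Γ ⊢ty t ─⟨ A ⟩⟶ t ≈ B)
  id-inv A p with coh-inv p
  ... | cohInv refl _ _ c _ r with disc-inv A c
  ... | a , b = a , b , ty-trans (ty-reflexive (sym (idTy-[] A))) r

-- Free variables

∪-inj₁ : {p q : Subset n} {x : Fin n} → x ∈ p → x ∈ p ∪ q
∪-inj₁ e = x∈p∪q⁺ (inj₁ e)

∪-inj₂ : {p q : Subset n} {x : Fin n} → x ∈ q → x ∈ p ∪ q
∪-inj₂ {p = p} e = x∈p∪q⁺ {p = p} (inj₂ e)

data ∈-⟶ (x : Fin n) (s : Tm n) (A : Ty n) (t : Tm n) : Set where
  in-src : x ∈ FVTm s → ∈-⟶ x s A t
  in-ty  : x ∈ FVTy A → ∈-⟶ x s A t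
  in-tgt : x ∈ FVTm t → ∈-⟶ x s A t

FV-⟶⁻ : {x : Fin n} (s : Tm n) (A : Ty n) (t : Tm n) → x ∈ FVTy (s ─⟨ A ⟩⟶ t) → ∈-⟶ x s A t
FV-⟶⁻ s A t e with x∈p∪q⁻ (FVTm s) (FVTy A ∪ FVTm t) e
... | inj₁ e′ = in-src e′
... | inj₂ e′ with x∈p∪q⁻ (FVTy A) (FVTm t) e′
...   | inj₁ e″ = in-ty e″
...   | inj₂ e″ = in-tgt e″

FV-⟶⁺ : {x : Fin n} {s : Tm n} {A : Ty n} {t : Tm n} → ∈-⟶ x s A t → x ∈ FVTy (s ─⟨ A ⟩⟶ t)
FV-⟶⁺ (in-src e) = ∪-inj₁ e
FV-⟶⁺ {s = s} (in-ty e)  = ∪-inj₂ {p = FVTm s} (∪-inj₁ e)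
FV-⟶⁺ {s = s} {A} (in-tgt e) = ∪-inj₂ {p = FVTm s} (∪-inj₂ {p = FVTy A} e)

FVTy-wk  : (A : Ty n) → FVTy (wkTy A) ≡ outside ∷ FVTy A
FVTm-wk  : (t : Tm n) → FVTm (wkTm t) ≡ outside ∷ FVTm t
FVSub-wk : (σ : Sub m n) → FVSub (wkSub σ) ≡ outside ∷ FVSub σ
FVTy-wk ⋆              = refl
FVTy-wk (s ─⟨ A ⟩⟶ t) rewrite FVTm-wk s | FVTy-wk A | FVTm-wk t = refl
FVTm-wk (var x)     = refl
FVTm-wk (Coh Δ A σ) = FVSub-wk σ
FVSub-wk ⟨⟩        = refl
FVSub-wk ⟨ σ , t ⟩ rewrite FVSub-wk σ | FVTm-wk t = refl

data Wk (P : Fin n → Set) : Fin (suc n) → Set where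
  wk : ∀ {x} → P x → Wk P (suc x)

wk⁻ : {p : Subset n} {q : Subset (suc n)} {x : Fin (suc n)} → q ≡ outside ∷ p → x ∈ q → Wk (_∈ p) x
wk⁻ refl (there e) = wk e

wk⁺ : {p : Subset n} {q : Subset (suc n)} {x : Fin n} → q ≡ outside ∷ p → x ∈ p → suc x ∈ q
wk⁺ refl e = there e

FVTy-[]⁻  : {w : Fin n} (A : Ty m) {σ : Sub m n} → w ∈ FVTy (A [ σ ]ty) →
            ∃[ x ] x ∈ FVTy A × w ∈ FVTm (x [ σ ]var)
FVTm-[]⁻  : {w : Fin n} (t : Tm m) {σ : Sub m n} → w ∈ FVTm (t [ σ ]tm) →
            ∃[ x ] x ∈ FVTm t × w ∈ FVTm (x [ σ ]var)
FVSub-∙⁻  : {w : Fin n} (τ : Sub l m) {σ : Sub m n} → w ∈ FVSub (τ ∙ σ) →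
            ∃[ x ] x ∈ FVSub τ × w ∈ FVTm (x [ σ ]var)
FVTy-[]⁻ ⋆ e = ⊥-elim (∉⊥ e)
FVTy-[]⁻ (s ─⟨ A ⟩⟶ t) e with FV-⟶⁻ (s [ _ ]tm) (A [ _ ]ty) (t [ _ ]tm) e
... | in-src e′ with FVTm-[]⁻ s e′
...   | x , p , q = x , FV-⟶⁺ {s = s} {A} {t} (in-src p) , q
FVTy-[]⁻ (s ─⟨ A ⟩⟶ t) e | in-ty e′ with FVTy-[]⁻ A e′
...   | x , p , q = x , FV-⟶⁺ {s = s} {A} {t} (in-ty p) , q
FVTy-[]⁻ (s ─⟨ A ⟩⟶ t) e | in-tgt e′ with FVTm-[]⁻ t e′
...   | x , p , q = x , FV-⟶⁺ {s = s} {A} {t} (in-tgt p) , q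
FVTm-[]⁻ (var x)     e = x , x∈⁅x⁆ x , e
FVTm-[]⁻ (Coh Δ A τ) e = FVSub-∙⁻ τ e
FVSub-∙⁻ ⟨⟩ e = ⊥-elim (∉⊥ e)
FVSub-∙⁻ ⟨ τ , t ⟩ {σ} e with x∈p∪q⁻ (FVSub (τ ∙ σ)) (FVTm (t [ σ ]tm)) e
... | inj₁ e′ with FVSub-∙⁻ τ e′
...   | x , p , q = x , ∪-inj₁ p , q
FVSub-∙⁻ ⟨ τ , t ⟩ e | inj₂ e′ with FVTm-[]⁻ t e′
...   | x , p , q = x , ∪-inj₂ {p = FVSub τ} p , q

FVTy-[]⁺  : {x : Fin m} {w : Fin n} (A : Ty m) {σ : Sub m n} →
            x ∈ FVTy A → w ∈ FVTm (x [ σ ]var) → w ∈ FVTy (A [ σ ]ty)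
FVTm-[]⁺  : {x : Fin m} {w : Fin n} (t : Tm m) {σ : Sub m n} →
            x ∈ FVTm t → w ∈ FVTm (x [ σ ]var) → w ∈ FVTm (t [ σ ]tm)
FVSub-∙⁺  : {x : Fin m} {w : Fin n} (τ : Sub l m) {σ : Sub m n} →
            x ∈ FVSub τ → w ∈ FVTm (x [ σ ]var) → w ∈ FVSub (τ ∙ σ)
FVTy-[]⁺ ⋆ e q = ⊥-elim (∉⊥ e)
FVTy-[]⁺ (s ─⟨ A ⟩⟶ t) {σ} e q with FV-⟶⁻ s A t e
... | in-src e′ = FV-⟶⁺ {s = s [ σ ]tm} {A [ σ ]ty} {t [ σ ]tm} (in-src (FVTm-[]⁺ s e′ q))
... | in-ty e′  = FV-⟶⁺ {s = s [ σ ]tm} {A [ σ ]ty} {t [ σ ]tm} (in-ty (FVTy-[]⁺ A e′ q))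
... | in-tgt e′ = FV-⟶⁺ {s = s [ σ ]tm} {A [ σ ]ty} {t [ σ ]tm} (in-tgt (FVTm-[]⁺ t e′ q))
FVTm-[]⁺ (var x) {σ} e q = subst (λ y → _ ∈ FVTm (y [ σ ]var)) (x∈⁅y⁆⇒x≡y x e) q
FVTm-[]⁺ (Coh Δ A τ) e q = FVSub-∙⁺ τ e q
FVSub-∙⁺ ⟨⟩ e q = ⊥-elim (∉⊥ e)
FVSub-∙⁺ ⟨ τ , t ⟩ {σ} e q with x∈p∪q⁻ (FVSub τ) (FVTm t) e
... | inj₁ e′ = ∪-inj₁ (FVSub-∙⁺ τ e′ q)
... | inj₂ e′ = ∪-inj₂ {p = FVSub (τ ∙ σ)} (FVTm-[]⁺ t e′ q)

FV-var-⊆ : {w : Fin n} (x : Fin m) (σ : Sub m n) → w ∈ FVTm (x [ σ ]var) → w ∈ FVSub σ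
FV-var-⊆ zero    ⟨ σ , t ⟩ e = ∪-inj₂ {p = FVSub σ} e
FV-var-⊆ (suc x) ⟨ σ , t ⟩ e = ∪-inj₁ (FV-var-⊆ x σ e)

FVSub⁻ : {w : Fin n} (σ : Sub m n) → w ∈ FVSub σ → ∃[ x ] w ∈ FVTm (x [ σ ]var)
FVSub⁻ ⟨⟩ e = ⊥-elim (∉⊥ e)
FVSub⁻ ⟨ σ , t ⟩ e with x∈p∪q⁻ (FVSub σ) (FVTm t) e
... | inj₁ e′ with FVSub⁻ σ e′
...   | x , q = suc x , q
FVSub⁻ ⟨ σ , t ⟩ e | inj₂ e′ = zero , e′

FV-⦅⦆⁻ : {w : Fin n} (A : Ty n) {t : Tm n} → w ∈ FVSub ⦅ A , t ⦆ → w ∈ FVTy A ⊎ w ∈ FVTm t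
FV-⦅⦆⁻ ⋆ {t} e with x∈p∪q⁻ _ (FVTm t) e
... | inj₁ e′ = ⊥-elim (∉⊥ e′)
... | inj₂ e′ = inj₂ e′
FV-⦅⦆⁻ (s ─⟨ A ⟩⟶ u) {t} e with x∈p∪q⁻ (FVSub ⦅ A , s ⦆ ∪ FVTm u) (FVTm t) e
... | inj₂ e′ = inj₂ e′
... | inj₁ e′ with x∈p∪q⁻ (FVSub ⦅ A , s ⦆) (FVTm u) e′
...   | inj₂ e″ = inj₁ (FV-⟶⁺ {s = s} {A} {u} (in-tgt e″))
...   | inj₁ e″ with FV-⦅⦆⁻ A e″
...     | inj₁ f = inj₁ (FV-⟶⁺ {s = s} {A} {u} (in-ty f))
...     | inj₂ f = inj₁ (FV-⟶⁺ {s = s} {A} {u} (in-src f))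

FV-⦅⦆-tm : {w : Fin n} (A : Ty n) {t : Tm n} → w ∈ FVTm t → w ∈ FVSub ⦅ A , t ⦆
FV-⦅⦆-tm ⋆ e = ∪-inj₂ {p = Data.Fin.Subset.⊥} e
FV-⦅⦆-tm (s ─⟨ A ⟩⟶ u) e = ∪-inj₂ {p = FVSub ⦅ A , s ⦆ ∪ FVTm u} e

-- Dyck words and the types of their contexts

lookupDim : (Γ : Ctx n) → Fin n → ℕ
lookupDim Γ x = dim (lookup Γ x)

lookupDim≤dimCtx : (Γ : Ctx n) (x : Fin n) → lookupDim Γ x ≤ dimCtx Γ
lookupDim≤dimCtx (Γ ▸ A) zero    =
  m≤n⇒m≤o⊔n (dimCtx Γ) (≤-reflexive (dim-wkTy A))
lookupDim≤dimCtx (Γ ▸ A) (suc x) =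
  m≤n⇒m≤n⊔o (dim A) (≤-trans (≤-reflexive (dim-wkTy (lookup Γ x))) (lookupDim≤dimCtx Γ x))

-- All types in ps-contexts and discs are of this form. Such types are normal, equality with them is
-- decidable, and their variables have smaller dimension than the type itself.
data VarTy (Γ : Ctx n) : Ty n → Set where
  ⋆ᵛ : VarTy Γ ⋆
  ⟶ᵛ : ∀ {A x y} → VarTy Γ A → lookup Γ x ≡ A → lookup Γ y ≡ A →
       VarTy Γ (var x ─⟨ A ⟩⟶ var y)

VarTy-wk : {Γ : Ctx n} {A B : Ty n} → VarTy Γ A → VarTy (Γ ▸ B) (wkTy A)
VarTy-wk ⋆ᵛ         = ⋆ᵛ
VarTy-wk (⟶ᵛ p q r) = ⟶ᵛ (VarTy-wk p) (cong wkTy q) (cong wkTy r)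

record PsVar {n} (Γ : Ctx n) (t : Tm n) (A : Ty n) : Set where
  constructor psVar
  field
    {index} : Fin n
    is-var  : t ≡ var index
    looks   : lookup Γ index ≡ A
    var-ty  : VarTy Γ A

dyck-var : (W : Dyck d) → PsVar ⌊ W ⌋ ⌊ W ⌋tm ⌊ W ⌋ty
dyck-var ⊖ = psVar refl refl ⋆ᵛ
dyck-var (W ⇑) with dyck-var W
... | psVar eq l v rewrite eq = psVar refl refl (VarTy-wk (⟶ᵛ (VarTy-wk v) (cong wkTy l) refl))
dyck-var (_⇓ {d} W) = go (dyck-var W) (dim-⌊⌋ty W)
  where
  -- The equation on dimensions excludes `⋆`, where `tyBase` and `tyTarget` only return defaults.
  go : ∀ {n} {Γ : Ctx n} {t A} → PsVar Γ t A → dim A ≡ suc d →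
       PsVar Γ (tyTarget A t) (tyBase A)
  go (psVar _ _ (⟶ᵛ v _ r)) _ = psVar refl r v

lookup-VarTy : (W : Dyck d) (x : Fin (size W)) → VarTy ⌊ W ⌋ (lookup ⌊ W ⌋ x)
lookup-VarTy ⊖     zero = ⋆ᵛ
lookup-VarTy (W ⇑) zero = PsVar.var-ty (dyck-var (W ⇑))
lookup-VarTy (W ⇑) (suc zero) = VarTy-wk (VarTy-wk (PsVar.var-ty (dyck-var W)))
lookup-VarTy (W ⇑) (suc (suc x)) = VarTy-wk (VarTy-wk (lookup-VarTy W x))
lookup-VarTy (W ⇓) x = lookup-VarTy W x

VarTy-FV : {Γ : Ctx n} {A : Ty n} {x : Fin n} → VarTy Γ A → x ∈ FVTy A → lookupDim Γ x < dim A
VarTy-FV ⋆ᵛ e = ⊥-elim (∉⊥ e)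
VarTy-FV (⟶ᵛ {A} {x} {y} v p q) e with FV-⟶⁻ (var x) A (var y) e
... | in-src f rewrite x∈⁅y⁆⇒x≡y x f | p = ≤-refl
... | in-ty  f = m<n⇒m<1+n (VarTy-FV v f)
... | in-tgt f rewrite x∈⁅y⁆⇒x≡y y f | q = ≤-refl

lookup-FV : (W : Dyck d) {x y : Fin (size W)} → y ∈ FVTy (lookup ⌊ W ⌋ x) →
            lookupDim ⌊ W ⌋ y < lookupDim ⌊ W ⌋ x
lookup-FV W {x} e = VarTy-FV (lookup-VarTy W x) e

lastDim : Ctx n → ℕ
lastDim ∅       = 0
lastDim (Γ ▸ A) = dim A

depth≤lastDim : (W : Dyck d) → d ≤ lastDim ⌊ W ⌋
depth≤lastDim ⊖     = z≤n
depth≤lastDim (W ⇑) = s≤s (≤-reflexive (sym (trans (dim-wkTy ⌊ W ⌋ty) (dim-⌊⌋ty W))))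
depth≤lastDim (W ⇓) = ≤-trans (n≤1+n _) (depth≤lastDim W)

lastDim-⇑ : (W : Dyck d) → lastDim ⌊ W ⇑ ⌋ ≡ suc d
lastDim-⇑ W = cong suc (trans (dim-wkTy ⌊ W ⌋ty) (dim-⌊⌋ty W))

AnyCtx : Set
AnyCtx = Σ[ n ∈ ℕ ] Ctx n

initCtx : AnyCtx → AnyCtx
initCtx (_ , ∅)     = _ , ∅
initCtx (_ , Γ ▸ A) = _ , Γ

-- The context forgets `⇓`, but the depth recovers it: after `⇑` the depth equals the dimension of
-- the last entry, while after `⇓` it is strictly smaller.
⌊⌋-injective : (V W : Dyck d) → (size V , ⌊ V ⌋) ≡ (size W , ⌊ W ⌋) → V ≡ W
⌊⌋-injective ⊖ ⊖ eq = refl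
⌊⌋-injective (V ⇑) (W ⇑) eq =
  cong _⇑ (⌊⌋-injective V W (cong (λ Γ → initCtx (initCtx Γ)) eq))
⌊⌋-injective (V ⇓) (W ⇓) eq = cong _⇓ (⌊⌋-injective V W eq)
⌊⌋-injective ⊖ (W ⇓) eq
  with subst (1 ≤_) (sym (cong (λ Γ → lastDim (proj₂ Γ)) eq)) (depth≤lastDim W)
... | ()
⌊⌋-injective (W ⇓) ⊖ eq
  with subst (1 ≤_) (cong (λ Γ → lastDim (proj₂ Γ)) eq) (depth≤lastDim W)
... | ()
⌊⌋-injective (V ⇑) (W ⇓) eq = ⊥-elim (<⇒≱ (depth≤lastDim W)
  (≤-reflexive (trans (sym (cong (λ Γ → lastDim (proj₂ Γ)) eq)) (lastDim-⇑ V))))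
⌊⌋-injective (W ⇓) (V ⇑) eq = ⊥-elim (<⇒≱ (depth≤lastDim W)
  (≤-reflexive (trans (cong (λ Γ → lastDim (proj₂ Γ)) eq) (lastDim-⇑ V))))

-- Boundaries

-- Membership in ∂ i ε, along the Dyck word instead of the derivation: the fourth
-- clause removes from ∂ d ⁺ the source of a ⇑ at depth d.
Bd : ℕ → Sign → (W : Dyck d) → Fin (size W) → Set
Bd i ε ⊖           x             = ⊤
Bd i ε (_⇑ {d} W)  zero          = d < i
Bd i ε (_⇑ {d} W)  (suc zero)    = d < i ⊎ (i ≡ d × ε ≡ ⁺)
Bd i ε (_⇑ {d} W)  (suc (suc x)) = Bd i ε W x × ¬ (i ≡ d × ε ≡ ⁺ × ⌊ W ⌋tm ≡ var x)
Bd i ε (W ⇓)       x             = Bd i ε W x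

Represents : (S : ℕ → Sign → Subset n) (P : ℕ → Sign → Fin n → Set) → Set
Represents S P = ∀ i ε x → (x ∈ S i ε → P i ε x) × (P i ε x → x ∈ S i ε)

-- The family of boundaries is an index, so that matching replaces a ps-context by the context of a
-- word and carries its boundaries along.
data IsDyck : (Γ : Ctx n) (t : Tm n) (A : Ty n) (S : ℕ → Sign → Subset n) → Set where
  isDyck : (W : Dyck d) {S : ℕ → Sign → Subset (size W)} →
           Represents S (λ i ε → Bd i ε W) → IsDyck ⌊ W ⌋ ⌊ W ⌋tm ⌊ W ⌋ty S

var-injective : {x y : Fin n} → var x ≡ var y → x ≡ y
var-injective refl = refl

x∈p─q⁻ : {x : Fin n} (p q : Subset n) → x ∈ p ─ q → x ∈ p × ¬ x ∈ q
x∈p─q⁻ (inside ∷ p) (outside ∷ q) here = here , λ ()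
x∈p─q⁻ (_ ∷ p) (outside ∷ q) (there e) with x∈p─q⁻ p q e
... | a , b = there a , λ { (there f) → b f }
x∈p─q⁻ (_ ∷ p) (inside ∷ q) (there e) with x∈p─q⁻ p q e
... | a , b = there a , λ { (there f) → b f }

pse-represents : (W : Dyck d) (p : ⌊ W ⌋ ⊢ps ⌊ W ⌋tm ∶ ⌊ W ⌋ty) →
                 Represents (λ i ε → ∂ i ε p) (λ i ε → Bd i ε W) →
                 Represents (λ i ε → ∂ i ε (pse p)) (λ i ε → Bd i ε (W ⇑))
pse-represents {d} W p rep i ε x with dyck-var W | <-cmp i (dim ⌊ W ⌋ty) | dim-⌊⌋ty W
pse-represents {d} W p rep i ε x | _ | tri< a ¬b ¬c | dq = to x , from x
  where
  to : ∀ x → x ∈ outside ∷ outside ∷ ∂ i ε p → Bd i ε (W ⇑) x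
  to (suc (suc x)) (there (there e)) =
    proj₁ (rep i ε x) e , λ { (q , _) → ¬b (trans q (sym dq)) }
  from : ∀ x → Bd i ε (W ⇑) x → x ∈ outside ∷ outside ∷ ∂ i ε p
  from zero          b               = ⊥-elim (¬c (subst (_< i) (sym dq) b))
  from (suc zero)    (inj₁ b)        = ⊥-elim (¬c (subst (_< i) (sym dq) b))
  from (suc zero)    (inj₂ (q , _))  = ⊥-elim (¬b (trans q (sym dq)))
  from (suc (suc x)) (b , _)         = there (there (proj₂ (rep i ε x) b))
pse-represents {d} W p rep i ⁻ x | _ | tri≈ ¬a _ ¬c | dq = to x , from x
  where
  to : ∀ x → x ∈ outside ∷ outside ∷ ∂ i ⁻ p → Bd i ⁻ (W ⇑) x
  to (suc (suc x)) (there (there e)) = proj₁ (rep i ⁻ x) e , λ { (_ , () , _) }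
  from : ∀ x → Bd i ⁻ (W ⇑) x → x ∈ outside ∷ outside ∷ ∂ i ⁻ p
  from zero          b               = ⊥-elim (¬c (subst (_< i) (sym dq) b))
  from (suc zero)    (inj₁ b)        = ⊥-elim (¬c (subst (_< i) (sym dq) b))
  from (suc zero)    (inj₂ (_ , ()))
  from (suc (suc x)) (b , _)         = there (there (proj₂ (rep i ⁻ x) b))
pse-represents {d} W p rep i ⁺ x | psVar {v} eq _ _ | tri≈ ¬a i≡ ¬c | dq = to x , from x
  where
  to : ∀ x → x ∈ outside ∷ inside ∷ (∂ i ⁺ p ─ FVTm ⌊ W ⌋tm) → Bd i ⁺ (W ⇑) x
  to (suc zero) (there here) = inj₂ (trans i≡ dq , refl)
  to (suc (suc x)) (there (there e)) with x∈p─q⁻ (∂ i ⁺ p) (FVTm ⌊ W ⌋tm) e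
  ... | e₁ , e₂ = proj₁ (rep i ⁺ x) e₁ ,
    λ { (_ , _ , q) → e₂ (subst (λ t → x ∈ FVTm t) (sym q) (x∈⁅x⁆ x)) }
  from : ∀ x → Bd i ⁺ (W ⇑) x → x ∈ outside ∷ inside ∷ (∂ i ⁺ p ─ FVTm ⌊ W ⌋tm)
  from zero          b               = ⊥-elim (¬c (subst (_< i) (sym dq) b))
  from (suc zero)    _               = there here
  from (suc (suc x)) (b , nr)        = there (there (x∈p∧x∉q⇒x∈p─q (proj₂ (rep i ⁺ x) b)
    λ e → nr (trans i≡ dq , refl ,
      trans eq (cong var (sym (x∈⁅y⁆⇒x≡y v (subst (λ t → x ∈ FVTm t) eq e)))))))
pse-represents {d} W p rep i ε x | _ | tri> _ ¬b c | dq = to x , from x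
  where
  to : ∀ x → x ∈ inside ∷ inside ∷ ∂ i ε p → Bd i ε (W ⇑) x
  to zero here = subst (_< i) dq c
  to (suc zero) (there here) = inj₁ (subst (_< i) dq c)
  to (suc (suc x)) (there (there e)) =
    proj₁ (rep i ε x) e , λ { (q , _) → ¬b (trans q (sym dq)) }
  from : ∀ x → Bd i ε (W ⇑) x → x ∈ inside ∷ inside ∷ ∂ i ε p
  from zero          b               = here
  from (suc zero)    _               = there here
  from (suc (suc x)) (b , _)         = there (there (proj₂ (rep i ε x) b))

ps-base : {Γ : Ctx n} {t : Tm n} (A : Ty n) (p : Γ ⊢ps t ∶ A) → dim A ≡ suc d →
          Σ[ q ∈ Γ ⊢ps tyTarget A t ∶ tyBase A ] (∀ i ε → ∂ i ε q ≡ ∂ i ε p)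
ps-base (s ─⟨ A ⟩⟶ t) p _ = psd p , λ _ _ → refl

dyck-ps : (W : Dyck d) → Σ[ p ∈ ⌊ W ⌋ ⊢ps ⌊ W ⌋tm ∶ ⌊ W ⌋ty ]
          Represents (λ i ε → ∂ i ε p) (λ i ε → Bd i ε W)
dyck-ps ⊖ = pss , λ { i ε zero → (λ _ → tt) , (λ _ → here) }
dyck-ps (W ⇑) with dyck-ps W
... | p , rep = pse p , pse-represents W p rep
dyck-ps (W ⇓) with dyck-ps W
... | p , rep with ps-base ⌊ W ⌋ty p (dim-⌊⌋ty W)
...   | q , eq = q , λ i ε x → subst (λ S → (x ∈ S → Bd i ε W x) × (Bd i ε W x → x ∈ S))
                                 (sym (eq i ε)) (rep i ε x)

ps-dyck : {Γ : Ctx n} {t : Tm n} {A : Ty n} (p : Γ ⊢ps t ∶ A) → IsDyck Γ t A (λ i ε → ∂ i ε p)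
ps-dyck pss = isDyck ⊖ λ { i ε zero → (λ _ → tt) , (λ _ → here) }
ps-dyck (pse p) with ps-dyck p
... | isDyck W rep = isDyck (W ⇑) (pse-represents W p rep)
ps-dyck (psd p) = base′ (ps-dyck p) refl
  where
  base′ : ∀ {Γ : Ctx n} {x B S s A t} → IsDyck Γ x B S → B ≡ s ─⟨ A ⟩⟶ t → IsDyck Γ t A S
  base′ (isDyck {zero} W rep) eq with trans (sym (dim-⌊⌋ty W)) (cong dim eq)
  ... | ()
  base′ (isDyck {suc d} W {S} rep) eq =
    subst (λ B → IsDyck ⌊ W ⌋ (tyTarget B ⌊ W ⌋tm) (tyBase B) S) eq (isDyck (W ⇓) rep)

data IsDyck₀ : (Γ : Ctx n) (S : ℕ → Sign → Subset n) → Set where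
  isDyck₀ : (W : Dyck 0) {S : ℕ → Sign → Subset (size W)} →
            Represents S (λ i ε → Bd i ε W) → IsDyck₀ ⌊ W ⌋ S

ps-dyck₀ : {Γ : Ctx n} (p : Γ ⊢ps) → IsDyck₀ Γ (λ i ε → ∂ps i ε p)
ps-dyck₀ (ps p) = closed (ps-dyck p) refl
  where
  closed : ∀ {Γ : Ctx n} {x A S} → IsDyck Γ x A S → A ≡ ⋆ → IsDyck₀ Γ S
  closed (isDyck W rep) eq with trans (sym (dim-⌊⌋ty W)) (cong dim eq)
  ... | refl = isDyck₀ W rep

-- An operation contains an arbitrary derivation that its context is a ps-context. That derivation
-- yields some word, which `⌊⌋-injective` identifies with `W`.
∂ps-represents : (W : Dyck 0) (p : ⌊ W ⌋ ⊢ps) →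
                 Represents (λ i ε → ∂ps i ε p) (λ i ε → Bd i ε W)
∂ps-represents W p = go (ps-dyck₀ p) refl
  where
  go : ∀ {n} {Γ : Ctx n} {S} → IsDyck₀ Γ S → (eq : (n , Γ) ≡ (size W , ⌊ W ⌋)) →
       Represents (subst (λ Γ → ℕ → Sign → Subset (proj₁ Γ)) eq S) (λ i ε → Bd i ε W)
  go (isDyck₀ V rep) eq with ⌊⌋-injective V W eq
  go (isDyck₀ V rep) refl | refl = rep

ps-⋆ : {Γ : Ctx n} {t : Tm n} (A : Ty n) (p : Γ ⊢ps t ∶ A) →
       Σ[ q ∈ Γ ⊢ps ] (∀ i ε → ∂ps i ε q ≡ ∂ i ε p)
ps-⋆ ⋆              p = ps p , λ _ _ → refl
ps-⋆ (s ─⟨ A ⟩⟶ t) p = ps-⋆ A (psd p)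

dyck-ps₀ : (W : Dyck 0) → ⌊ W ⌋ ⊢ps
dyck-ps₀ W = proj₁ (ps-⋆ ⌊ W ⌋ty (proj₁ (dyck-ps W)))

-- Discs as ps-contexts

dim-U : ∀ k → dim (U k) ≡ k
dim-U zero    = refl
dim-U (suc k) = cong suc (trans (dim-wkTy (wkTy (U k))) (trans (dim-wkTy (U k)) (dim-U k)))

dimCtx-D : ∀ k → dimCtx (D k) ≤ k
dimCtx-D zero    = z≤n
dimCtx-D (suc k) = ⊔-lub (⊔-lub (≤-trans (dimCtx-D k) (n≤1+n k))
  (≤-trans (≤-reflexive (dim-U k)) (n≤1+n k)))
  (s≤s (≤-reflexive (trans (dim-wkTy (U k)) (dim-U k))))

disc-ps : ∀ k → D k ⊢ps var zero ∶ U k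
disc-ps zero    = pss
disc-ps (suc k) = pse (disc-ps k)

disc-full : ∀ k {i} ε x → k ≤ i → x ∈ ∂ i ε (disc-ps k)
disc-full zero    ε zero le = here
disc-full (suc k) {i} ε x le with <-cmp i (dim (U k))
disc-full (suc k) {i} ε x le | tri< a ¬b ¬c = ⊥-elim (¬c (subst (_< i) (sym (dim-U k)) le))
disc-full (suc k) {i} ε x le | tri≈ ¬a b ¬c = ⊥-elim (¬c (subst (_< i) (sym (dim-U k)) le))
disc-full (suc k) {i} ε zero             le | tri> _ _ _ = here
disc-full (suc k) {i} ε (suc zero)       le | tri> _ _ _ = there here
disc-full (suc k) {i} ε (suc (suc x))    le | tri> _ _ _ =
  there (there (disc-full k ε x (≤-trans (n≤1+n k) le)))

Closure-bind : {Γ : Ctx n} {S T : Subset n} {x : Fin n} → Closure Γ S x →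
               (∀ {y} → y ∈ S → Closure Γ T y) → Closure Γ T x
Closure-bind (base e)   f = f e
Closure-bind (step c e) f = step (Closure-bind c f) e

Closure-wk : {Γ : Ctx n} {A : Ty n} {S : Subset n} {T : Subset (suc n)} {x : Fin n} →
             Closure Γ S x → (∀ {y} → y ∈ S → Closure (Γ ▸ A) T (suc y)) →
             Closure (Γ ▸ A) T (suc x)
Closure-wk (base e) f = f e
Closure-wk {Γ = Γ} (step {x} c e) f = step (Closure-wk c f) (wk⁺ (FVTy-wk (lookup Γ x)) e)

disc-supp : ∀ k x → Supp (D k) (var zero) x
disc-supp zero    zero = base (x∈⁅x⁆ zero)
disc-supp (suc k) zero = base (x∈⁅x⁆ zero)
disc-supp (suc k) (suc zero) = step (base (x∈⁅x⁆ zero))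
  (FV-⟶⁺ {s = var (suc (suc zero))} {wkTy (wkTy (U k))} {var (suc zero)} (in-tgt (x∈⁅x⁆ (suc zero))))
disc-supp (suc k) (suc (suc x)) =
  Closure-wk {S = FVTm (var (suc zero))}
    (Closure-wk (disc-supp k x) λ e → base (subst (λ y → suc y ∈ _) (sym (x∈⁅y⁆⇒x≡y zero e)) (x∈⁅x⁆ (suc zero))))
    λ e → step (base (x∈⁅x⁆ zero))
      (FV-⟶⁺ {s = var (suc (suc zero))} {wkTy (wkTy (U k))} {var (suc zero)}
        (in-src (subst (λ y → suc y ∈ _) (sym (x∈⁅y⁆⇒x≡y (suc zero) e)) (x∈⁅x⁆ (suc (suc zero))))))

disc-ps₀ : ∀ k → D k ⊢ps
disc-ps₀ k = proj₁ (ps-⋆ (U k) (disc-ps k))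

-- At index `k`, the dimension of the disc, both boundaries are the whole disc, and so is the
-- support of its top variable.
disc-operation : ∀ k → 𝒪 (D k) (Supp (D k) (var zero)) (Supp (D k) (var zero))
disc-operation k with ps-⋆ (U k) (disc-ps k)
... | q , eq = regular q k (≤-trans (dimCtx-D k) (n≤1+n k)) (all ⁻) (all ⁺)
  where
  all : ∀ ε → (∀ {x} → Supp (D k) (var zero) x → x ∈ ∂ps k ε q) ×
              (∀ {x} → x ∈ ∂ps k ε q → Supp (D k) (var zero) x)
  all ε = (λ {x} _ → subst (x ∈_) (sym (eq k ε)) (disc-full k ε x ≤-refl)) ,
          (λ {x} _ → disc-supp k x)

-- The targets inside `⌊ W ⌋ty` are the cells that later `⇓` can make current; `k` is the dimension
-- of the target `y`.
data IsTgt {n} : Ty n → ℕ → Fin n → Set where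
  top  : ∀ {s A t y} → t ≡ var y → k ≡ dim A → IsTgt (s ─⟨ A ⟩⟶ t) k y
  down : ∀ {s A t y} → IsTgt A k y → IsTgt (s ─⟨ A ⟩⟶ t) k y

IsTgt-wk⁻ : (A : Ty n) {y : Fin (suc n)} → IsTgt (wkTy A) k y → Wk (IsTgt A k) y
IsTgt-wk⁻ (s ─⟨ A ⟩⟶ t) (top eq q) with wkTm-var eq
... | _ , eq′ , refl = wk (top eq′ (trans q (dim-wkTy A)))
IsTgt-wk⁻ (s ─⟨ A ⟩⟶ t) (down h) with IsTgt-wk⁻ A h
... | wk h′ = wk (down h′)

VarTy-tgt : {Γ : Ctx n} {A : Ty n} {y : Fin n} → VarTy Γ A → IsTgt A k y →
            lookupDim Γ y ≡ k × k < dim A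
VarTy-tgt (⟶ᵛ v p q) (top refl refl) = cong dim q , ≤-refl
VarTy-tgt (⟶ᵛ v p q) (down h) with VarTy-tgt v h
... | a , b = a , m<n⇒m<1+n b

dim-⌊⌋tm : (W : Dyck d) {x : Fin (size W)} → ⌊ W ⌋tm ≡ var x → lookupDim ⌊ W ⌋ x ≡ d
dim-⌊⌋tm W eq with dyck-var W
... | psVar eq′ l v with var-injective (trans (sym eq) eq′)
...   | refl = trans (cong dim l) (dim-⌊⌋ty W)

lookupDim-⇑ : (W : Dyck d) (x : Fin (size W)) → lookupDim ⌊ W ⇑ ⌋ (suc (suc x)) ≡ lookupDim ⌊ W ⌋ x
lookupDim-⇑ W x = trans (dim-wkTy (wkTy (lookup ⌊ W ⌋ x))) (dim-wkTy (lookup ⌊ W ⌋ x))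

lookupDim-⇑₀ : (W : Dyck d) → lookupDim ⌊ W ⇑ ⌋ zero ≡ suc d
lookupDim-⇑₀ W = cong suc (trans (dim-wkTy (wkTy ⌊ W ⌋ty)) (trans (dim-wkTy ⌊ W ⌋ty) (dim-⌊⌋ty W)))

lookupDim-⇑₁ : (W : Dyck d) → lookupDim ⌊ W ⇑ ⌋ (suc zero) ≡ d
lookupDim-⇑₁ W = trans (dim-wkTy (wkTy ⌊ W ⌋ty)) (trans (dim-wkTy ⌊ W ⌋ty) (dim-⌊⌋ty W))

Up : ℕ → Sign → ℕ → Set
Up i ε k = k < i ⊎ (i ≡ k × ε ≡ ⁺)

-- Only a `⇑` starting at a cell removes it from a positive boundary, and none has yet started at
-- `⌊ W ⌋tm` or at a target in its type. In the case `⇑` the targets kept in the type have smaller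
-- dimension than the source.
Bd-tm  : ∀ {i ε} (W : Dyck d) {y} → ⌊ W ⌋tm ≡ var y → Up i ε d → Bd i ε W y
Bd-tgt : ∀ {i ε} (W : Dyck d) {y} → IsTgt ⌊ W ⌋ty k y → Up i ε k → Bd i ε W y
Bd-tm ⊖ eq u = tt
Bd-tm (W ⇑) refl (inj₁ lt) = ≤-trans (n≤1+n _) lt
Bd-tm (W ⇑) refl (inj₂ (eq , _)) = ≤-reflexive (sym eq)
Bd-tm {i = i} {ε} (_⇓ {d} W) eq u = go (dyck-var W) (dim-⌊⌋ty W) (Bd-tgt W) eq
  where
  go : ∀ {A t y} → PsVar ⌊ W ⌋ t A → dim A ≡ suc d →
       (∀ {k y} → IsTgt A k y → Up i ε k → Bd i ε W y) → tyTarget A t ≡ var y → Bd i ε W y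
  go (psVar _ _ (⟶ᵛ v _ r)) dq f eq = f (top eq refl) (subst (Up i ε) (sym (suc-injective dq)) u)
Bd-tgt ⊖ () u
Bd-tgt {i = i} {ε} (W ⇑) h u with IsTgt-wk⁻ _ h
... | wk (top refl refl) =
  subst (Up i ε) (trans (dim-wkTy ⌊ W ⌋ty) (dim-⌊⌋ty W)) u
... | wk (down h′) with IsTgt-wk⁻ ⌊ W ⌋ty h′
...   | wk h″ with VarTy-tgt (PsVar.var-ty (dyck-var W)) h″
...     | a , b = Bd-tgt W h″ u , λ { (_ , _ , eq) →
  <-irrefl refl (subst₂ _<_ (trans (sym a) (dim-⌊⌋tm W eq)) (dim-⌊⌋ty W) b) }
Bd-tgt {k = k} {i} {ε} (_⇓ {d} W) {y} h u = go ⌊ W ⌋ty h (Bd-tgt W)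
  where
  go : ∀ A → IsTgt (tyBase A) k y → (∀ {k y} → IsTgt A k y → Up i ε k → Bd i ε W y) → Bd i ε W y
  go (_ ─⟨ _ ⟩⟶ _) h f = f (down h) u

Bd-dim : ∀ {i ε} (W : Dyck d) x → Bd i ε W x → lookupDim ⌊ W ⌋ x ≤ i
Bd-dim ⊖     zero b = z≤n
Bd-dim (W ⇑) zero b = ≤-trans (≤-reflexive (lookupDim-⇑₀ W)) b
Bd-dim (W ⇑) (suc zero) (inj₁ lt) = ≤-trans (≤-reflexive (lookupDim-⇑₁ W)) (<⇒≤ lt)
Bd-dim (W ⇑) (suc zero) (inj₂ (eq , _)) = ≤-reflexive (trans (lookupDim-⇑₁ W) (sym eq))
Bd-dim (W ⇑) (suc (suc x)) (b , _) = ≤-trans (≤-reflexive (lookupDim-⇑ W x)) (Bd-dim W x b)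
Bd-dim (W ⇓) x b = Bd-dim W x b

FV-⌊⌋ty : (W : Dyck d) {x : Fin (size W)} → x ∈ FVTy ⌊ W ⌋ty → lookupDim ⌊ W ⌋ x < d
FV-⌊⌋ty W {x} e = subst (lookupDim ⌊ W ⌋ x <_) (dim-⌊⌋ty W) (VarTy-FV (PsVar.var-ty (dyck-var W)) e)

-- Removals from the boundary at index `i` concern cells of dimension `i`, whereas the cells in the
-- type of a boundary element have dimension below `i`.
Bd-closed : ∀ {i ε} (W : Dyck d) x {y} → Bd i ε W x → y ∈ FVTy (lookup ⌊ W ⌋ x) → Bd i ε W y
Bd-closed-tm : ∀ {i ε} (W : Dyck d) {y} → Up i ε d → y ∈ FVTy ⌊ W ⌋ty → Bd i ε W y
Bd-closed ⊖ zero b e = ⊥-elim (∉⊥ e)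
Bd-closed {i = i} (W ⇑) zero b e
  with wk⁻ (FVTy-wk (wkTm ⌊ W ⌋tm ─⟨ wkTy ⌊ W ⌋ty ⟩⟶ var zero)) e
... | wk e₁ with FV-⟶⁻ (wkTm ⌊ W ⌋tm) (wkTy ⌊ W ⌋ty) (var zero) e₁
Bd-closed {i = i} (W ⇑) zero b e | wk e₁ | in-src e₂ with wk⁻ (FVTm-wk ⌊ W ⌋tm) e₂ | dyck-var W
... | wk {x} e₃ | psVar {v} eq _ _ =
  Bd-tm W (trans eq (cong var (sym (x∈⁅y⁆⇒x≡y v (subst (λ t → x ∈ FVTm t) eq e₃))))) (inj₁ b) ,
  λ { (q , _) → <-irrefl (sym q) b }
Bd-closed {i = i} (W ⇑) zero b e | wk e₁ | in-ty e₂ with wk⁻ (FVTy-wk ⌊ W ⌋ty) e₂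
... | wk e₃ = Bd-closed-tm W (inj₁ b) e₃ , λ { (q , _) → <-irrefl (sym q) b }
Bd-closed {i = i} (W ⇑) zero b e | wk e₁ | in-tgt e₂ with x∈⁅y⁆⇒x≡y zero e₂
... | refl = inj₁ b
Bd-closed (W ⇑) (suc zero) b e with wk⁻ (FVTy-wk (wkTy ⌊ W ⌋ty)) e
... | wk e₁ with wk⁻ (FVTy-wk ⌊ W ⌋ty) e₁
...   | wk e₂ = Bd-closed-tm W b e₂ , λ { (_ , _ , q) → <-irrefl (dim-⌊⌋tm W q) (FV-⌊⌋ty W e₂) }
Bd-closed (W ⇑) (suc (suc x)) (b , _) e with wk⁻ (FVTy-wk (wkTy (lookup ⌊ W ⌋ x))) e
... | wk e₁ with wk⁻ (FVTy-wk (lookup ⌊ W ⌋ x)) e₁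
...   | wk e₂ = Bd-closed W x b e₂ , λ { (q₁ , _ , q) → <-irrefl (trans (dim-⌊⌋tm W q) (sym q₁))
                 (≤-trans (lookup-FV W e₂) (Bd-dim W x b)) }
Bd-closed (W ⇓) x b e = Bd-closed W x b e
Bd-closed-tm W u e with dyck-var W
... | psVar {v} eq l _ = Bd-closed W v (Bd-tm W eq u) (subst (λ A → _ ∈ FVTy A) (sym l) e)

depth≤dimCtx : (W : Dyck d) → d ≤ dimCtx ⌊ W ⌋
depth≤dimCtx W with dyck-var W
... | psVar {v} eq _ _ = subst (_≤ dimCtx ⌊ W ⌋) (dim-⌊⌋tm W eq) (lookupDim≤dimCtx ⌊ W ⌋ v)

-- A negative boundary never loses a cell, so a witness survives every `⇑`. It is replaced only when
-- the new arrow belongs to the boundary and has larger dimension.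
Bd-large : ∀ i (W : Dyck d) →
           ∃[ x ] Bd i ⁻ W x × (i ≤ lookupDim ⌊ W ⌋ x ⊎ dimCtx ⌊ W ⌋ ≤ lookupDim ⌊ W ⌋ x)
Bd-large i ⊖ = zero , tt , inj₂ z≤n
Bd-large i (_⇑ {d} W) with Bd-large i W
... | x , b , inj₁ le =
  suc (suc x) , (b , λ { (_ , () , _) }) , inj₁ (≤-trans le (≤-reflexive (sym (lookupDim-⇑ W x))))
... | x , b , inj₂ le with d <? i
...   | no ¬lt = suc (suc x) , (b , λ { (_ , () , _) }) ,
  inj₁ (≤-trans (≮⇒≥ ¬lt) (≤-trans (depth≤dimCtx W) (≤-trans le (≤-reflexive (sym (lookupDim-⇑ W x))))))
...   | yes lt with d <? lookupDim ⌊ W ⌋ x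
...     | yes lt′ = suc (suc x) , (b , λ { (_ , () , _) }) , inj₂ (subst (dimCtx ⌊ W ⇑ ⌋ ≤_) (sym (lookupDim-⇑ W x))
  (⊔-lub (⊔-lub le (≤-trans (≤-reflexive (dim-⌊⌋ty W)) (<⇒≤ lt′)))
    (≤-trans (≤-reflexive (lastDim-⇑ W)) lt′)))
...     | no ¬lt′ = zero , lt , inj₂ (subst (dimCtx ⌊ W ⇑ ⌋ ≤_) (sym (lookupDim-⇑₀ W))
  (⊔-lub (⊔-lub (≤-trans le (≤-trans (≮⇒≥ ¬lt′) (n≤1+n d))) (≤-trans (≤-reflexive (dim-⌊⌋ty W)) (n≤1+n d)))
    (≤-reflexive (lastDim-⇑ W))))
Bd-large i (W ⇓) = Bd-large i W

-- The target of the last ⇑ at depth i separates the two boundaries.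
Bd-separated : ∀ {i} (W : Dyck d) → dimCtx ⌊ W ⌋ ≤ suc i →
               (∀ ε x → Bd i ε W x) ⊎ (∃[ x ] Bd i ⁺ W x × ¬ Bd i ⁻ W x)
Bd-separated ⊖ le = inj₁ λ ε x → tt
Bd-separated {i = i} (_⇑ {d} W) le with i ≟ d
... | yes refl = inj₂ (suc zero , inj₂ (refl , refl) ,
  λ { (inj₁ lt) → <-irrefl refl lt ; (inj₂ (_ , ())) })
... | no i≢d with Bd-separated W (≤-trans (≤-trans (m≤m⊔n _ _) (m≤m⊔n _ _)) le)
...   | inj₂ (x , p , q) = inj₂ (suc (suc x) , (p , λ { (q , _) → i≢d q }) , λ { (b , _) → q b })
...   | inj₁ f = inj₁ g
  where
  d<i : d < i
  d<i = ≤∧≢⇒< (≤-pred (≤-trans (≤-reflexive (sym (lastDim-⇑ W)))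
    (≤-trans (m≤n⊔m (dimCtx ⌊ W ⌋ ⊔ dim ⌊ W ⌋ty) _) le))) (λ q → i≢d (sym q))
  g : ∀ ε x → Bd i ε (W ⇑) x
  g ε zero          = d<i
  g ε (suc zero)    = inj₁ d<i
  g ε (suc (suc x)) = f ε x , λ { (q , _) → i≢d q }
Bd-separated (W ⇓) le = Bd-separated W le

-- Dimension bounds from regularity

module Dimension (R : RuleSet) where

  open Catt R
  open Typing R

  -- The support of `s` is a negative boundary, hence contains the cell of `Bd-large`. Passing from
  -- free variables to the support does not raise dimensions, so that cell has dimension at most
  -- `k`.
  operation-dim : {Δ : Ctx m} (s t : Tm m) → 𝒪 Δ (Supp Δ s) (Supp Δ t) →
                  (∀ {x} → x ∈ FVTm s → lookupDim Δ x ≤ k) → dimCtx Δ ≤ suc k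
  operation-dim {k = k} s _ (regular p i le (_ , b⊆s) _) f = go {s = s} (ps-dyck₀ p) b⊆s le f
    where
    go : ∀ {m} {Δ : Ctx m} {S} {s : Tm m} → IsDyck₀ Δ S → (∀ {x} → x ∈ S i ⁻ → Supp Δ s x) →
         dimCtx Δ ≤ suc i → (∀ {x} → x ∈ FVTm s → lookupDim Δ x ≤ k) → dimCtx Δ ≤ suc k
    go {s = s} (isDyck₀ W rep) b⊆s le f with Bd-large i W
    ... | x , b , large = finish large
      where
      bound : ∀ {y} → Supp ⌊ W ⌋ s y → lookupDim ⌊ W ⌋ y ≤ k
      bound (base e)   = f e
      bound (step c e) = ≤-trans (<⇒≤ (lookup-FV W e)) (bound c)
      x≤k : lookupDim ⌊ W ⌋ x ≤ k
      x≤k = bound (b⊆s (proj₂ (rep i ⁻ x) b))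
      finish : i ≤ lookupDim ⌊ W ⌋ x ⊎ dimCtx ⌊ W ⌋ ≤ lookupDim ⌊ W ⌋ x → dimCtx ⌊ W ⌋ ≤ suc k
      finish (inj₁ le′) = ≤-trans le (s≤s (≤-trans le′ x≤k))
      finish (inj₂ le′) = ≤-trans le′ (≤-trans x≤k (n≤1+n k))

  tm-FV-dim  : {Γ : Ctx n} {t : Tm n} {A : Ty n} {x : Fin n} →
               Γ ⊢tm t ∶ A → x ∈ FVTm t → lookupDim Γ x ≤ dim A
  sub-FV-dim : {Γ : Ctx n} {Δ : Ctx m} {σ : Sub m n} {x : Fin n} →
               Γ ⊢sub σ ∶ Δ → x ∈ FVSub σ → lookupDim Γ x ≤ dimCtx Δ
  tm-FV-dim {Γ = Γ} (tm-var y) e = ≤-reflexive (cong (lookupDim Γ) (x∈⁅y⁆⇒x≡y y e))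
  tm-FV-dim (tm-conv p q) e = ≤-trans (tm-FV-dim p e) (≤-reflexive (dim-≈ q))
  tm-FV-dim (tm-coh {s = s} {t} {A} _ (ty-⟶ a b c) p o) e =
    ≤-trans (sub-FV-dim p e)
      (≤-trans (operation-dim s t o (tm-FV-dim b)) (≤-reflexive (cong suc (sym (dim-[] A)))))
  sub-FV-dim sub-⟨⟩ e = ⊥-elim (∉⊥ e)
  sub-FV-dim {Δ = Δ ▸ A} (sub-, {σ = σ} {t = t} p q) e with x∈p∪q⁻ (FVSub σ) (FVTm t) e
  ... | inj₁ e′ = m≤n⇒m≤n⊔o (dim A) (sub-FV-dim p e′)
  ... | inj₂ e′ = m≤n⇒m≤o⊔n (dimCtx Δ) (≤-trans (tm-FV-dim q e′) (≤-reflexive (dim-[] A)))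

  coh-dim : {Δ : Ctx m} {s t : Tm m} {A : Ty m} → Δ ⊢ty s ─⟨ A ⟩⟶ t →
            𝒪 Δ (Supp Δ s) (Supp Δ t) → dimCtx Δ ≤ suc (dim A)
  coh-dim {s = s} {t} (ty-⟶ _ b _) o = operation-dim s t o (tm-FV-dim b)

-- Support

-- Inclusions checked on generators suffice for equality of supports, and in this form they pass to
-- unions.
SameSupp : Ctx n → Subset n → Subset n → Set
SameSupp Γ p q = (∀ {x} → x ∈ p → Closure Γ q x) × (∀ {x} → x ∈ q → Closure Γ p x)

SameSupp-∪ : {Γ : Ctx n} {p p′ q q′ : Subset n} → SameSupp Γ p q → SameSupp Γ p′ q′ →
             SameSupp Γ (p ∪ p′) (q ∪ q′)
SameSupp-∪ {Γ = Γ} (f , g) (f′ , g′) = half f f′ , half g g′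
  where
  half : ∀ {p p′ q q′ x} → (∀ {x} → x ∈ p → Closure Γ q x) → (∀ {x} → x ∈ p′ → Closure Γ q′ x) →
         x ∈ p ∪ p′ → Closure Γ (q ∪ q′) x
  half {p} {p′} {q} f f′ e with x∈p∪q⁻ p p′ e
  ... | inj₁ e′ = Closure-bind (f e′) λ z → base (∪-inj₁ z)
  ... | inj₂ e′ = Closure-bind (f′ e′) λ z → base (∪-inj₂ {p = q} z)

SameSupp-refl : {Γ : Ctx n} {p : Subset n} → SameSupp Γ p p
SameSupp-refl = base , base

SameSupp-sym : {Γ : Ctx n} {p q : Subset n} → SameSupp Γ p q → SameSupp Γ q p
SameSupp-sym (f , g) = g , f

SameSupp-trans : {Γ : Ctx n} {p q r : Subset n} → SameSupp Γ p q → SameSupp Γ q r → SameSupp Γ p r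
SameSupp-trans (f , g) (f′ , g′) =
  (λ e → Closure-bind (f e) f′) , (λ e → Closure-bind (g′ e) g)

module Support (R : RuleSet) 
  (rule-supp : ∀ {n} {Γ : Ctx n} {s t : Tm n} {A : Ty n} → R Γ s t → Catt._⊢tm_∶_ R Γ s A →
               SameSupp Γ (FVTm s) (FVTm t))
  where

  open Catt R
  open Typing R

  ty-supp  : {Γ : Ctx n} {A B : Ty n} → Γ ⊢ty A ≈ B → SameSupp Γ (FVTy A) (FVTy B)
  tm-supp  : {Γ : Ctx n} {s t : Tm n} → Γ ⊢tm s ≈ t → SameSupp Γ (FVTm s) (FVTm t)
  sub-supp : {Γ : Ctx n} {σ τ : Sub m n} → Γ ⊢sub σ ≈ τ → SameSupp Γ (FVSub σ) (FVSub τ)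
  ty-supp ≈-⋆         = SameSupp-refl
  ty-supp (≈-⟶ p q r) = SameSupp-∪ (tm-supp p) (SameSupp-∪ (ty-supp q) (tm-supp r))
  tm-supp (≈-var x)     = SameSupp-refl
  tm-supp (≈-sym p)     = SameSupp-sym (tm-supp p)
  tm-supp (≈-trans p q) = SameSupp-trans (tm-supp p) (tm-supp q)
  tm-supp (≈-coh p q)   = sub-supp q
  tm-supp (≈-rule r p)  = rule-supp r p
  sub-supp ≈-⟨⟩      = SameSupp-refl
  sub-supp (≈-, p q) = SameSupp-∪ (sub-supp p) (tm-supp q)

  type-supp : {Γ : Ctx n} {t : Tm n} {A : Ty n} {x : Fin n} → Γ ⊢tm t ∶ A → x ∈ FVTy A → Supp Γ t x
  type-supp (tm-var y)    e = step (base (x∈⁅x⁆ y)) e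
  type-supp (tm-conv p q) e = Closure-bind (proj₂ (ty-supp q) e) (type-supp p)
  type-supp (tm-coh {s = s} {t} {A} {σ} _ _ _ _) e with FVTy-[]⁻ (s ─⟨ A ⟩⟶ t) e
  ... | x , _ , q = base (FV-var-⊆ x σ q)

  supp-[]⁺ : {Γ : Ctx n} {Δ : Ctx m} {σ : Sub m n} (s : Tm m) {x : Fin m} {w : Fin n} →
             Γ ⊢sub σ ∶ Δ → Supp Δ s x → w ∈ FVTm (x [ σ ]var) → Supp Γ (s [ σ ]tm) w
  supp-[]⁺ s p (base e) q = base (FVTm-[]⁺ s e q)
  supp-[]⁺ {Δ = Δ} s p (step {x} c e) q =
    Closure-bind (type-supp (sub-var p x) (FVTy-[]⁺ (lookup Δ x) e q)) (supp-[]⁺ s p c)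

  -- By typing, the argument and the type of the identity at the peak are equal to the source and
  -- the type supplied by the rest of `σ`, and the deleted target is equal to the argument. Nothing
  -- leaves the support with them.
  //ˢ-supp : {Γ : Ctx n} {W : Dyck d} (p : Peak W) (σ : Sub (size W) n) → Γ ⊢sub σ ∶ ⌊ W ⌋ →
             IsIdentity (peakVar p [ σ ]var) → SameSupp Γ (FVSub σ) (FVSub (σ //ˢ p))
  //ˢ-supp {Γ = Γ} (here E) ⟨ ⟨ σ , s ⟩ , _ ⟩ (sub-, (sub-, a b) c) (A , u , refl) with id-inv A c
  ... | _ , _ , ≈-⟶ p q r = forth , λ e → base (∪-inj₁ (∪-inj₁ e))
    where
    in-σ-tm : ∀ {x} (t : Tm _) → x ∈ FVTm (wkTm t [ ⟨ σ , s ⟩ ]tm) → x ∈ FVSub σ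
    in-σ-tm t e with FVTm-[]⁻ t (subst (λ t → _ ∈ FVTm t) (wkTm-⟨,⟩ t) e)
    ... | y , _ , f = FV-var-⊆ y σ f
    in-σ-ty : ∀ {x} (A : Ty _) → x ∈ FVTy (wkTy A [ ⟨ σ , s ⟩ ]ty) → x ∈ FVSub σ
    in-σ-ty A e with FVTy-[]⁻ A (subst (λ A → _ ∈ FVTy A) (wkTy-⟨,⟩ A) e)
    ... | y , _ , f = FV-var-⊆ y σ f
    from-u : ∀ {x} → x ∈ FVTm u → Closure Γ (FVSub σ) x
    from-u e = Closure-bind (proj₁ (tm-supp p) e) λ f → base (in-σ-tm ⌊ E ⌋tm f)
    forth : ∀ {x} → x ∈ (FVSub σ ∪ FVTm s) ∪ FVSub ⦅ A , u ⦆ → Closure Γ (FVSub σ) x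
    forth {x} e with x∈p∪q⁻ (FVSub σ ∪ FVTm s) (FVSub ⦅ A , u ⦆) e
    ... | inj₂ e′ with FV-⦅⦆⁻ A e′
    ...   | inj₁ f = Closure-bind (proj₁ (ty-supp q) f) λ g → base (in-σ-ty ⌊ E ⌋ty g)
    ...   | inj₂ f = from-u f
    forth e | inj₁ e′ with x∈p∪q⁻ (FVSub σ) (FVTm s) e′
    ...   | inj₁ f = base f
    ...   | inj₂ f = Closure-bind (proj₂ (tm-supp r) f) from-u
  //ˢ-supp (p ⇑ₚ) ⟨ ⟨ σ , s ⟩ , t ⟩ (sub-, (sub-, a b) c) i =
    SameSupp-∪ (SameSupp-∪ (//ˢ-supp p σ a i) SameSupp-refl) SameSupp-refl
  //ˢ-supp (p ⇓ₚ) σ a i = //ˢ-supp p σ a i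

  dr-supp : {Γ : Ctx n} {s t : Tm n} {A : Ty n} → dr Γ s t → Γ ⊢tm s ∶ A →
            SameSupp Γ (FVTm s) (FVTm t)
  dr-supp {Γ = Γ} (disc A t) p = forth , λ e → base (FV-⦅⦆-tm A e)
    where
    t-typed : Γ ⊢tm t ∶ A
    t-typed = proj₂ (disc-inv A (CohInv.sub-typed (coh-inv p)))
    forth : ∀ {x} → x ∈ FVSub ⦅ A , t ⦆ → Supp Γ t x
    forth e with FV-⦅⦆⁻ A e
    ... | inj₁ f = type-supp t-typed f
    ... | inj₂ f = base f

  -- Since `s` is both source and target, the two boundaries coincide. By `Bd-separated` they are
  -- then all of `Δ`, so `s [ σ ]tm` supports every entry of `σ`.
  ecr-supp : {Γ : Ctx n} {s t : Tm n} {A : Ty n} → ecr Γ s t → Γ ⊢tm s ∶ A →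
             SameSupp Γ (FVTm s) (FVTm t)
  ecr-supp {Γ = Γ} (endo Δ s A σ) p with coh-inv p
  ... | cohInv refl _ _ σ-typed (regular q i le (s⊆∂⁻ , ∂⁻⊆s) (s⊆∂⁺ , ∂⁺⊆s)) _ = forth , back
    where
    full : ∀ {m} {Δ : Ctx m} {S} {s : Tm m} → IsDyck₀ Δ S → dimCtx Δ ≤ suc i →
           (∀ {x} → Supp Δ s x → x ∈ S i ⁻) → (∀ {x} → x ∈ S i ⁻ → Supp Δ s x) →
           (∀ {x} → x ∈ S i ⁺ → Supp Δ s x) → ∀ x → Supp Δ s x
    full (isDyck₀ W rep) le f g h x with Bd-separated W le
    ... | inj₁ all = g (proj₂ (rep i ⁻ x) (all ⁻ x))
    ... | inj₂ (y , b , ¬b) = ⊥-elim (¬b (proj₁ (rep i ⁻ y) (f (h (proj₂ (rep i ⁺ y) b)))))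
    forth : ∀ {x} → x ∈ FVSub σ → Closure Γ (FVSub ⦅ A [ σ ]ty , s [ σ ]tm ⦆) x
    forth e with FVSub⁻ σ e
    ... | y , f = Closure-bind (supp-[]⁺ s σ-typed (full {s = s} (ps-dyck₀ q) le s⊆∂⁻ ∂⁻⊆s ∂⁺⊆s y) f)
                    λ g → base (FV-⦅⦆-tm (A [ σ ]ty) g)
    back : ∀ {x} → x ∈ FVSub ⦅ A [ σ ]ty , s [ σ ]tm ⦆ → Closure Γ (FVSub σ) x
    back e with FV-⦅⦆⁻ (A [ σ ]ty) e
    ... | inj₁ f with FVTy-[]⁻ A f
    ...   | y , _ , g = base (FV-var-⊆ y σ g)
    back e | inj₂ f with FVTm-[]⁻ s f
    ...   | y , _ , g = base (FV-var-⊆ y σ g)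

  prune-supp : {Γ : Ctx n} {s t : Tm n} {A : Ty n} → prune Γ s t → Γ ⊢tm s ∶ A →
               SameSupp Γ (FVTm s) (FVTm t)
  prune-supp (prune-peak W p A σ i) q = //ˢ-supp p σ (CohInv.sub-typed (coh-inv q)) i

  su′-supp : {Γ : Ctx n} {s t : Tm n} {A : Ty n} → su′ Γ s t → Γ ⊢tm s ∶ A →
             SameSupp Γ (FVTm s) (FVTm t)
  su′-supp (inj₁ r)              p = dr-supp r p
  su′-supp (inj₂ (inj₁ (r , _))) p = prune-supp r p
  su′-supp (inj₂ (inj₂ (r , _))) p = ecr-supp r p

open Catt su′
open Typing su′
open Dimension su′
open Reduction su′

-- Substitution

-- Typing of `σ` is assumed variable by variable: in this form it is available for `wkSub idSub`
-- before typed substitutions can be weakened, so that weakening of typing is an instance.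
ty-[]-typed  : {Γ : Ctx n} {Δ : Ctx m} {σ : Sub m n} {A : Ty m} →
               Δ ⊢ty A → (∀ x → Γ ⊢tm x [ σ ]var ∶ lookup Δ x [ σ ]ty) → Γ ⊢ty A [ σ ]ty
tm-[]-typed  : {Γ : Ctx n} {Δ : Ctx m} {σ : Sub m n} {A : Ty m} {t : Tm m} →
               Δ ⊢tm t ∶ A → (∀ x → Γ ⊢tm x [ σ ]var ∶ lookup Δ x [ σ ]ty) →
               Γ ⊢tm t [ σ ]tm ∶ A [ σ ]ty
∙-typed      : {Γ : Ctx n} {Δ : Ctx m} {Θ : Ctx l} {σ : Sub m n} {τ : Sub l m} →
               Δ ⊢sub τ ∶ Θ → (∀ x → Γ ⊢tm x [ σ ]var ∶ lookup Δ x [ σ ]ty) →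
               Γ ⊢sub τ ∙ σ ∶ Θ
ty-≈-[]      : {Γ : Ctx n} {Δ : Ctx m} {σ : Sub m n} {A B : Ty m} →
               Δ ⊢ty A ≈ B → (∀ x → Γ ⊢tm x [ σ ]var ∶ lookup Δ x [ σ ]ty) →
               Γ ⊢ty A [ σ ]ty ≈ B [ σ ]ty
tm-≈-[]      : {Γ : Ctx n} {Δ : Ctx m} {σ : Sub m n} {s t : Tm m} →
               Δ ⊢tm s ≈ t → (∀ x → Γ ⊢tm x [ σ ]var ∶ lookup Δ x [ σ ]ty) →
               Γ ⊢tm s [ σ ]tm ≈ t [ σ ]tm
sub-≈-[]     : {Γ : Ctx n} {Δ : Ctx m} {σ : Sub m n} {τ ρ : Sub l m} →
               Δ ⊢sub τ ≈ ρ → (∀ x → Γ ⊢tm x [ σ ]var ∶ lookup Δ x [ σ ]ty) →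
               Γ ⊢sub τ ∙ σ ≈ ρ ∙ σ
ty-[]-typed ty-⋆         v = ty-⋆
ty-[]-typed (ty-⟶ a b c) v = ty-⟶ (ty-[]-typed a v) (tm-[]-typed b v) (tm-[]-typed c v)
tm-[]-typed (tm-var x)    v = v x
tm-[]-typed (tm-conv p q) v = tm-conv (tm-[]-typed p v) (ty-≈-[] q v)
tm-[]-typed (tm-coh {s = s} {t} {A} a b c o) v =
  tm-cast (ty-∙ (s ─⟨ A ⟩⟶ t)) (tm-coh a b (∙-typed c v) o)
∙-typed sub-⟨⟩ v = sub-⟨⟩
∙-typed (sub-, {A = A} p q) v = sub-, (∙-typed p v) (tm-cast (sym (ty-∙ A)) (tm-[]-typed q v))
ty-≈-[] ≈-⋆         v = ≈-⋆
ty-≈-[] (≈-⟶ p q r) v = ≈-⟶ (tm-≈-[] p v) (ty-≈-[] q v) (tm-≈-[] r v)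
tm-≈-[] (≈-var x)     v = tm-refl _
tm-≈-[] (≈-sym p)     v = ≈-sym (tm-≈-[] p v)
tm-≈-[] (≈-trans p q) v = ≈-trans (tm-≈-[] p v) (tm-≈-[] q v)
tm-≈-[] (≈-coh p q)   v = ≈-coh p (sub-≈-[] q v)
tm-≈-[] (≈-rule r p)  v = ≈-rule (su′-[] _ r) (tm-[]-typed p v)
sub-≈-[] ≈-⟨⟩      v = ≈-⟨⟩
sub-≈-[] (≈-, p q) v = ≈-, (sub-≈-[] p v) (tm-≈-[] q v)

wk-typed : (Γ : Ctx n) (A : Ty n) →
           ∀ x → Γ ▸ A ⊢tm x [ wkSub idSub ]var ∶ lookup Γ x [ wkSub idSub ]ty
wk-typed Γ A x = subst₂ (Γ ▸ A ⊢tm_∶_) (sym (trans (var-wkSub x) (cong wkTm (var-idSub x))))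
  (sym (ty-wk (lookup Γ x))) (tm-var (suc x))

wkTm-typed : {Γ : Ctx n} {A B : Ty n} {t : Tm n} → Γ ⊢tm t ∶ A → Γ ▸ B ⊢tm wkTm t ∶ wkTy A
wkTm-typed {Γ = Γ} {A} {B} {t} p =
  subst₂ (Γ ▸ B ⊢tm_∶_) (tm-wk t) (ty-wk A) (tm-[]-typed p (wk-typed Γ B))

wkSub-typed : {Γ : Ctx n} {Δ : Ctx m} {B : Ty n} {σ : Sub m n} →
              Γ ⊢sub σ ∶ Δ → Γ ▸ B ⊢sub wkSub σ ∶ Δ
wkSub-typed sub-⟨⟩ = sub-⟨⟩
wkSub-typed (sub-, {A = A} p q) =
  sub-, (wkSub-typed p) (tm-cast (sym (ty-wkSub A)) (wkTm-typed q))

idSub-typed : (Γ : Ctx n) → Γ ⊢sub idSub ∶ Γ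
idSub-typed ∅       = sub-⟨⟩
idSub-typed (Γ ▸ A) = sub-, (wkSub-typed (idSub-typed Γ)) (tm-cast (sym (ty-wk A)) (tm-var zero))

-- That su′ preserves support is not provable by induction on its derivations
-- directly, since the induction would have to be applied to equations
-- obtained by inversion.  Derivations are therefore first translated to the
-- theory in which every rule is required to preserve support.
su′ₛ : RuleSet
su′ₛ Γ s t = su′ Γ s t × SameSupp Γ (FVTm s) (FVTm t)

module S = Catt su′ₛ

su′ₛ-supp : {Γ : Ctx n} {s t : Tm n} {A : Ty n} → su′ₛ Γ s t → Γ S.⊢tm s ∶ A →
            SameSupp Γ (FVTm s) (FVTm t)
su′ₛ-supp r _ = proj₂ r

module Suppₛ = Support su′ₛ su′ₛ-supp

ty-translate    : {Γ : Ctx n} {A : Ty n} → Γ ⊢ty A → Γ S.⊢ty A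
tm-translate    : {Γ : Ctx n} {t : Tm n} {A : Ty n} → Γ ⊢tm t ∶ A → Γ S.⊢tm t ∶ A
sub-translate   : {Γ : Ctx n} {Δ : Ctx m} {σ : Sub m n} → Γ ⊢sub σ ∶ Δ → Γ S.⊢sub σ ∶ Δ
ty-≈-translate  : {Γ : Ctx n} {A B : Ty n} → Γ ⊢ty A ≈ B → Γ S.⊢ty A ≈ B
tm-≈-translate  : {Γ : Ctx n} {s t : Tm n} → Γ ⊢tm s ≈ t → Γ S.⊢tm s ≈ t
sub-≈-translate : {Γ : Ctx n} {σ τ : Sub m n} → Γ ⊢sub σ ≈ τ → Γ S.⊢sub σ ≈ τ
ty-translate ty-⋆         = S.ty-⋆
ty-translate (ty-⟶ a b c) = S.ty-⟶ (ty-translate a) (tm-translate b) (tm-translate c)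
tm-translate (tm-var x)       = S.tm-var x
tm-translate (tm-conv p q)    = S.tm-conv (tm-translate p) (ty-≈-translate q)
tm-translate (tm-coh a b c o) = S.tm-coh a (ty-translate b) (sub-translate c) o
sub-translate sub-⟨⟩     = S.sub-⟨⟩
sub-translate (sub-, p q) = S.sub-, (sub-translate p) (tm-translate q)
ty-≈-translate ≈-⋆         = S.≈-⋆
ty-≈-translate (≈-⟶ p q r) = S.≈-⟶ (tm-≈-translate p) (ty-≈-translate q) (tm-≈-translate r)
tm-≈-translate (≈-var x)     = S.≈-var x
tm-≈-translate (≈-sym p)     = S.≈-sym (tm-≈-translate p)
tm-≈-translate (≈-trans p q) = S.≈-trans (tm-≈-translate p) (tm-≈-translate q)
tm-≈-translate (≈-coh p q)   = S.≈-coh (ty-≈-translate p) (sub-≈-translate q)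
tm-≈-translate (≈-rule r p)  with tm-translate p
... | p′ = S.≈-rule (r , Suppₛ.su′-supp r p′) p′
sub-≈-translate ≈-⟨⟩      = S.≈-⟨⟩
sub-≈-translate (≈-, p q) = S.≈-, (sub-≈-translate p) (tm-≈-translate q)

su′-preserves-supp : {Γ : Ctx n} {s t : Tm n} {A : Ty n} → su′ Γ s t → Γ ⊢tm s ∶ A →
                     SameSupp Γ (FVTm s) (FVTm t)
su′-preserves-supp r p = Suppₛ.su′-supp r (tm-translate p)

open Support su′ su′-preserves-supp public
  using (ty-supp; tm-supp; type-supp; supp-[]⁺)

-- Typing of pruning

VarTy-typed : {Γ : Ctx n} {A : Ty n} → VarTy Γ A → Γ ⊢ty A
VarTy-typed ⋆ᵛ = ty-⋆
VarTy-typed (⟶ᵛ {x = x} {y} v p q) =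
  ty-⟶ (VarTy-typed v) (tm-cast p (tm-var x)) (tm-cast q (tm-var y))

dyck-ty-typed : (W : Dyck d) → ⌊ W ⌋ ⊢ty ⌊ W ⌋ty
dyck-ty-typed W = VarTy-typed (PsVar.var-ty (dyck-var W))

dyck-tm-typed : (W : Dyck d) → ⌊ W ⌋ ⊢tm ⌊ W ⌋tm ∶ ⌊ W ⌋ty
dyck-tm-typed W with dyck-var W
... | psVar {x} eq l _ = subst₂ (⌊ W ⌋ ⊢tm_∶_) (sym eq) l (tm-var x)

disc-ty-typed : ∀ k → D k ⊢ty U k
disc-tm-typed : ∀ k → D k ⊢tm var zero ∶ U k
disc-ty-typed zero    = ty-⋆
disc-ty-typed (suc k) = wkTy-typed (ty-⟶ (wkTy-typed (disc-ty-typed k))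
  (wkTm-typed (disc-tm-typed k)) (tm-var zero))
  where
  wkTy-typed : {Γ : Ctx n} {A B : Ty n} → Γ ⊢ty A → Γ ▸ B ⊢ty wkTy A
  wkTy-typed {A = A} p = subst (_ ⊢ty_) (ty-wk A) (ty-[]-typed p (wk-typed _ _))
disc-tm-typed zero    = tm-var zero
disc-tm-typed (suc k) = tm-var zero

idTm-typed : {Γ : Ctx n} (A : Ty n) {t : Tm n} → Γ ⊢ty A → Γ ⊢tm t ∶ A →
             Γ ⊢tm idTm A t ∶ t ─⟨ A ⟩⟶ t
idTm-typed A p q = tm-cast (idTy-[] A) (tm-coh (disc-ps₀ (dim A))
  (ty-⟶ (disc-ty-typed _) (disc-tm-typed _) (disc-tm-typed _))
  (disc-typed A p q) (disc-operation (dim A)))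

ty-π : {W : Dyck d} (p : Peak W) → ⌊ W ⌋ty [ π p ]ty ≡ ⌊ W // p ⌋ty
tm-π : {W : Dyck d} (p : Peak W) → ⌊ W ⌋tm [ π p ]tm ≡ ⌊ W // p ⌋tm
ty-π (here E) = trans (wkTy-⟨,⟩ (wkTy ⌊ E ⌋ty)) (trans (wkTy-⟨,⟩ ⌊ E ⌋ty) (ty-idSub ⌊ E ⌋ty))
ty-π {W = W ⇑} (p ⇑ₚ) = cong-⟶
  (trans (wkTm-⟨,⟩ (wkTm ⌊ W ⌋tm)) (trans (wkTm-⟨,⟩ ⌊ W ⌋tm)
    (trans (tm-wkSub ⌊ W ⌋tm) (cong wkTm (trans (tm-wkSub ⌊ W ⌋tm) (cong wkTm (tm-π p)))))))
  (trans (wkTy-⟨,⟩ (wkTy ⌊ W ⌋ty)) (trans (wkTy-⟨,⟩ ⌊ W ⌋ty)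
    (trans (ty-wkSub ⌊ W ⌋ty) (cong wkTy (trans (ty-wkSub ⌊ W ⌋ty) (cong wkTy (ty-π p)))))))
  refl
ty-π {W = W ⇓} (p ⇓ₚ) = trans (sym (tyBase-[] ⌊ W ⌋ty)) (cong tyBase (ty-π p))
tm-π (here E) = refl
tm-π (p ⇑ₚ) = refl
tm-π {W = W ⇓} (p ⇓ₚ) = trans (sym (tyTarget-[] ⌊ W ⌋ty)) (cong₂ tyTarget (ty-π p) (tm-π p))

π-typed : {W : Dyck d} (p : Peak W) → ⌊ W // p ⌋ ⊢sub π p ∶ ⌊ W ⌋
π-typed (here E) = sub-, (sub-, (idSub-typed ⌊ E ⌋)
  (tm-cast (sym (ty-idSub ⌊ E ⌋ty)) (dyck-tm-typed E)))
  (tm-cast (sym (cong-⟶ (trans (wkTm-⟨,⟩ ⌊ E ⌋tm) (tm-idSub ⌊ E ⌋tm))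
                        (trans (wkTy-⟨,⟩ ⌊ E ⌋ty) (ty-idSub ⌊ E ⌋ty)) refl))
    (idTm-typed ⌊ E ⌋ty (dyck-ty-typed E) (dyck-tm-typed E)))
π-typed {W = W ⇑} (p ⇑ₚ) = sub-, (sub-, (wkSub-typed (wkSub-typed (π-typed p)))
  (tm-cast (sym (ty-eq)) (tm-var (suc zero))))
  (tm-cast (sym (cong-⟶ (trans (wkTm-⟨,⟩ ⌊ W ⌋tm) tm-eq) (trans (wkTy-⟨,⟩ ⌊ W ⌋ty) ty-eq) refl)) (tm-var zero))
  where
  ty-eq : ⌊ W ⌋ty [ wkSub (wkSub (π p)) ]ty ≡ wkTy (wkTy ⌊ W // p ⌋ty)
  ty-eq = trans (ty-wkSub ⌊ W ⌋ty) (cong wkTy (trans (ty-wkSub ⌊ W ⌋ty) (cong wkTy (ty-π p))))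
  tm-eq : ⌊ W ⌋tm [ wkSub (wkSub (π p)) ]tm ≡ wkTm (wkTm ⌊ W // p ⌋tm)
  tm-eq = trans (tm-wkSub ⌊ W ⌋tm) (cong wkTm (trans (tm-wkSub ⌊ W ⌋tm) (cong wkTm (tm-π p))))
π-typed (p ⇓ₚ) = π-typed p

π-⇑-∙ : {W : Dyck d} (p : Peak W) (ρ : Sub (size (W // p)) n) {s t : Tm n} →
        π (p ⇑ₚ) ∙ ⟨ ⟨ ρ , s ⟩ , t ⟩ ≡ ⟨ ⟨ π p ∙ ρ , s ⟩ , t ⟩
π-⇑-∙ p ρ = cong (λ τ → ⟨ ⟨ τ , _ ⟩ , _ ⟩) (trans (wkSub-⟨,⟩ (wkSub (π p))) (wkSub-⟨,⟩ (π p)))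

-- The peak being an identity whose boundary is determined by its type, the
-- deleted entries are recovered from the others up to equality.
//ˢ-typed : {Γ : Ctx n} {W : Dyck d} (p : Peak W) (σ : Sub (size W) n) → Γ ⊢sub σ ∶ ⌊ W ⌋ →
            IsIdentity (peakVar p [ σ ]var) →
            (Γ ⊢sub σ //ˢ p ∶ ⌊ W // p ⌋) × (Γ ⊢sub π p ∙ (σ //ˢ p) ≈ σ)
//ˢ-typed {Γ = Γ} (here E) ⟨ ⟨ σ , s ⟩ , _ ⟩ (sub-, (sub-, a b) c) (A , u , refl) with id-inv A c
... | _ , _ , ≈-⟶ p q r = a , ≈-, (≈-, (sub-reflexive (idSub-∙ σ)) (≈-trans (≈-sym p′) r))
      (subst (λ t → Γ ⊢tm t ≈ idTm A u) (sym (idTm-[] ⌊ E ⌋ty ⌊ E ⌋tm)) (idTm-≈ (ty-sym q′) (≈-sym p′)))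
  where
  p′ : Γ ⊢tm u ≈ ⌊ E ⌋tm [ σ ]tm
  p′ = subst (λ t → Γ ⊢tm u ≈ t) (wkTm-⟨,⟩ ⌊ E ⌋tm) p
  q′ : Γ ⊢ty A ≈ ⌊ E ⌋ty [ σ ]ty
  q′ = subst (λ B → Γ ⊢ty A ≈ B) (wkTy-⟨,⟩ ⌊ E ⌋ty) q
//ˢ-typed {Γ = Γ} (_⇑ₚ {W = W} p) ⟨ ⟨ σ , s ⟩ , t ⟩ (sub-, (sub-, a b) c) i with //ˢ-typed p σ a i
... | typed , eq = sub-, (sub-, typed (tm-conv b ty-eq)) (tm-conv c (≈-⟶
        (subst₂ (Γ ⊢tm_≈_) (sym (wkTm-⟨,⟩ ⌊ W ⌋tm)) (sym (wkTm-⟨,⟩ ⌊ W // p ⌋tm)) tm-eq)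
        (subst₂ (Γ ⊢ty_≈_) (sym (wkTy-⟨,⟩ ⌊ W ⌋ty)) (sym (wkTy-⟨,⟩ ⌊ W // p ⌋ty)) ty-eq)
        (tm-refl s))) ,
      subst (λ τ → Γ ⊢sub τ ≈ ⟨ ⟨ σ , s ⟩ , t ⟩) (sym (π-⇑-∙ p (σ //ˢ p)))
        (≈-, (≈-, eq (tm-refl s)) (tm-refl t))
  where
  ty-eq : Γ ⊢ty ⌊ W ⌋ty [ σ ]ty ≈ ⌊ W // p ⌋ty [ σ //ˢ p ]ty
  ty-eq = subst (λ B → Γ ⊢ty ⌊ W ⌋ty [ σ ]ty ≈ B)
    (trans (ty-∙ ⌊ W ⌋ty) (cong (_[ σ //ˢ p ]ty) (ty-π p))) (ty-sym (ty-[]-≈ ⌊ W ⌋ty eq))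
  tm-eq : Γ ⊢tm ⌊ W ⌋tm [ σ ]tm ≈ ⌊ W // p ⌋tm [ σ //ˢ p ]tm
  tm-eq = subst (λ B → Γ ⊢tm ⌊ W ⌋tm [ σ ]tm ≈ B)
    (trans (tm-∙ ⌊ W ⌋tm) (cong (_[ σ //ˢ p ]tm) (tm-π p))) (≈-sym (tm-[]-≈ ⌊ W ⌋tm eq))
//ˢ-typed (p ⇓ₚ) σ a i = //ˢ-typed p σ a i

-- Boundaries of pruned contexts

dimCtx-// : {W : Dyck d} (p : Peak W) → dimCtx ⌊ W // p ⌋ ≤ dimCtx ⌊ W ⌋
dimCtx-// (here E) = ≤-trans (m≤m⊔n _ _) (m≤m⊔n _ _)
dimCtx-// {W = W ⇑} (p ⇑ₚ) =
  ⊔-mono-≤ (⊔-mono-≤ (dimCtx-// p) (≤-reflexive (trans (dim-⌊⌋ty (W // p)) (sym (dim-⌊⌋ty W)))))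
    (≤-reflexive (trans (lastDim-⇑ (W // p)) (sym (lastDim-⇑ W))))
dimCtx-// (p ⇓ₚ) = dimCtx-// p

π-⇑-var : {W : Dyck d} (p : Peak W) (x : Fin (size W)) →
          suc (suc x) [ π (p ⇑ₚ) ]var ≡ wkTm (wkTm (x [ π p ]var))
π-⇑-var p x = trans (var-wkSub x) (cong wkTm (var-wkSub x))

-- The only variables that π p identifies are the source and the target of the
-- peak, and these do not both belong to ∂ i ⁺ when i is their dimension.
π-injective : ∀ {i} {W : Dyck d} (p : Peak W) (x y : Fin (size W)) → Bd i ⁺ W x → Bd i ⁺ W y →
              lookupDim ⌊ W ⌋ x ≡ i → lookupDim ⌊ W ⌋ y ≡ i → ∀ {w} →
              x [ π p ]var ≡ var w → y [ π p ]var ≡ var w → x ≡ y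
π-injective (here E) zero y b c q r () f
π-injective (here E) (suc x) zero b c q r e ()
π-injective (here E) (suc zero) (suc zero) b c q r e f = refl
π-injective (here E) (suc zero) (suc (suc y)) b (_ , nr) q r e f =
  ⊥-elim (nr (trans (sym q) (lookupDim-⇑₁ E) , refl , trans e (trans (sym f) (var-idSub y))))
π-injective (here E) (suc (suc x)) (suc zero) (_ , nr) c q r e f =
  ⊥-elim (nr (trans (sym r) (lookupDim-⇑₁ E) , refl , trans f (trans (sym e) (var-idSub x))))
π-injective (here E) (suc (suc x)) (suc (suc y)) b c q r e f =
  cong (λ z → suc (suc z)) (var-injective (trans (sym (var-idSub x)) (trans (trans e (sym f)) (var-idSub y))))
π-injective (p ⇑ₚ) zero zero b c q r e f = refl
π-injective (p ⇑ₚ) (suc zero) (suc zero) b c q r e f = refl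
π-injective (p ⇑ₚ) zero (suc zero) b c q r refl ()
π-injective (p ⇑ₚ) (suc zero) zero b c q r refl ()
π-injective (p ⇑ₚ) zero (suc (suc y)) b c q r refl f with wkTm-var (trans (sym (var-wkSub y)) f)
... | _ , _ , ()
π-injective (p ⇑ₚ) (suc zero) (suc (suc y)) b c q r refl f
  with wkTm-var (trans (sym (π-⇑-var p y)) f)
... | z , eq , refl with wkTm-var eq
...   | _ , _ , ()
π-injective (p ⇑ₚ) (suc (suc x)) zero b c q r e refl with wkTm-var (trans (sym (var-wkSub x)) e)
... | _ , _ , ()
π-injective (p ⇑ₚ) (suc (suc x)) (suc zero) b c q r e refl
  with wkTm-var (trans (sym (π-⇑-var p x)) e)
... | z , eq , refl with wkTm-var eq
...   | _ , _ , ()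
π-injective {W = W ⇑} (p ⇑ₚ) (suc (suc x)) (suc (suc y)) (b , _) (c , _) q r e f
  with wkTm-var (trans (sym (π-⇑-var p x)) e) | wkTm-var (trans (sym (π-⇑-var p y)) f)
... | z , eq , refl | .z , eq′ , refl with wkTm-var eq | wkTm-var eq′
...   | v , e′ , refl | .v , f′ , refl = cong (λ z → suc (suc z))
  (π-injective p x y b c (trans (sym (lookupDim-⇑ W x)) q) (trans (sym (lookupDim-⇑ W y)) r) e′ f′)
π-injective (p ⇓ₚ) x y b c q r e f = π-injective p x y b c q r e f

-- Only the peak goes to a term other than a variable, namely an identity, whose variables all have
-- lower dimension than the peak.
π-var-or-lower : {W : Dyck d} (p : Peak W) (x : Fin (size W)) →
                 (∃[ w ] x [ π p ]var ≡ var w) ⊎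
                 (∀ {w} → w ∈ FVTm (x [ π p ]var) → lookupDim ⌊ W // p ⌋ w < lookupDim ⌊ W ⌋ x)
π-var-or-lower (here E) zero = inj₂ lower
  where
  lower : ∀ {w} → w ∈ FVSub ⦅ ⌊ E ⌋ty , ⌊ E ⌋tm ⦆ → lookupDim ⌊ E ⌋ w < lookupDim ⌊ E ⇑ ⌋ zero
  lower {w} e with FV-⦅⦆⁻ ⌊ E ⌋ty e
  ... | inj₁ f = subst (lookupDim ⌊ E ⌋ w <_) (sym (lookupDim-⇑₀ E)) (m<n⇒m<1+n (FV-⌊⌋ty E f))
  ... | inj₂ f with dyck-var E
  ...   | psVar {v} eq _ _ with x∈⁅y⁆⇒x≡y v (subst (λ t → w ∈ FVTm t) eq f)
  ...     | refl = ≤-reflexive (trans (cong suc (dim-⌊⌋tm E eq)) (sym (lookupDim-⇑₀ E)))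
π-var-or-lower (here E) (suc zero) with dyck-var E
... | psVar {v} eq _ _ = inj₁ (v , eq)
π-var-or-lower (here E) (suc (suc x)) = inj₁ (x , var-idSub x)
π-var-or-lower (p ⇑ₚ) zero = inj₁ (zero , refl)
π-var-or-lower (p ⇑ₚ) (suc zero) = inj₁ (suc zero , refl)
π-var-or-lower {W = W ⇑} (p ⇑ₚ) (suc (suc x)) with π-var-or-lower p x
... | inj₁ (w , eq) = inj₁ (suc (suc w) , trans (π-⇑-var p x) (cong (λ t → wkTm (wkTm t)) eq))
... | inj₂ f = inj₂ lower
  where
  lower : ∀ {w} → w ∈ FVTm (x [ wkSub (wkSub (π p)) ]var) →
          lookupDim ⌊ (W // p) ⇑ ⌋ w < lookupDim ⌊ W ⇑ ⌋ (suc (suc x))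
  lower e with wk⁻ (FVTm-wk (wkTm (x [ π p ]var))) (subst (λ t → _ ∈ FVTm t) (π-⇑-var p x) e)
  ... | wk e₁ with wk⁻ (FVTm-wk (x [ π p ]var)) e₁
  ...   | wk {w} e₂ = subst₂ _<_ (sym (lookupDim-⇑ (W // p) w)) (sym (lookupDim-⇑ W x)) (f e₂)
π-var-or-lower (p ⇓ₚ) x = π-var-or-lower p x

π-dim : {W : Dyck d} (p : Peak W) (x : Fin (size W)) {w : Fin (size (W // p))} →
        x [ π p ]var ≡ var w → lookupDim ⌊ W // p ⌋ w ≡ lookupDim ⌊ W ⌋ x
π-dim {W = W} p x {w} eq = trans (dim-≈ (var-inv (subst (λ t → ⌊ W // p ⌋ ⊢tm t ∶ lookup ⌊ W ⌋ x [ π p ]ty)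
  eq (sub-var (π-typed p) x)))) (dim-[] (lookup ⌊ W ⌋ x))

Bd-π⁺ : ∀ {i ε} {W : Dyck d} (p : Peak W) {x w} → Bd i ε W x → w ∈ FVTm (x [ π p ]var) →
        Bd i ε (W // p) w
Bd-π⁺ (here E) {zero} b e with FV-⦅⦆⁻ ⌊ E ⌋ty e
... | inj₁ f = Bd-closed-tm E (inj₁ b) f
... | inj₂ f with dyck-var E
...   | psVar {v} eq _ _ =
  Bd-tm E (trans eq (cong var (sym (x∈⁅y⁆⇒x≡y v (subst (λ t → _ ∈ FVTm t) eq f))))) (inj₁ b)
Bd-π⁺ (here E) {suc zero} b f with dyck-var E
... | psVar {v} eq _ _ =
  Bd-tm E (trans eq (cong var (sym (x∈⁅y⁆⇒x≡y v (subst (λ t → _ ∈ FVTm t) eq f))))) b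
Bd-π⁺ {i = i} {ε} (here E) {suc (suc x)} (b , _) e =
  subst (Bd i ε E) (sym (x∈⁅y⁆⇒x≡y x (subst (λ t → _ ∈ FVTm t) (var-idSub x) e))) b
Bd-π⁺ (p ⇑ₚ) {zero} b e with x∈⁅y⁆⇒x≡y zero e
... | refl = b
Bd-π⁺ (p ⇑ₚ) {suc zero} b e with x∈⁅y⁆⇒x≡y (suc zero) e
... | refl = b
Bd-π⁺ {i = i} {ε} {W = W ⇑} (p ⇑ₚ) {suc (suc x)} (b , nr) e
  with wk⁻ (FVTm-wk (wkTm (x [ π p ]var))) (subst (λ t → _ ∈ FVTm t) (π-⇑-var p x) e)
... | wk e₁ with wk⁻ (FVTm-wk (x [ π p ]var)) e₁
...   | wk {w} e₂ = Bd-π⁺ p b e₂ , removed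
  where
  -- If `w` were the source removed from `W // p`, its dimension would force `x` to be sent to the
  -- variable `w`, like `⌊ W ⌋tm`. By `π-injective`, `x` would be `⌊ W ⌋tm` and so removed already.
  removed : ¬ (i ≡ _ × ε ≡ ⁺ × ⌊ W // p ⌋tm ≡ var w)
  removed (refl , refl , eq) with π-var-or-lower p x | dyck-var W
  ... | inj₂ f | _ = <-irrefl (dim-⌊⌋tm (W // p) eq) (≤-trans (f e₂) (Bd-dim W x b))
  ... | inj₁ (v , eq′) | psVar {z} eq″ _ _
    with x∈⁅y⁆⇒x≡y v (subst (λ t → _ ∈ FVTm t) eq′ e₂)
  ...   | refl = nr (refl , refl , trans eq″ (cong var (sym
    (π-injective p x z b (Bd-tm W eq″ (inj₂ (refl , refl)))
      (trans (sym (π-dim p x eq′)) (dim-⌊⌋tm (W // p) eq)) (dim-⌊⌋tm W eq″) eq′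
      (trans (sym (cong (_[ π p ]tm) eq″)) (trans (tm-π p) eq))))))
Bd-π⁺ (p ⇓ₚ) b e = Bd-π⁺ p b e

supp-var⁻ : {Γ : Ctx n} {x y : Fin n} → Supp Γ (var x) y → y ≡ x ⊎ Closure Γ (FVTy (lookup Γ x)) y
supp-var⁻ {x = x} (base e) = inj₁ (x∈⁅y⁆⇒x≡y x e)
supp-var⁻ (step c e) with supp-var⁻ c
... | inj₁ refl = inj₂ (base e)
... | inj₂ c′   = inj₂ (step c′ e)

supp-wk : {Γ : Ctx n} {A : Ty n} (t : Tm n) {x : Fin n} → Supp Γ t x → Supp (Γ ▸ A) (wkTm t) (suc x)
supp-wk t c = Closure-wk c λ e → base (wk⁺ (FVTm-wk t) e)

closure-[]⁻ : {Γ : Ctx n} (A : Ty m) {σ : Sub m n} {w : Fin n} → Closure Γ (FVTy (A [ σ ]ty)) w →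
              ∃[ x ] x ∈ FVTy A × Supp Γ (x [ σ ]var) w
closure-[]⁻ A (base e) with FVTy-[]⁻ A e
... | x , p , q = x , p , base q
closure-[]⁻ A (step c e) with closure-[]⁻ A c
... | x , p , q = x , p , step q e

removed? : ∀ i ε (W : Dyck d) x → Dec (i ≡ d × ε ≡ ⁺ × ⌊ W ⌋tm ≡ var x)
removed? {d} i ε W x with i ≟ d | ε | dyck-var W
... | no i≢d | _ | _ = no λ { (q , _) → i≢d q }
... | yes q  | ⁻ | _ = no λ { (_ , () , _) }
... | yes q  | ⁺ | psVar {v} eq _ _ with v Fin.≟ x
...   | yes refl = yes (q , refl , eq)
...   | no v≢x   = no λ { (_ , _ , r) → v≢x (var-injective (trans (sym eq) r)) }

-- Preimages exist only up to support. If the source of the peak was removed, the target of the peak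
-- replaces it. If the preimage found is a removed `⌊ W ⌋tm`, then `w` lies in the support of the
-- type of its image, and a variable of `⌊ W ⌋ty` serves, being of too low a dimension to be
-- removed.
Bd-π⁻ : ∀ {i ε} {W : Dyck d} (p : Peak W) {w} → Bd i ε (W // p) w →
        ∃[ x ] Bd i ε W x × Supp ⌊ W // p ⌋ (x [ π p ]var) w
Bd-π⁻ {i = i} {ε} (here E) {w} b with removed? i ε E w
... | no nr = suc (suc w) , (b , nr) ,
  subst (λ t → Supp ⌊ E ⌋ t w) (sym (var-idSub w)) (base (x∈⁅x⁆ w))
... | yes (q , r , eq) = suc zero , inj₂ (q , r) ,
  subst (λ t → Supp ⌊ E ⌋ t w) (sym eq) (base (x∈⁅x⁆ w))
Bd-π⁻ (p ⇑ₚ) {zero} b = zero , b , base (x∈⁅x⁆ zero)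
Bd-π⁻ (p ⇑ₚ) {suc zero} b = suc zero , b , base (x∈⁅x⁆ (suc zero))
Bd-π⁻ {d = suc d} {i = i} {ε} {W ⇑} (p ⇑ₚ) {suc (suc w)} (b , nr) with Bd-π⁻ p b
... | x , b′ , c = choose (removed? i ε W x)
  where
  up : ∀ x → Supp ⌊ W // p ⌋ (x [ π p ]var) w →
       Supp ⌊ (W // p) ⇑ ⌋ (suc (suc x) [ π (p ⇑ₚ) ]var) (suc (suc w))
  up x c = subst (λ t → Supp ⌊ (W // p) ⇑ ⌋ t (suc (suc w))) (sym (π-⇑-var p x))
    (supp-wk (wkTm (x [ π p ]var)) (supp-wk (x [ π p ]var) c))
  choose : Dec (i ≡ d × ε ≡ ⁺ × ⌊ W ⌋tm ≡ var x) →
           ∃[ y ] Bd i ε (W ⇑) y × Supp ⌊ (W // p) ⇑ ⌋ (y [ π (p ⇑ₚ) ]var) (suc (suc w))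
  choose (no ¬r) = suc (suc x) , (b′ , ¬r) , up x c
  choose (yes (refl , refl , eq)) with dyck-var (W // p)
  ... | psVar {v} eq′ l _ with supp-var⁻ (subst (λ t → Supp ⌊ W // p ⌋ t w)
                               (trans (sym (cong (_[ π p ]tm) eq)) (trans (tm-π p) eq′)) c)
  ...   | inj₁ refl = ⊥-elim (nr (refl , refl , eq′))
  ...   | inj₂ c′ with closure-[]⁻ ⌊ W ⌋ty (subst (λ A → Closure ⌊ W // p ⌋ (FVTy A) w)
                         (trans l (sym (ty-π p))) c′)
  ...     | y , e , c″ = suc (suc y) , (Bd-closed-tm W (inj₂ (refl , refl)) e ,
    λ { (_ , _ , r) → <-irrefl (dim-⌊⌋tm W r) (FV-⌊⌋ty W e) }) , up y c″
Bd-π⁻ (p ⇓ₚ) b = Bd-π⁻ p b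

supp-[]⁻ : {Γ : Ctx n} {Δ : Ctx m} {σ : Sub m n} (s : Tm m) {w : Fin n} →
           Supp Γ (s [ σ ]tm) w → ∃[ x ] Supp Δ s x × Supp Γ (x [ σ ]var) w
supp-[]⁻ s (base e) with FVTm-[]⁻ s e
... | x , p , q = x , base p , base q
supp-[]⁻ s (step c e) with supp-[]⁻ s c
... | x , p , q = x , p , step q e

Bd-supp : ∀ {i ε} (W : Dyck d) {S w} → (∀ {x} → x ∈ S → Bd i ε W x) → Closure ⌊ W ⌋ S w → Bd i ε W w
Bd-supp W f (base e)   = f e
Bd-supp W f (step {x} c e) = Bd-closed W x (Bd-supp W f c) e

//-operation : {W : Dyck 0} (p : Peak W) (s t : Tm (size W)) →
               𝒪 ⌊ W ⌋ (Supp ⌊ W ⌋ s) (Supp ⌊ W ⌋ t) →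
               𝒪 ⌊ W // p ⌋ (Supp ⌊ W // p ⌋ (s [ π p ]tm)) (Supp ⌊ W // p ⌋ (t [ π p ]tm))
//-operation {W} p s t (regular q i le S T) =
  regular (dyck-ps₀ (W // p)) i (≤-trans (dimCtx-// p) le) (transport ⁻ s S) (transport ⁺ t T)
  where
  rep  = ∂ps-represents W q
  rep′ = ∂ps-represents (W // p) (dyck-ps₀ (W // p))
  transport : ∀ ε s → (∀ {x} → Supp ⌊ W ⌋ s x → x ∈ ∂ps i ε q) × (∀ {x} → x ∈ ∂ps i ε q → Supp ⌊ W ⌋ s x) →
              (∀ {x} → Supp ⌊ W // p ⌋ (s [ π p ]tm) x → x ∈ ∂ps i ε (dyck-ps₀ (W // p))) ×
              (∀ {x} → x ∈ ∂ps i ε (dyck-ps₀ (W // p)) → Supp ⌊ W // p ⌋ (s [ π p ]tm) x)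
  transport ε s (f , g) = to , from
    where
    to : ∀ {w} → Supp ⌊ W // p ⌋ (s [ π p ]tm) w → w ∈ ∂ps i ε (dyck-ps₀ (W // p))
    to {w} c with supp-[]⁻ {Δ = ⌊ W ⌋} s c
    ... | x , a , b = proj₂ (rep′ i ε w) (Bd-supp (W // p) (Bd-π⁺ p (proj₁ (rep i ε x) (f a))) b)
    from : ∀ {w} → w ∈ ∂ps i ε (dyck-ps₀ (W // p)) → Supp ⌊ W // p ⌋ (s [ π p ]tm) w
    from {w} e with Bd-π⁻ p (proj₁ (rep′ i ε w) e)
    ... | x , b , c = Closure-bind c λ z → supp-[]⁺ s (π-typed p) (g (proj₂ (rep i ε x) b)) z

-- Subject reduction

≐-SameSupp : {Γ : Ctx n} {s t : Tm n} → SameSupp Γ (FVTm s) (FVTm t) →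
             (∀ {x} → Supp Γ s x → Supp Γ t x) × (∀ {x} → Supp Γ t x → Supp Γ s x)
≐-SameSupp (f , g) = (λ c → Closure-bind c f) , (λ c → Closure-bind c g)

operation-≈ : {Δ : Ctx m} {s s′ t t′ : Tm m} → Δ ⊢tm s ≈ s′ → Δ ⊢tm t ≈ t′ →
              𝒪 Δ (Supp Δ s) (Supp Δ t) → 𝒪 Δ (Supp Δ s′) (Supp Δ t′)
operation-≈ {s = s} {s′} {t} {t′} p q (regular r i le (a , b) (c , d))
  with ≐-SameSupp {s = s} {s′} (tm-supp p) | ≐-SameSupp {s = t} {t′} (tm-supp q)
... | f , g | f′ , g′ = regular r i le ((λ z → a (g z)) , (λ z → f (b z))) ((λ z → c (g′ z)) , (λ z → f′ (d z)))

rule-typed : {Γ : Ctx n} {s t : Tm n} {B : Ty n} → su′ Γ s t → Γ ⊢tm s ∶ B → Γ ⊢tm t ∶ B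
rule-typed (inj₁ (disc A t)) p with coh-inv p
... | cohInv _ _ _ σ _ r =
  tm-conv (proj₂ (disc-inv A σ)) (ty-trans (ty-reflexive (sym (U-[] A))) r)
rule-typed {Γ = Γ} (inj₂ (inj₁ (prune-peak W p A σ i , _))) q with coh-inv q
... | cohInv {src = s} {t} refl _ a b o r with //ˢ-typed p σ b i
...   | b′ , eq = tm-conv (tm-coh (dyck-ps₀ (W // p)) (ty-[]-typed a (sub-var (π-typed p))) b′ (//-operation p s t o))
  (ty-trans (ty-reflexive (sym (ty-∙ A))) (ty-trans (ty-[]-≈ A eq) r))
rule-typed (inj₂ (inj₂ (endo Δ s A σ , _))) q with coh-inv q
... | cohInv refl _ (ty-⟶ a b _) c _ r = tm-conv
  (idTm-typed (A [ σ ]ty) (ty-[]-typed a (sub-var c)) (tm-[]-typed b (sub-var c))) r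

-- Symmetry forces both directions to be proved together. Backwards across a rule, the redex is
-- typed by the premise of `≈-rule`, and uniqueness of types adjusts that type.
ty-≈-typed   : {Γ : Ctx n} {A B : Ty n} → Γ ⊢ty A ≈ B →
               (Γ ⊢ty A → Γ ⊢ty B) × (Γ ⊢ty B → Γ ⊢ty A)
tm-≈-typed   : {Γ : Ctx n} {s t : Tm n} {B : Ty n} → Γ ⊢tm s ≈ t →
               (Γ ⊢tm s ∶ B → Γ ⊢tm t ∶ B) × (Γ ⊢tm t ∶ B → Γ ⊢tm s ∶ B)
sub-≈-typed  : {Γ : Ctx n} {Δ : Ctx m} {σ τ : Sub m n} → Γ ⊢sub σ ≈ τ →
               (Γ ⊢sub σ ∶ Δ → Γ ⊢sub τ ∶ Δ) × (Γ ⊢sub τ ∶ Δ → Γ ⊢sub σ ∶ Δ)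
ty-≈-typed ≈-⋆ = (λ p → p) , (λ p → p)
ty-≈-typed (≈-⟶ p q r) =
  (λ { (ty-⟶ a b c) → ty-⟶ (proj₁ (ty-≈-typed q) a) (tm-conv (proj₁ (tm-≈-typed p) b) q)
                                                      (tm-conv (proj₁ (tm-≈-typed r) c) q) }) ,
  (λ { (ty-⟶ a b c) → ty-⟶ (proj₂ (ty-≈-typed q) a) (tm-conv (proj₂ (tm-≈-typed p) b) (ty-sym q))
                                                      (tm-conv (proj₂ (tm-≈-typed r) c) (ty-sym q)) })
tm-≈-typed (≈-var x) = (λ p → p) , (λ p → p)
tm-≈-typed (≈-sym p) = proj₂ (tm-≈-typed p) , proj₁ (tm-≈-typed p)
tm-≈-typed (≈-trans p q) = (λ a → proj₁ (tm-≈-typed q) (proj₁ (tm-≈-typed p) a)) ,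
                           (λ a → proj₂ (tm-≈-typed p) (proj₂ (tm-≈-typed q) a))
tm-≈-typed {Γ = Γ} {B = B} (≈-coh {Δ = Δ} {A} {A′} {σ} {τ} p q) = to p , from p
  where
  to : Δ ⊢ty A ≈ A′ → Γ ⊢tm Coh Δ A σ ∶ B → Γ ⊢tm Coh Δ A′ τ ∶ B
  to p′ t with coh-inv t
  to p′@(≈-⟶ u v w) t | cohInv refl a b c o r =
    tm-conv (tm-coh a (proj₁ (ty-≈-typed p) b) (proj₁ (sub-≈-typed q) c) (operation-≈ u w o))
      (ty-trans (ty-sym (ty-trans (ty-≈-[] p′ (sub-var c)) (ty-[]-≈ A′ q))) r)
  from : Δ ⊢ty A ≈ A′ → Γ ⊢tm Coh Δ A′ τ ∶ B → Γ ⊢tm Coh Δ A σ ∶ B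
  from p′ t with coh-inv t
  from p′@(≈-⟶ u v w) t | cohInv refl a b c o r =
    tm-conv (tm-coh a (proj₂ (ty-≈-typed p) b) (proj₂ (sub-≈-typed q) c) (operation-≈ (≈-sym u) (≈-sym w) o))
      (ty-trans (ty-trans (ty-[]-≈ A q) (ty-≈-[] p′ (sub-var c))) r)
tm-≈-typed {t = t} (≈-rule r p) = rule-typed r ,
  λ q → tm-conv p (type-unique t (rule-typed r p) q)
sub-≈-typed ≈-⟨⟩ = (λ p → p) , (λ p → p)
sub-≈-typed (≈-, p q) =
  (λ { (sub-, {A = A} a b) → sub-, (proj₁ (sub-≈-typed p) a) (tm-conv (proj₁ (tm-≈-typed q) b) (ty-[]-≈ A p)) }) ,
  (λ { (sub-, {A = A} a b) → sub-, (proj₂ (sub-≈-typed p) a)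
        (tm-conv (proj₂ (tm-≈-typed q) b) (ty-[]-≈ A (sub-sym p))) })

-- Reduction sequences

infix 4 _⊢ty_⇝*_ _⊢tm_⇝*_ _⊢sub_⇝*_

_⊢ty_⇝*_ : Ctx n → Ty n → Ty n → Set
Γ ⊢ty A ⇝* B = Star (Γ ⊢ty_⇝_) A B

_⊢tm_⇝*_ : Ctx n → Tm n → Tm n → Set
Γ ⊢tm s ⇝* t = Star (Γ ⊢tm_⇝_) s t

_⊢sub_⇝*_ : Ctx n → Sub m n → Sub m n → Set
Γ ⊢sub σ ⇝* τ = Star (Γ ⊢sub_⇝_) σ τ

⟶-⇝* : {Γ : Ctx n} {s s′ t t′ : Tm n} {A A′ : Ty n} → Γ ⊢tm s ⇝* s′ → Γ ⊢ty A ⇝* A′ →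
        Γ ⊢tm t ⇝* t′ → Γ ⊢ty s ─⟨ A ⟩⟶ t ⇝* s′ ─⟨ A′ ⟩⟶ t′
⟶-⇝* p q r = gmap (_─⟨ _ ⟩⟶ _) ⇝-src p ◅◅ gmap (_ ─⟨_⟩⟶ _) ⇝-ty q ◅◅ gmap (_ ─⟨ _ ⟩⟶_) ⇝-tgt r

Coh-⇝* : {Γ : Ctx n} {Δ : Ctx m} {A B : Ty m} {σ τ : Sub m n} → Δ ⊢ty A ⇝* B →
         Γ ⊢sub σ ⇝* τ → Γ ⊢tm Coh Δ A σ ⇝* Coh Δ B τ
Coh-⇝* {Δ = Δ} {B = B} {σ} p q = gmap (λ A → Coh Δ A σ) ⇝-cohTy p ◅◅ gmap (Coh Δ B) ⇝-cohSub q

⟨,⟩-⇝* : {Γ : Ctx n} {σ τ : Sub m n} {s t : Tm n} → Γ ⊢sub σ ⇝* τ → Γ ⊢tm s ⇝* t →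
         Γ ⊢sub ⟨ σ , s ⟩ ⇝* ⟨ τ , t ⟩
⟨,⟩-⇝* {τ = τ} {s} p q = gmap ⟨_, s ⟩ ⇝-init p ◅◅ gmap ⟨ τ ,_⟩ ⇝-last q

ty-⇝-[]  : {Γ : Ctx m} {Δ : Ctx n} {A B : Ty m} (σ : Sub m n) → Γ ⊢ty A ⇝ B →
           Δ ⊢ty A [ σ ]ty ⇝ B [ σ ]ty
tm-⇝-[]  : {Γ : Ctx m} {Δ : Ctx n} {s t : Tm m} (σ : Sub m n) → Γ ⊢tm s ⇝ t →
           Δ ⊢tm s [ σ ]tm ⇝ t [ σ ]tm
sub-⇝-[] : {Γ : Ctx m} {Δ : Ctx n} {τ ρ : Sub l m} (σ : Sub m n) → Γ ⊢sub τ ⇝ ρ →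
           Δ ⊢sub τ ∙ σ ⇝ ρ ∙ σ
ty-⇝-[] σ (⇝-src r) = ⇝-src (tm-⇝-[] σ r)
ty-⇝-[] σ (⇝-ty r)  = ⇝-ty (ty-⇝-[] σ r)
ty-⇝-[] σ (⇝-tgt r) = ⇝-tgt (tm-⇝-[] σ r)
tm-⇝-[] σ (⇝-rule r)   = ⇝-rule (su′-[] σ r)
tm-⇝-[] σ (⇝-cohTy r)  = ⇝-cohTy r
tm-⇝-[] σ (⇝-cohSub r) = ⇝-cohSub (sub-⇝-[] σ r)
sub-⇝-[] σ (⇝-init r) = ⇝-init (sub-⇝-[] σ r)
sub-⇝-[] σ (⇝-last r) = ⇝-last (tm-⇝-[] σ r)

var-[]-⇝ : {Γ : Ctx n} {σ τ : Sub m n} (x : Fin m) → Γ ⊢sub σ ⇝ τ →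
           Γ ⊢tm x [ σ ]var ⇝* x [ τ ]var
var-[]-⇝ zero    (⇝-init r) = done
var-[]-⇝ zero    (⇝-last r) = r ◅ done
var-[]-⇝ (suc x) (⇝-init r) = var-[]-⇝ x r
var-[]-⇝ (suc x) (⇝-last r) = done

ty-[]-⇝ : {Γ : Ctx n} {σ τ : Sub m n} (A : Ty m) → Γ ⊢sub σ ⇝ τ →
          Γ ⊢ty A [ σ ]ty ⇝* A [ τ ]ty
tm-[]-⇝ : {Γ : Ctx n} {σ τ : Sub m n} (t : Tm m) → Γ ⊢sub σ ⇝ τ →
          Γ ⊢tm t [ σ ]tm ⇝* t [ τ ]tm
∙-⇝     : {Γ : Ctx n} {σ τ : Sub m n} (ρ : Sub l m) → Γ ⊢sub σ ⇝ τ →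
          Γ ⊢sub ρ ∙ σ ⇝* ρ ∙ τ
ty-[]-⇝ ⋆              r = done
ty-[]-⇝ (s ─⟨ A ⟩⟶ t) r = ⟶-⇝* (tm-[]-⇝ s r) (ty-[]-⇝ A r) (tm-[]-⇝ t r)
tm-[]-⇝ (var x)     r = var-[]-⇝ x r
tm-[]-⇝ (Coh Δ A ρ) r = Coh-⇝* done (∙-⇝ ρ r)
∙-⇝ ⟨⟩        r = done
∙-⇝ ⟨ ρ , t ⟩ r = ⟨,⟩-⇝* (∙-⇝ ρ r) (tm-[]-⇝ t r)

⦅⦆-⇝-tm : {Γ : Ctx n} (A : Ty n) {s t : Tm n} → Γ ⊢tm s ⇝ t → Γ ⊢sub ⦅ A , s ⦆ ⇝ ⦅ A , t ⦆
⦅⦆-⇝-tm ⋆              r = ⇝-last r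
⦅⦆-⇝-tm (_ ─⟨ _ ⟩⟶ _) r = ⇝-last r

data DiscSub⇝ (Γ : Ctx n) : DiscSub n → DiscSub n → Set where
  discSub⇝ : ∀ {k σ τ} → Γ ⊢sub σ ⇝ τ → DiscSub⇝ Γ (k , σ) (k , τ)

discSub-⇝-ty : {Γ : Ctx n} {A B : Ty n} {t : Tm n} → Γ ⊢ty A ⇝ B →
               DiscSub⇝ Γ (discSub A t) (discSub B t)
discSub-⇝-ty (⇝-src {A = A} r) = discSub⇝ (⇝-init (⇝-init (⦅⦆-⇝-tm A r)))
discSub-⇝-ty (⇝-ty {A = A} {A′} {s} r) with dim A | ⦅ A , s ⦆ | dim A′ | ⦅ A′ , s ⦆ | discSub-⇝-ty {t = s} r
... | _ | _ | _ | _ | discSub⇝ r′ = discSub⇝ (⇝-init (⇝-init r′))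
discSub-⇝-ty (⇝-tgt r) = discSub⇝ (⇝-init (⇝-last r))

idTm-⇝* : {Γ : Ctx n} {A B : Ty n} {s t : Tm n} → Γ ⊢ty A ⇝* B → Γ ⊢tm s ⇝* t →
          Γ ⊢tm idTm A s ⇝* idTm B t
idTm-⇝* {Γ = Γ} {B = B} {s} p q =
  gmap (λ A → idTm A s) (λ r → go (discSub-⇝-ty r)) p ◅◅
  gmap (idTm B) (λ r → ⇝-cohSub (⦅⦆-⇝-tm B r)) q
  where
  go : ∀ {x y} → DiscSub⇝ Γ x y → Γ ⊢tm discCoh idTy x ⇝ discCoh idTy y
  go (discSub⇝ r) = ⇝-cohSub r

ty-⇝-≈  : {Γ : Ctx n} {A B : Ty n} → Γ ⊢ty A → Γ ⊢ty A ⇝ B → Γ ⊢ty A ≈ B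
tm-⇝-≈  : {Γ : Ctx n} {s t : Tm n} {B : Ty n} → Γ ⊢tm s ∶ B → Γ ⊢tm s ⇝ t → Γ ⊢tm s ≈ t
sub-⇝-≈ : {Γ : Ctx n} {Δ : Ctx m} {σ τ : Sub m n} → Γ ⊢sub σ ∶ Δ → Γ ⊢sub σ ⇝ τ → Γ ⊢sub σ ≈ τ
ty-⇝-≈ (ty-⟶ a b c) (⇝-src r) = ≈-⟶ (tm-⇝-≈ b r) (ty-refl _) (tm-refl _)
ty-⇝-≈ (ty-⟶ a b c) (⇝-ty r)  = ≈-⟶ (tm-refl _) (ty-⇝-≈ a r) (tm-refl _)
ty-⇝-≈ (ty-⟶ a b c) (⇝-tgt r) = ≈-⟶ (tm-refl _) (ty-refl _) (tm-⇝-≈ c r)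
tm-⇝-≈ p (⇝-rule r)   = ≈-rule r p
tm-⇝-≈ p (⇝-cohTy r)  = ≈-coh (ty-⇝-≈ (CohInv.ty-typed (coh-inv p)) r) (sub-refl _)
tm-⇝-≈ p (⇝-cohSub r) = ≈-coh (ty-refl _) (sub-⇝-≈ (CohInv.sub-typed (coh-inv p)) r)
sub-⇝-≈ (sub-, p q) (⇝-init r) = ≈-, (sub-⇝-≈ p r) (tm-refl _)
sub-⇝-≈ (sub-, p q) (⇝-last r) = ≈-, (sub-refl _) (tm-⇝-≈ q r)

tm-⇝-typed : {Γ : Ctx n} {s t : Tm n} {B : Ty n} → Γ ⊢tm s ∶ B → Γ ⊢tm s ⇝ t → Γ ⊢tm t ∶ B
tm-⇝-typed p r = proj₁ (tm-≈-typed (tm-⇝-≈ p r)) p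

-- Recognising identities

lookup-D : ∀ k → lookup (D k) zero ≡ U k
lookup-D zero    = refl
lookup-D (suc k) = refl

VarTy-U : ∀ k → VarTy (D k) (U k)
VarTy-U zero    = ⋆ᵛ
VarTy-U (suc k) = VarTy-wk (⟶ᵛ (VarTy-wk (VarTy-U k)) (cong wkTy (lookup-D k)) refl)

VarTy-idTy : ∀ k → VarTy (D k) (idTy k)
VarTy-idTy k = ⟶ᵛ (VarTy-U k) (lookup-D k) (lookup-D k)

VarTy-normal : {Γ Δ : Ctx n} {A B : Ty n} → VarTy Γ A → ¬ (Δ ⊢ty A ⇝ B)
VarTy-normal (⟶ᵛ v p q) (⇝-src (⇝-rule (inj₁ ())))
VarTy-normal (⟶ᵛ v p q) (⇝-src (⇝-rule (inj₂ (inj₁ (() , _)))))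
VarTy-normal (⟶ᵛ v p q) (⇝-src (⇝-rule (inj₂ (inj₂ (() , _)))))
VarTy-normal (⟶ᵛ v p q) (⇝-ty r) = VarTy-normal v r
VarTy-normal (⟶ᵛ v p q) (⇝-tgt (⇝-rule (inj₁ ())))
VarTy-normal (⟶ᵛ v p q) (⇝-tgt (⇝-rule (inj₂ (inj₁ (() , _)))))
VarTy-normal (⟶ᵛ v p q) (⇝-tgt (⇝-rule (inj₂ (inj₂ (() , _)))))

var? : (t : Tm n) (x : Fin n) → Dec (t ≡ var x)
var? (var y)     x = map′ (cong var) var-injective (y Fin.≟ x)
var? (Coh _ _ _) x = no λ ()

varTy? : {Γ : Ctx n} (A : Ty n) {B : Ty n} → VarTy Γ B → Dec (A ≡ B)
varTy? ⋆              ⋆ᵛ = yes refl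
varTy? (_ ─⟨ _ ⟩⟶ _) ⋆ᵛ = no λ ()
varTy? ⋆              (⟶ᵛ _ _ _) = no λ ()
varTy? (s ─⟨ A ⟩⟶ t) (⟶ᵛ {x = x} {y} v _ _) with var? s x | varTy? A v | var? t y
... | yes refl | yes refl | yes refl = yes refl
... | no ¬p | _ | _ = no λ { refl → ¬p refl }
... | _ | no ¬p | _ = no λ { refl → ¬p refl }
... | _ | _ | no ¬p = no λ { refl → ¬p refl }

-- The types of a disc are built from variables, so no decision procedure for equality of arbitrary
-- syntax is involved.
disc? : (Δ : Ctx m) → ∀ k → Dec ((m , Δ) ≡ (suc (k * 2) , D k))
disc? ∅ zero = no λ ()
disc? (∅ ▸ ⋆) zero = yes refl
disc? (∅ ▸ _ ─⟨ _ ⟩⟶ _) zero = no λ ()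
disc? (Δ ▸ _ ▸ _) zero = no λ ()
disc? ∅ (suc k) = no λ ()
disc? (∅ ▸ _) (suc k) = no λ ()
disc? (Δ ▸ A ▸ B) (suc k) with disc? Δ k
... | no ¬p = no λ eq → ¬p (cong (λ Γ → initCtx (initCtx Γ)) eq)
... | yes refl with varTy? A (VarTy-U k)
                  | varTy? B (⟶ᵛ {x = suc zero} {zero} (VarTy-wk {B = U k} (VarTy-U k)) (cong wkTy (lookup-D k)) refl)
...   | yes refl | yes refl = yes refl
...   | no ¬p | _ = no λ { refl → ¬p refl }
...   | _ | no ¬p = no λ { refl → ¬p refl }

CtxTy : Set
CtxTy = Σ[ m ∈ ℕ ] Ctx m × Ty m

ctxTy : CohData n → CtxTy
ctxTy (m , Δ , A , σ) = m , Δ , A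

identity-ctxTy : {Δ : Ctx m} {A : Ty m} {σ : Sub m n} → IsIdentity (Coh Δ A σ) →
                 ∃[ k ] (m , Δ , A) ≡ (suc (k * 2) , D k , idTy k)
identity-ctxTy (B , s , eq) = dim B , cong ctxTy (Coh-injective eq)

disc-identity? : {Δ : Ctx m} (A : Ty m) (σ : Sub m n) → ∀ k → _≡_ {A = AnyCtx} (m , Δ) (suc (k * 2) , D k) →
                 Dec (IsIdentity (Coh Δ A σ))
disc-identity? A σ k refl with varTy? A (VarTy-idTy k)
... | yes refl = yes (discCoh-identity k σ)
... | no ¬p    = no λ i → not i
  where
  not : ¬ IsIdentity (Coh (D k) A σ)
  not i with identity-ctxTy {σ = σ} i
  ... | l , eq with double-injective {k} {l} (cong (λ q → pred (proj₁ q)) eq)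
  not i | l , refl | refl = ¬p refl

identity? : (t : Tm n) → Dec (IsIdentity t)
identity? (var x) = no λ { (_ , _ , ()) }
-- The type `idTy k` has dimension `suc k`, so only the disc of dimension `pred (dim A)` has to be
-- tried.
identity? (Coh Δ A σ) with disc? Δ (pred (dim A))
... | yes p = disc-identity? A σ (pred (dim A)) p
... | no ¬p = no λ i → not i
  where
  not : ¬ IsIdentity (Coh Δ A σ)
  not i with identity-ctxTy {σ = σ} i
  ... | k , refl = ¬p (subst (λ l → _≡_ {A = AnyCtx} (suc (k * 2) , D k) (suc (l * 2) , D l)) (sym (dim-U k)) refl)

-- Redexes

U-not-endo : ∀ {k m} {Δ : Ctx m} {s : Tm m} {A : Ty m} →
             ¬ ((suc (k * 2) , D k , U k) ≡ (m , Δ , s ─⟨ A ⟩⟶ s))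
U-not-endo {k} eq = go k (subst EndsEqual (sym eq) refl)
  where
  EndsEqual : CtxTy → Set
  EndsEqual (_ , _ , ⋆)              = Data.Empty.⊥
  EndsEqual (_ , _ , s ─⟨ A ⟩⟶ t) = s ≡ t
  go : ∀ k → ¬ EndsEqual (suc (k * 2) , D k , U k)
  go zero    ()
  go (suc k) ()

-- Indexing the rules by the components of the redex turns overlaps into equations between contexts,
-- types and substitutions. The substitution of a `dr` redex is arbitrary here, by
-- `discSub-surjective`.
data RuleView (Γ : Ctx n) : (Δ : Ctx m) (A : Ty m) (σ : Sub m n) (t : Tm n) → Set where
  dr-view    : ∀ k σ → RuleView Γ (D k) (U k) σ (zero [ σ ]var)
  prune-view : (W : Dyck 0) (p : Peak W) (A : Ty (size W)) (σ : Sub (size W) n) →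
               IsIdentity (peakVar p [ σ ]var) → ¬ IsIdentity (Coh ⌊ W ⌋ A σ) →
               RuleView Γ ⌊ W ⌋ A σ (Coh ⌊ W // p ⌋ (A [ π p ]ty) (σ //ˢ p))
  ecr-view   : (Δ : Ctx m) (s : Tm m) (A : Ty m) (σ : Sub m n) →
               ¬ IsIdentity (Coh Δ (s ─⟨ A ⟩⟶ s) σ) →
               RuleView Γ Δ (s ─⟨ A ⟩⟶ s) σ (idTm (A [ σ ]ty) (s [ σ ]tm))

rule-view : {Γ : Ctx n} {Δ : Ctx m} {A : Ty m} {σ : Sub m n} {t : Tm n} →
            su′ Γ (Coh Δ A σ) t → RuleView Γ Δ A σ t
rule-view r = go r refl
  where
  go : ∀ {m n} {Γ : Ctx n} {Δ : Ctx m} {A : Ty m} {σ s t} → su′ Γ s t → s ≡ Coh Δ A σ →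
       RuleView Γ Δ A σ t
  go (inj₁ (disc A t)) refl = subst (RuleView _ _ _ _) (zero-[] A) (dr-view (dim A) ⦅ A , t ⦆)
  go (inj₂ (inj₁ (prune-peak W p A σ i , j))) refl = prune-view W p A σ i j
  go (inj₂ (inj₂ (endo Δ s A σ , j)))         refl = ecr-view Δ s A σ j

dr-⇝ : {Γ : Ctx n} → ∀ k (σ : Sub (suc (k * 2)) n) → Γ ⊢tm Coh (D k) (U k) σ ⇝ zero [ σ ]var
dr-⇝ {Γ = Γ} k σ with discSub-surjective k σ
... | A , t , refl = ⇝-rule (inj₁ (subst (dr Γ _) (sym (zero-[] A)) (disc A t)))

-- `dr` would require the two distinct ends of `U (suc k)` to coincide, the other two rules exclude
-- identities, and the annotating type is normal.
identity-⇝ : {Γ : Ctx n} {s t : Tm n} → IsIdentity s → Γ ⊢tm s ⇝ t →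
             ∃[ k ] ∃[ σ ] ∃[ τ ] s ≡ Coh (D k) (idTy k) σ × t ≡ Coh (D k) (idTy k) τ × (Γ ⊢sub σ ⇝ τ)
identity-⇝ {Γ = Γ} (A , s , refl) (⇝-rule r) with rule-view r
... | v = ⊥-elim (go v refl)
  where
  go : ∀ {m} {Δ : Ctx m} {B σ t} → RuleView Γ Δ B σ t → ¬ (idTm A s ≡ Coh Δ B σ)
  go (dr-view k σ) eq with Coh-injective eq
  ... | eq′ with double-injective {dim A} {k} (cong (λ q → pred (proj₁ q)) eq′)
  ...   | refl = U-not-endo {k = k} (sym (cong ctxTy eq′))
  go (prune-view W p B σ i j) eq = j (A , s , sym eq)
  go (ecr-view Δ u B σ j) eq = j (A , s , sym eq)
identity-⇝ (A , s , refl) (⇝-cohTy r)  = ⊥-elim (VarTy-normal (VarTy-idTy (dim A)) r)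
identity-⇝ (A , s , refl) (⇝-cohSub r) = dim A , _ , _ , refl , refl , r

identity-⇝* : {Γ : Ctx n} {s t : Tm n} → IsIdentity s → Γ ⊢tm s ⇝* t → IsIdentity t
identity-⇝* i done = i
identity-⇝* i (r ◅ rs) with identity-⇝ i r
... | k , _ , τ , _ , refl , _ = identity-⇝* (discCoh-identity k τ) rs

-- Peaks of discs

πD : ∀ k → Sub (suc (suc k * 2)) (suc (k * 2))
πD k = ⟨ ⟨ idSub , var zero ⟩ , idTm (U k) (var zero) ⟩

-- The one peak of a disc is its top cell, and pruning it leaves the disc one dimension lower.
-- Everything that depends on the word and the peak is an index, so a single match replaces all of
-- it.
data DiscPeak {n} : ∀ {m m′} → Ctx m → Ctx m′ → Sub m m′ → Fin m → Sub m n → Sub m′ n → Set where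
  discPeak : ∀ k (σ : Sub (suc (k * 2)) n) s t →
             DiscPeak (D (suc k)) (D k) (πD k) zero ⟨ ⟨ σ , s ⟩ , t ⟩ σ

lastDim-D : ∀ k → lastDim (D k) ≡ k
lastDim-D zero    = refl
lastDim-D (suc k) = cong suc (trans (dim-wkTy (U k)) (dim-U k))

-- A word of depth `k` with context `D k` has never descended: a `⇓` would leave the depth below the
-- dimension of the last entry.
⇑-no-peak : (W : Dyck k) → _≡_ {A = AnyCtx} (size W , ⌊ W ⌋) (suc (k * 2) , D k) → ¬ Peak W
⇑-no-peak {k} _ eq (here E) = <-irrefl
  (sym (trans (sym (lastDim-⇑ E)) (trans (cong (λ Γ → lastDim (proj₂ Γ)) eq) (lastDim-D k)))) (n<1+n k)
⇑-no-peak (W ⇑) eq (p ⇑ₚ) = ⇑-no-peak W (cong (λ Γ → initCtx (initCtx Γ)) eq) p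
⇑-no-peak {k} (W ⇓) eq (p ⇓ₚ) = <-irrefl refl (≤-trans (depth≤lastDim W)
  (≤-reflexive (trans (cong (λ Γ → lastDim (proj₂ Γ)) eq) (lastDim-D k))))

-- The context of an unknown word does not unify with a disc. The data that determine the last arrow
-- are projected out instead, and `disc-peak` transports along the resulting equation; `nothing`
-- covers contexts of another shape.
PsData : Set
PsData = Σ[ n ∈ ℕ ] Ctx n × Ty n × Maybe (Fin n)

psData : AnyCtx → PsData
psData (_ , Γ ▸ A ▸ var (suc x) ─⟨ _ ⟩⟶ _) = _ , Γ , A , just x
psData (_ , Γ ▸ A ▸ _)                      = _ , Γ , A , nothing
psData (_ , Γ)                              = _ , Γ , ⋆ , nothing

disc-peak : {W : Dyck d} (p : Peak W) → ∀ k → _≡_ {A = AnyCtx} (size W , ⌊ W ⌋) (suc (k * 2) , D k) →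
            (σ : Sub (size W) n) → DiscPeak ⌊ W ⌋ ⌊ W // p ⌋ (π p) (peakVar p) σ (σ //ˢ p)
disc-peak {n = n} (here E) (suc k) eq ⟨ ⟨ σ , s ⟩ , t ⟩ with ⌊ E ⌋tm | dyck-var E
... | _ | psVar {v} refl _ _ = subst Goal (sym (cong psData eq)) (λ σ s t → discPeak k σ s t) σ s t
  where
  Goal : PsData → Set
  Goal (m , Γ , A , nothing) = ⊤
  Goal (m , Γ , A , just x)  = (σ : Sub m n) (s t : Tm n) →
    DiscPeak (Γ ▸ A ▸ (var (suc x) ─⟨ wkTy A ⟩⟶ var zero)) Γ
             ⟨ ⟨ idSub , var x ⟩ , idTm A (var x) ⟩ zero ⟨ ⟨ σ , s ⟩ , t ⟩ σ
disc-peak (here E) zero eq σ with cong proj₁ eq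
... | ()
disc-peak {d = suc d} {W = W ⇑} (p ⇑ₚ) (suc k) eq σ with depth-eq
  where
  depth-eq : d ≡ k
  depth-eq = trans (sym (dim-⌊⌋ty W))
    (trans (cong (λ Γ → lastDim (proj₂ (initCtx Γ))) eq) (dim-U k))
... | refl = ⊥-elim (⇑-no-peak W (cong (λ Γ → initCtx (initCtx Γ)) eq) p)
disc-peak (p ⇑ₚ) zero eq σ with cong proj₁ eq
... | ()
disc-peak (p ⇓ₚ) k eq σ = disc-peak p k eq σ

-- Distinct peaks commute

-- Once its `⇓` has passed, a peak never becomes current again: `⇑` introduces a new cell and `⇓`
-- exposes a target, and a peak is never a target. The two statements need each other in the
-- induction.
tm-not-peak  : (W : Dyck d) (p : Peak W) → ¬ (⌊ W ⌋tm ≡ var (peakVar p))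
tgt-not-peak : (W : Dyck d) (p : Peak W) → ¬ IsTgt ⌊ W ⌋ty k (peakVar p)
tm-not-peak .(E ⇑ ⇓) (here E) ()
tm-not-peak (W ⇑) (p ⇑ₚ) ()
tm-not-peak (_⇓ {d} W) (p ⇓ₚ) eq = go ⌊ W ⌋ty (dim-⌊⌋ty W) eq (tgt-not-peak W p)
  where
  go : ∀ {x t} A → dim A ≡ suc d → tyTarget A t ≡ var x → ¬ (∀ {k} → ¬ IsTgt A k x)
  go (_ ─⟨ _ ⟩⟶ _) _ eq f = f (top eq refl)
tgt-not-peak .(E ⇑ ⇓) (here E) h with IsTgt-wk⁻ (wkTy ⌊ E ⌋ty) h
... | ()
tgt-not-peak (W ⇑) (p ⇑ₚ) h with IsTgt-wk⁻ (wkTm ⌊ W ⌋tm ─⟨ wkTy ⌊ W ⌋ty ⟩⟶ var zero) h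
... | wk (top () _)
... | wk (down h′) with IsTgt-wk⁻ ⌊ W ⌋ty h′
...   | wk h″ = tgt-not-peak W p h″
tgt-not-peak {k = k} (W ⇓) (p ⇓ₚ) h = go ⌊ W ⌋ty h (tgt-not-peak W p)
  where
  go : ∀ {x} A → IsTgt (tyBase A) k x → ¬ (∀ {k} → ¬ IsTgt A k x)
  go (_ ─⟨ _ ⟩⟶ _) h f = f (down h)

peakVar-π : {W : Dyck d} (p : Peak W) {x : Fin (size (W // p))} → ¬ (peakVar p [ π p ]var ≡ var x)
peakVar-π (here E) ()
peakVar-π (p ⇑ₚ) eq with wkTm-var (trans (sym (π-⇑-var p (peakVar p))) eq)
... | _ , eq′ , _ with wkTm-var eq′
...   | _ , eq″ , _ = peakVar-π p eq″
peakVar-π (p ⇓ₚ) eq = peakVar-π p eq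

Pruned : ℕ → ℕ → ℕ → Set
Pruned d m n = Σ[ W ∈ Dyck d ] Sub m (size W) × Sub (size W) n

-- `square` is one equation of triples because the types of the projection and of the substitution
-- depend on the pruned word. `lift-q` serves to show that two prunings are not both identities.
record Commuting {W : Dyck d} (p q : Peak W) : Set where
  field
    q/p    : Peak (W // p)
    p/q    : Peak (W // q)
    square : ∀ {n} (σ : Sub (size W) n) →
             _≡_ {A = Pruned d (size W) n}
               ((W // p) // q/p , π p ∙ π q/p , (σ //ˢ p) //ˢ q/p)
               ((W // q) // p/q , π q ∙ π p/q , (σ //ˢ q) //ˢ p/q)
    var-q  : ∀ {n} (σ : Sub (size W) n) → peakVar q/p [ σ //ˢ p ]var ≡ peakVar q [ σ ]var
    var-p  : ∀ {n} (σ : Sub (size W) n) → peakVar p/q [ σ //ˢ q ]var ≡ peakVar p [ σ ]var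
    lift-q : ∀ x → x [ π p ]var ≡ var (peakVar q/p) → x ≡ peakVar q

π-commute-here : {E : Dyck d} (q : Peak E) →
                 π (here E) ∙ π q ≡ π ((q ⇑ₚ) ⇓ₚ) ∙ π (here (E // q))
π-commute-here {E = E} q = cong₂ ⟨_,_⟩
  (cong₂ ⟨_,_⟩
    (trans (idSub-∙ (π q)) (sym (trans (wkSub-⟨,⟩ (wkSub (π q))) (trans (wkSub-⟨,⟩ (π q)) (∙-idSub (π q))))))
    (tm-π q))
  (trans (idTm-[] ⌊ E ⌋ty ⌊ E ⌋tm) (cong₂ idTm (ty-π q) (tm-π q)))

commute : {W : Dyck d} (p q : Peak W) → p ≡ q ⊎ Commuting p q
commute (here E) (here .E) = inj₁ refl
commute (here E) ((q ⇑ₚ) ⇓ₚ) = inj₂ record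
  { q/p    = q
  ; p/q    = here (E // q)
  ; square = λ { ⟨ ⟨ σ , s ⟩ , t ⟩ → cong (λ ρ → (E // q) , ρ , (σ //ˢ q)) (π-commute-here q) }
  ; var-q  = λ { ⟨ ⟨ σ , s ⟩ , t ⟩ → refl }
  ; var-p  = λ { ⟨ ⟨ σ , s ⟩ , t ⟩ → refl }
  ; lift-q = λ { zero () ; (suc zero) eq → ⊥-elim (tm-not-peak E q eq)
               ; (suc (suc x)) eq → cong (λ x → suc (suc x)) (var-injective (trans (sym (var-idSub x)) eq)) }
  }
commute ((p ⇑ₚ) ⇓ₚ) (here E) = inj₂ record
  { q/p    = here (E // p)
  ; p/q    = p
  ; square = λ { ⟨ ⟨ σ , s ⟩ , t ⟩ → cong (λ ρ → (E // p) , ρ , (σ //ˢ p)) (sym (π-commute-here p)) }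
  ; var-q  = λ { ⟨ ⟨ σ , s ⟩ , t ⟩ → refl }
  ; var-p  = λ { ⟨ ⟨ σ , s ⟩ , t ⟩ → refl }
  ; lift-q = λ { zero eq → refl ; (suc zero) () ; (suc (suc x)) eq → ⊥-elim (not-zero x eq) }
  }
  where
  not-zero : ∀ x → ¬ (x [ wkSub (wkSub (π p)) ]var ≡ var zero)
  not-zero x eq with wkTm-var (trans (sym (var-wkSub x)) eq)
  ... | _ , _ , ()
commute {W = W ⇑} (p ⇑ₚ) (q ⇑ₚ) with commute p q
... | inj₁ refl = inj₁ refl
... | inj₂ c = inj₂ record
  { q/p    = q/p ⇑ₚ
  ; p/q    = p/q ⇑ₚ
  ; square = λ { ⟨ ⟨ σ , s ⟩ , t ⟩ → trans (up p q/p σ) (trans (cong (extend s t) (square σ)) (sym (up q p/q σ))) }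
  ; var-q  = λ { ⟨ ⟨ σ , s ⟩ , t ⟩ → var-q σ }
  ; var-p  = λ { ⟨ ⟨ σ , s ⟩ , t ⟩ → var-p σ }
  ; lift-q = λ { zero () ; (suc zero) () ; (suc (suc x)) eq → cong (λ x → suc (suc x)) (lift-q x (down² x eq)) }
  }
  where
  open Commuting c
  extend : ∀ {n} → Tm n → Tm n → Pruned _ (size W) n → Pruned _ (suc (suc (size W))) n
  extend s t (V , ρ , σ) = V ⇑ , ⟨ ⟨ wkSub (wkSub ρ) , var (suc zero) ⟩ , var zero ⟩ , ⟨ ⟨ σ , s ⟩ , t ⟩
  up : ∀ {n} (p : Peak W) (q : Peak (W // p)) (σ : Sub (size W) n) {s t} →
       (((W // p) // q) ⇑ , π (p ⇑ₚ) ∙ π (q ⇑ₚ) , ⟨ ⟨ (σ //ˢ p) //ˢ q , s ⟩ , t ⟩) ≡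
       extend s t ((W // p) // q , π p ∙ π q , (σ //ˢ p) //ˢ q)
  up p q σ {s} {t} = cong (λ ρ → ((W // p) // q) ⇑ , ρ , ⟨ ⟨ (σ //ˢ p) //ˢ q , s ⟩ , t ⟩) (trans (π-⇑-∙ p (wkSub (wkSub (π q))))
    (cong (λ ρ → ⟨ ⟨ ρ , var (suc zero) ⟩ , var zero ⟩) (trans (∙-wkSub (π p)) (cong wkSub (∙-wkSub (π p))))))
  down² : ∀ x → x [ wkSub (wkSub (π p)) ]var ≡ var (suc (suc (peakVar q/p))) → x [ π p ]var ≡ var (peakVar q/p)
  down² x eq with wkTm-var (trans (sym (π-⇑-var p x)) eq)
  ... | _ , eq′ , refl with wkTm-var eq′
  ...   | _ , eq″ , refl = eq″
commute {W = W ⇓} (p ⇓ₚ) (q ⇓ₚ) with commute p q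
... | inj₁ refl = inj₁ refl
... | inj₂ c = inj₂ record
  { q/p    = q/p ⇓ₚ
  ; p/q    = p/q ⇓ₚ
  ; square = λ σ → cong (λ { (V , ρ , σ) → V ⇓ , ρ , σ }) (square σ)
  ; var-q  = var-q
  ; var-p  = var-p
  ; lift-q = lift-q
  }
  where open Commuting c

-- Joinability, confluence and termination in bounded dimension

Joinable : Ctx n → Tm n → Tm n → Set
Joinable Γ s t = ∃[ u ] (Γ ⊢tm s ⇝* u) × (Γ ⊢tm t ⇝* u)

TyJoinable : Ctx n → Ty n → Ty n → Set
TyJoinable Γ A B = ∃[ C ] (Γ ⊢ty A ⇝* C) × (Γ ⊢ty B ⇝* C)

SubJoinable : Ctx n → Sub m n → Sub m n → Set
SubJoinable Γ σ τ = ∃[ ρ ] (Γ ⊢sub σ ⇝* ρ) × (Γ ⊢sub τ ⇝* ρ)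

join-sym : {Γ : Ctx n} {s t : Tm n} → Joinable Γ s t → Joinable Γ t s
join-sym (u , p , q) = u , q , p

join-⇝* : {Γ : Ctx n} {s s′ t t′ : Tm n} → Γ ⊢tm s ⇝* s′ → Γ ⊢tm t ⇝* t′ →
          Joinable Γ s′ t′ → Joinable Γ s t
join-⇝* p q (u , r , r′) = u , p ◅◅ r , q ◅◅ r′

ConfluentAt : Ctx n → Tm n → Set
ConfluentAt Γ s = ∀ {t u} → Γ ⊢tm s ⇝* t → Γ ⊢tm s ⇝* u → Joinable Γ t u

ConfluentBelow : ℕ → Set
ConfluentBelow N = ∀ {n} {Γ : Ctx n} {s : Tm n} {A : Ty n} → Γ ⊢tm s ∶ A → dim A < N → ConfluentAt Γ s

TerminatingTm : (Γ : Ctx n) → Tm n → Set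
TerminatingTm Γ = Acc (λ t s → Γ ⊢tm s ⇝ t)

TerminatingTy : (Γ : Ctx n) → Ty n → Set
TerminatingTy Γ = Acc (λ B A → Γ ⊢ty A ⇝ B)

TerminatingSub : (Γ : Ctx n) → Sub m n → Set
TerminatingSub Γ = Acc (λ τ σ → Γ ⊢sub σ ⇝ τ)

TerminatingBelow : ℕ → Set
TerminatingBelow N = ∀ {n} {Γ : Ctx n} (s : Tm n) {A : Ty n} → Γ ⊢tm s ∶ A → dim A < N → TerminatingTm Γ s

-- Termination

⟶-terminating : {Γ : Ctx n} {s t : Tm n} {A : Ty n} → TerminatingTm Γ s → TerminatingTy Γ A →
                TerminatingTm Γ t → TerminatingTy Γ (s ─⟨ A ⟩⟶ t)
⟶-terminating (acc f) (acc g) (acc h) = acc λ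
  { (⇝-src r) → ⟶-terminating (f r) (acc g) (acc h)
  ; (⇝-ty r)  → ⟶-terminating (acc f) (g r) (acc h)
  ; (⇝-tgt r) → ⟶-terminating (acc f) (acc g) (h r) }

⟨,⟩-terminating : {Γ : Ctx n} {σ : Sub m n} {t : Tm n} → TerminatingSub Γ σ → TerminatingTm Γ t →
                  TerminatingSub Γ ⟨ σ , t ⟩
⟨,⟩-terminating (acc f) (acc g) = acc λ
  { (⇝-init r) → ⟨,⟩-terminating (f r) (acc g)
  ; (⇝-last r) → ⟨,⟩-terminating (acc f) (g r) }

last-terminating : {Γ : Ctx n} {σ : Sub (suc m) n} → TerminatingSub Γ σ → TerminatingTm Γ (zero [ σ ]var)
last-terminating {σ = ⟨ σ , t ⟩} (acc f) = acc λ r → last-terminating (f (⇝-last r))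

-- Deleting entries creates no new reductions, so `σ //ˢ p` inherits termination from `σ`.
//ˢ-lift : {Γ : Ctx n} {W : Dyck d} (p : Peak W) (σ : Sub (size W) n) {τ : Sub (size (W // p)) n} →
           Γ ⊢sub σ //ˢ p ⇝ τ → ∃[ σ′ ] (Γ ⊢sub σ ⇝ σ′) × τ ≡ σ′ //ˢ p
//ˢ-lift (here E) ⟨ ⟨ σ , s ⟩ , t ⟩ r = ⟨ ⟨ _ , s ⟩ , t ⟩ , ⇝-init (⇝-init r) , refl
//ˢ-lift (p ⇑ₚ) ⟨ ⟨ σ , s ⟩ , t ⟩ (⇝-init (⇝-init r)) with //ˢ-lift p σ r
... | σ′ , r′ , refl = ⟨ ⟨ σ′ , s ⟩ , t ⟩ , ⇝-init (⇝-init r′) , refl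
//ˢ-lift (p ⇑ₚ) ⟨ ⟨ σ , s ⟩ , t ⟩ (⇝-init (⇝-last r)) = ⟨ ⟨ σ , _ ⟩ , t ⟩ , ⇝-init (⇝-last r) , refl
//ˢ-lift (p ⇑ₚ) ⟨ ⟨ σ , s ⟩ , t ⟩ (⇝-last r) = ⟨ ⟨ σ , s ⟩ , _ ⟩ , ⇝-last r , refl
//ˢ-lift (p ⇓ₚ) σ r = //ˢ-lift p σ r

//ˢ-terminating : {Γ : Ctx n} {W : Dyck d} (p : Peak W) {σ : Sub (size W) n} →
                  TerminatingSub Γ σ → TerminatingSub Γ (σ //ˢ p)
//ˢ-terminating {Γ = Γ} p {σ} (acc f) = acc go
  where
  go : ∀ {τ} → Γ ⊢sub σ //ˢ p ⇝ τ → TerminatingSub Γ τ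
  go r with //ˢ-lift p σ r
  ... | σ′ , r′ , refl = //ˢ-terminating p (f r′)

identity-terminating : {Γ : Ctx n} → ∀ k {σ : Sub (suc (k * 2)) n} → TerminatingSub Γ σ →
                       TerminatingTm Γ (Coh (D k) (idTy k) σ)
identity-terminating {Γ = Γ} k {σ} (acc f) = acc go
  where
  go : ∀ {t} → Γ ⊢tm Coh (D k) (idTy k) σ ⇝ t → TerminatingTm Γ t
  go (⇝-cohSub r) = identity-terminating k (f r)
  go (⇝-cohTy r)  = ⊥-elim (VarTy-normal (VarTy-idTy k) r)
  go r@(⇝-rule _) with identity-⇝ (discCoh-identity k σ) r
  ... | l , _ , _ , eq , refl , r′ with Coh-injective eq
  ...   | eq′ with double-injective {k} {l} (cong (λ q → pred (proj₁ q)) eq′)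
  go (⇝-rule _) | l , _ , _ , eq , refl , r′ | refl | refl = identity-terminating k (f r′)

size-// : {W : Dyck d} (p : Peak W) → size (W // p) < size W
size-// (here E) = n≤1+n _
size-// (p ⇑ₚ)   = s≤s (s≤s (size-// p))
size-// (p ⇓ₚ)   = size-// p

module Termination {N : ℕ} (lower : TerminatingBelow N) where

  ty-terminating : {Γ : Ctx n} {A : Ty n} → Γ ⊢ty A → dim A ≤ N → TerminatingTy Γ A
  ty-terminating ty-⋆ le = acc λ ()
  ty-terminating (ty-⟶ {s = s} {t} a b c) le =
    ⟶-terminating (lower s b le) (ty-terminating a (≤-trans (n≤1+n _) le)) (lower t c le)

  ⦅⦆-terminating : {Γ : Ctx n} (A : Ty n) {t : Tm n} → Γ ⊢ty A → dim A ≤ N → TerminatingTm Γ t →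
                  TerminatingSub Γ ⦅ A , t ⦆
  ⦅⦆-terminating ⋆ p le q = ⟨,⟩-terminating (acc λ ()) q
  ⦅⦆-terminating (s ─⟨ A ⟩⟶ u) (ty-⟶ a b c) le q =
    ⟨,⟩-terminating (⟨,⟩-terminating (⦅⦆-terminating A a (≤-trans (n≤1+n _) le) (lower s b le)) (lower u c le)) q

  CohTerminating : ℕ → Set
  CohTerminating m = ∀ {n} {Γ : Ctx n} {Δ : Ctx m} {A : Ty m} {σ : Sub m n} {B : Ty n} →
    Γ ⊢tm Coh Δ A σ ∶ B → dim B ≤ N → TerminatingTy Δ A → TerminatingSub Γ σ → TerminatingTm Γ (Coh Δ A σ)

  rule-terminating : {Γ : Ctx n} {Δ : Ctx m} {A : Ty m} {σ : Sub m n} {B : Ty n} {t : Tm n} →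
    (∀ {l} → l < m → CohTerminating l) → Γ ⊢tm t ∶ B → dim B ≤ N → TerminatingSub Γ σ →
    RuleView Γ Δ A σ t → TerminatingTm Γ t
  rule-terminating IH typed le g (dr-view k _) = last-terminating g
  rule-terminating IH typed le g (prune-view W p A σ i j) with coh-inv typed
  -- `A [ π p ]ty` is no reduct of `A`; it terminates because its components have dimension below
  -- `N`.
  ... | cohInv _ _ a _ _ e = IH (size-// p) typed le
    (ty-terminating a (≤-trans (≤-reflexive (trans (sym (dim-[] (A [ π p ]ty))) (dim-≈ e))) le))
    (//ˢ-terminating p g)
  rule-terminating IH typed le g (ecr-view Δ s A σ j) with id-inv (A [ σ ]ty) typed
  ... | a , b , e = identity-terminating _ (⦅⦆-terminating (A [ σ ]ty) a (≤-trans (n≤1+n _) le′)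
    (lower (s [ σ ]tm) b le′))
    where
    le′ : dim (A [ σ ]ty) < N
    le′ = ≤-trans (≤-reflexive (dim-≈ e)) le

  Coh-step : (∀ {l} → l < m → CohTerminating l) → CohTerminating m
  Coh-step IH typed le (acc f) (acc g) = acc λ
    { (⇝-rule r)       → rule-terminating IH (rule-typed r typed) le (acc g) (rule-view r)
    ; r@(⇝-cohTy r′)  → Coh-step IH (tm-⇝-typed typed r) le (f r′) (acc g)
    ; r@(⇝-cohSub r′) → Coh-step IH (tm-⇝-typed typed r) le (acc f) (g r′) }

  Coh-terminating : Acc _<_ m → CohTerminating m
  Coh-terminating (acc f) = Coh-step λ lt → Coh-terminating (f lt)

  tm-terminating  : {Γ : Ctx n} (s : Tm n) {A : Ty n} → Γ ⊢tm s ∶ A → dim A ≤ N → TerminatingTm Γ s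
  sub-terminating : {Γ : Ctx n} {Δ : Ctx m} (σ : Sub m n) → Γ ⊢sub σ ∶ Δ → dimCtx Δ ≤ N → TerminatingSub Γ σ
  tm-terminating (var x) p le = acc λ
    { (⇝-rule (inj₁ ())) ; (⇝-rule (inj₂ (inj₁ (() , _)))) ; (⇝-rule (inj₂ (inj₂ (() , _)))) }
  tm-terminating (Coh Δ A σ) p le with coh-inv p
  ... | cohInv refl _ a b o e = Coh-terminating (<-wellFounded _) p le
    (ty-terminating a le′) (sub-terminating σ b (≤-trans (coh-dim a o) le′))
    where
    le′ : dim A ≤ N
    le′ = ≤-trans (≤-reflexive (trans (sym (dim-[] A)) (dim-≈ e))) le
  sub-terminating ⟨⟩ p le = acc λ ()
  sub-terminating {Δ = Δ ▸ A} ⟨ σ , t ⟩ (sub-, p q) le =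
    ⟨,⟩-terminating (sub-terminating σ p (≤-trans (m≤m⊔n _ _) le))
      (tm-terminating t q (≤-trans (≤-reflexive (dim-[] A)) (≤-trans (m≤n⊔m (dimCtx Δ) _) le)))

terminating : ∀ N → TerminatingBelow N
terminating zero    s p ()
terminating (suc N) s p (s≤s le) = Termination.tm-terminating (terminating N) s p le

-- Joinability of equal terms

module ChurchRosser {N : ℕ} (confluent : ConfluentBelow N) where

  coh-dim-≡ : {Γ : Ctx n} (A : Ty m) {σ : Sub m n} {B : Ty n} → Γ ⊢ty A [ σ ]ty ≈ B → dim A ≡ dim B
  coh-dim-≡ A e = trans (sym (dim-[] A)) (dim-≈ e)

  -- Confluence serves transitivity. Types may have dimension `N` where terms must stay below it,
  -- since the components of an arrow lie one dimension lower. In coherences, `coh-dim` keeps the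
  -- entries of the substitution below `N`.
  ≈⇒ty-joinable  : {Γ : Ctx n} {A B : Ty n} → Γ ⊢ty A ≈ B → Γ ⊢ty A → dim A ≤ N → TyJoinable Γ A B
  ≈⇒joinable     : {Γ : Ctx n} {s t : Tm n} {A : Ty n} → Γ ⊢tm s ≈ t → Γ ⊢tm s ∶ A → dim A < N → Joinable Γ s t
  ≈⇒sub-joinable : {Γ : Ctx n} {Δ : Ctx m} {σ τ : Sub m n} → Γ ⊢sub σ ≈ τ → Γ ⊢sub σ ∶ Δ → dimCtx Δ < N →
                   SubJoinable Γ σ τ
  ≈⇒ty-joinable ≈-⋆ _ le = ⋆ , done , done
  ≈⇒ty-joinable (≈-⟶ p q r) (ty-⟶ a b c) le
    with ≈⇒joinable p b le | ≈⇒ty-joinable q a (≤-trans (n≤1+n _) le) | ≈⇒joinable r c le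
  ... | _ , p₁ , p₂ | _ , q₁ , q₂ | _ , r₁ , r₂ = _ , ⟶-⇝* p₁ q₁ r₁ , ⟶-⇝* p₂ q₂ r₂
  ≈⇒joinable (≈-var x) _ le = var x , done , done
  ≈⇒joinable (≈-sym p) a le = join-sym (≈⇒joinable p (proj₂ (tm-≈-typed p) a) le)
  ≈⇒joinable (≈-trans p q) a le
    with ≈⇒joinable p a le | ≈⇒joinable q (proj₁ (tm-≈-typed p) a) le
  ... | _ , p₁ , p₂ | _ , q₁ , q₂ with confluent (proj₁ (tm-≈-typed p) a) le p₂ q₁
  ...   | _ , r₁ , r₂ = _ , p₁ ◅◅ r₁ , q₂ ◅◅ r₂
  ≈⇒joinable {A = B} (≈-coh {A = A} p q) a le with coh-inv a
  ... | cohInv refl _ b c o e with subst (_< N) (sym (coh-dim-≡ A e)) le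
  ...   | le′ with ≈⇒ty-joinable p b (<⇒≤ le′) | ≈⇒sub-joinable q c (≤-<-trans (coh-dim b o) le′)
  ... | _ , p₁ , p₂ | _ , q₁ , q₂ = _ , Coh-⇝* p₁ q₁ , Coh-⇝* p₂ q₂
  ≈⇒joinable (≈-rule r p) _ le = _ , ⇝-rule r ◅ done , done
  ≈⇒sub-joinable ≈-⟨⟩ _ le = ⟨⟩ , done , done
  ≈⇒sub-joinable (≈-, p q) (sub-, {Δ = Δ} {A = A} a b) le
    with ≈⇒sub-joinable p a (≤-<-trans (m≤m⊔n _ _) le)
       | ≈⇒joinable q b (≤-<-trans (≤-trans (≤-reflexive (dim-[] A)) (m≤n⊔m (dimCtx Δ) _)) le)
  ... | _ , p₁ , p₂ | _ , q₁ , q₂ = _ , ⟨,⟩-⇝* p₁ q₁ , ⟨,⟩-⇝* p₂ q₂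

-- Critical pairs and local confluence

//ˢ-⇝ : {Γ : Ctx n} {W : Dyck d} (p : Peak W) {σ τ : Sub (size W) n} →
        Γ ⊢sub σ ⇝ τ → Γ ⊢sub σ //ˢ p ⇝* τ //ˢ p
//ˢ-⇝ (here E) (⇝-init (⇝-init r)) = r ◅ done
//ˢ-⇝ (here E) (⇝-init (⇝-last r)) = done
//ˢ-⇝ (here E) {⟨ ⟨ σ , s ⟩ , t ⟩} (⇝-last r) = done
//ˢ-⇝ (p ⇑ₚ) (⇝-init (⇝-init r)) = ⟨,⟩-⇝* (⟨,⟩-⇝* (//ˢ-⇝ p r) done) done
//ˢ-⇝ (p ⇑ₚ) (⇝-init (⇝-last r)) = ⇝-init (⇝-last r) ◅ done
//ˢ-⇝ (p ⇑ₚ) {⟨ ⟨ σ , s ⟩ , t ⟩} (⇝-last r) = ⇝-last r ◅ done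
//ˢ-⇝ (p ⇓ₚ) r = //ˢ-⇝ p r

-- Unrestricted `ecr` is available in at most one step, since on an identity it returns that same
-- identity.
ecr-⇝* : {Γ : Ctx n} (Δ : Ctx m) (s : Tm m) (A : Ty m) (σ : Sub m n) →
         Γ ⊢tm Coh Δ (s ─⟨ A ⟩⟶ s) σ ⇝* idTm (A [ σ ]ty) (s [ σ ]tm)
ecr-⇝* {Γ = Γ} Δ s A σ with identity? (Coh Δ (s ─⟨ A ⟩⟶ s) σ)
... | no ¬i = ⇝-rule (inj₂ (inj₂ (endo Δ s A σ , ¬i))) ◅ done
... | yes (B , u , eq) with Coh-injective eq
...   | refl = subst (λ t → Γ ⊢tm idTm B u ⇝* t) (cong₂ idTm (sym (U-[] B)) (sym (zero-[] B))) done

-- Pruning the top cell of a disc turns the type of a `dr` redex into that of an identity.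
U-πD : ∀ k → U (suc k) [ πD k ]ty ≡ idTy k
U-πD k = cong-⟶ refl (trans (wkTy-⟨,⟩ (wkTy (U k))) (trans (wkTy-⟨,⟩ (U k)) (ty-idSub (U k)))) refl

module LocalConfluence {N : ℕ} (confluent : ConfluentBelow N) where

  open ChurchRosser confluent

  idTm-joinable : {Γ : Ctx n} {A B : Ty n} {s t : Tm n} → Γ ⊢ty A ≈ B → Γ ⊢tm s ≈ t →
                  Γ ⊢ty A → Γ ⊢tm s ∶ A → dim A < N → Joinable Γ (idTm A s) (idTm B t)
  idTm-joinable p q a b le with ≈⇒ty-joinable p a (<⇒≤ le) | ≈⇒joinable q b le
  ... | _ , p₁ , p₂ | _ , q₁ , q₂ = _ , idTm-⇝* p₁ q₁ , idTm-⇝* p₂ q₂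

  record DiscArg (Γ : Ctx n) (σ : Sub (suc (k * 2)) n) (s t : Tm n) : Set where
    constructor discArg
    field
      {C C′}  : Ty n
      {u u′}  : Tm n
      disc-≡  : (k , σ) ≡ discSub C u
      id-≡    : t ≡ idTm C′ u′
      C-typed : Γ ⊢ty C
      u-typed : Γ ⊢tm u ∶ C
      C′-typed : Γ ⊢ty C′
      u′-typed : Γ ⊢tm u′ ∶ C′
      s-typed : Γ ⊢tm s ∶ C
      u′≈u    : Γ ⊢tm u′ ≈ u
      C′≈C    : Γ ⊢ty C′ ≈ C
      u′≈s    : Γ ⊢tm u′ ≈ s

  disc-arg : {Γ : Ctx n} (σ : Sub (suc (k * 2)) n) {s t : Tm n} → Γ ⊢sub ⟨ ⟨ σ , s ⟩ , t ⟩ ∶ D (suc k) →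
             IsIdentity t → DiscArg {k = k} Γ σ s t
  disc-arg {k = k} σ {s} {t} p (C′ , u′ , refl) with discSub-surjective k σ
  ... | C , u , refl with disc-inv (u ─⟨ C ⟩⟶ s) p
  ...   | ty-⟶ a b c , e with id-inv C′ e
  ...     | a′ , b′ , ≈-⟶ x y z = discArg refl refl a b a′ b′ c x y z

  -- `dr` leaves `t`, an identity on some `u′`; pruning leaves the identity on the last entry `u` of
  -- `σ`. Typing of the peak makes `u′` and `u` equal, in dimension below `N`.
  disc-prune-dr : {Γ : Ctx n} {B : Ty n} (σ : Sub (suc (k * 2)) n) {s t : Tm n} →
                  Γ ⊢tm Coh (D (suc k)) (U (suc k)) ⟨ ⟨ σ , s ⟩ , t ⟩ ∶ B → dim B ≤ N → IsIdentity t →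
                  Joinable Γ t (Coh (D k) (U (suc k) [ πD k ]ty) σ)
  disc-prune-dr {k = k} σ p le i with coh-inv p
  ... | cohInv _ _ _ b _ e with disc-arg {k = k} σ b i
  ...   | discArg {C} {C′} {u} {u′} refl refl _ _ a′ b′ _ x y _ =
    subst (Joinable _ (idTm C′ u′)) (cong (λ A → Coh (D (dim C)) A ⦅ C , u ⦆) (sym (U-πD (dim C)))) (idTm-joinable y x a′ b′ lt)
    where
    lt : dim C′ < N
    lt = ≤-trans (≤-reflexive (trans (cong suc (dim-≈ y))
      (trans (sym (dim-U (suc (dim C)))) (coh-dim-≡ (U (suc (dim C))) e)))) le

  -- The pruned coherence runs from an identity to itself, so `ecr-⇝*` takes it to an identity on an
  -- identity. The argument of the latter is equal to `t` and has dimension below `N`.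
  disc-prune-identity : {Γ : Ctx n} {B : Ty n} (σ : Sub (suc (k * 2)) n) {s t : Tm n} →
                        Γ ⊢tm Coh (D (suc k)) (idTy (suc k)) ⟨ ⟨ σ , s ⟩ , t ⟩ ∶ B → dim B ≤ N → IsIdentity t →
                        Joinable Γ (Coh (D (suc k)) (idTy (suc k)) ⟨ ⟨ σ , s ⟩ , t ⟩)
                                   (Coh (D k) (idTy (suc k) [ πD k ]ty) σ)
  disc-prune-identity {k = k} {Γ = Γ} σ {s} p le i with coh-inv p
  ... | cohInv _ _ _ b _ e with disc-arg {k = k} σ b i
  ...   | discArg {C} {C′} {u} {u′} refl refl a c a′ b′ c′ x y z =
    join-⇝* done (ecr-⇝* (D (dim C)) _ _ ⦅ C , u ⦆)
      (subst (Joinable Γ _) (cong₂ idTm (sym ty-eq) (sym id-eq))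
        (idTm-joinable (≈-⟶ (tm-refl u) (ty-refl C) (≈-trans (≈-sym z) x)) (idTm-≈ y x)
          (ty-⟶ a c c′)
          (tm-conv (idTm-typed C′ a′ b′) (≈-⟶ x y z)) lt))
    where
    id-eq : idTm (U (dim C)) (var zero) [ ⦅ C , u ⦆ ]tm ≡ idTm C u
    id-eq = trans (idTm-[] (U (dim C)) (var zero)) (cong₂ idTm (U-[] C) (zero-[] C))
    ty-eq : U (suc (dim C)) [ πD (dim C) ]ty [ ⦅ C , u ⦆ ]ty ≡ u ─⟨ C ⟩⟶ u
    ty-eq = trans (cong (_[ ⦅ C , u ⦆ ]ty) (U-πD (dim C))) (idTy-[] C)
    lt : suc (dim C) < N
    lt = ≤-trans (≤-reflexive (trans (cong suc (sym (dim-U (suc (dim C)))))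
      (coh-dim-≡ (idTy (suc (dim C))) e))) le

  -- On an identity prune′ does not apply, and the two sides are joined through
  -- ecr′ instead.
  prune-joinable : {Γ : Ctx n} {B : Ty n} (W : Dyck 0) (p : Peak W) (A : Ty (size W)) (σ : Sub (size W) n) →
                   Γ ⊢tm Coh ⌊ W ⌋ A σ ∶ B → dim B ≤ N → IsIdentity (peakVar p [ σ ]var) →
                   Joinable Γ (Coh ⌊ W ⌋ A σ) (Coh ⌊ W // p ⌋ (A [ π p ]ty) (σ //ˢ p))
  prune-joinable {Γ = Γ} W p A σ typed le i with identity? (Coh ⌊ W ⌋ A σ)
  ... | no ¬id = _ , ⇝-rule (inj₂ (inj₁ (prune-peak W p A σ i , ¬id))) ◅ done , done
  ... | yes id with identity-ctxTy {σ = σ} id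
  ...   | k , eq = go k eq (disc-peak p k (cong (λ { (m , Δ , A) → m , Δ }) eq) σ) typed i
    where
    go : ∀ {m m′} {Δ : Ctx m} {Δ′ : Ctx m′} {ρ : Sub m m′} {x : Fin m} {A} {σ : Sub m _} {σ′ : Sub m′ _} →
         ∀ k → _≡_ {A = CtxTy} (m , Δ , A) (suc (k * 2) , D k , idTy k) → DiscPeak Δ Δ′ ρ x σ σ′ →
         Γ ⊢tm Coh Δ A σ ∶ _ → IsIdentity (x [ σ ]var) →
         Joinable Γ (Coh Δ A σ) (Coh Δ′ (A [ ρ ]ty) σ′)
    go k eq (discPeak j σ s t) typed i with double-injective {suc j} {k} (cong (λ q → pred (proj₁ q)) eq)
    go k refl (discPeak j σ s t) typed i | refl = disc-prune-identity {k = j} σ typed le i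

  prune-dr-joinable : {Γ : Ctx n} {B : Ty n} (W : Dyck 0) (p : Peak W) (A : Ty (size W)) (σ : Sub (size W) n) →
                      ∀ k τ → _≡_ {A = CohData n} (size W , ⌊ W ⌋ , A , σ) (suc (k * 2) , D k , U k , τ) →
                      Γ ⊢tm Coh ⌊ W ⌋ A σ ∶ B → dim B ≤ N → IsIdentity (peakVar p [ σ ]var) →
                      Joinable Γ (zero [ τ ]var) (Coh ⌊ W // p ⌋ (A [ π p ]ty) (σ //ˢ p))
  prune-dr-joinable {Γ = Γ} W p A σ k τ eq typed le i =
    go k τ eq (disc-peak p k (cong (λ { (m , Δ , _) → m , Δ }) eq) σ) typed i
    where
    go : ∀ {m m′} {Δ : Ctx m} {Δ′ : Ctx m′} {ρ : Sub m m′} {x : Fin m} {A} {σ : Sub m _} {σ′ : Sub m′ _} →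
         ∀ k τ → _≡_ {A = CohData _} (m , Δ , A , σ) (suc (k * 2) , D k , U k , τ) → DiscPeak Δ Δ′ ρ x σ σ′ →
         Γ ⊢tm Coh Δ A σ ∶ _ → IsIdentity (x [ σ ]var) →
         Joinable Γ (zero [ τ ]var) (Coh Δ′ (A [ ρ ]ty) σ′)
    go k τ eq (discPeak j σ s t) typed i with double-injective {suc j} {k} (cong (λ q → pred (proj₁ q)) eq)
    go k _ refl (discPeak j σ s t) typed i | refl = disc-prune-dr {k = j} σ typed le i

  typed-prune : {Γ : Ctx n} {B : Ty n} (W : Dyck 0) (p : Peak W) (A : Ty (size W)) (σ : Sub (size W) n) →
                Γ ⊢tm Coh ⌊ W ⌋ A σ ∶ B → IsIdentity (peakVar p [ σ ]var) → ¬ IsIdentity (Coh ⌊ W ⌋ A σ) →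
                Γ ⊢tm Coh ⌊ W // p ⌋ (A [ π p ]ty) (σ //ˢ p) ∶ B
  typed-prune W p A σ typed i ¬id = rule-typed (inj₂ (inj₁ (prune-peak W p A σ i , ¬id))) typed

  -- If both prunings are identities, then the source of A is sent by π p to
  -- the peak of W // p and by π q to the peak of W // q.  The former makes it
  -- the peak q, which π q does not send to a variable.
  one-not-identity : {W : Dyck 0} {p q : Peak W} → Commuting p q → (A : Ty (size W)) (σ : Sub (size W) n) →
                     IsIdentity (Coh ⌊ W // p ⌋ (A [ π p ]ty) (σ //ˢ p)) →
                     ¬ IsIdentity (Coh ⌊ W // q ⌋ (A [ π q ]ty) (σ //ˢ q))
  one-not-identity {W = W} {p} {q} c A σ i j with identity-ctxTy {σ = σ //ˢ p} i | identity-ctxTy {σ = σ //ˢ q} j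
  ... | k , eq | l , eq′ =
    contradiction-at A (src-peak k (A [ π p ]ty) (q/p) eq σ//p) (src-zero l (A [ π q ]ty) eq′)
    where
    open Commuting c
    σ//p = σ //ˢ p
    SrcVar : ∀ {m} → Ty m → Set
    SrcVar ⋆              = Data.Empty.⊥
    SrcVar (s ─⟨ A ⟩⟶ t) = ∃[ x ] s ≡ var x
    SrcIs : ∀ {m} → Fin m → Ty m → Set
    SrcIs x ⋆              = Data.Empty.⊥
    SrcIs x (s ─⟨ A ⟩⟶ t) = s ≡ var x
    src-zero : ∀ {m} {Δ : Ctx m} k A → _≡_ {A = CtxTy} (m , Δ , A) (suc (k * 2) , D k , idTy k) → SrcVar A
    src-zero k _ refl = zero , refl
    peak-zero : ∀ {m m′ n} {Δ : Ctx m} {Δ′ : Ctx m′} {ρ x} {σ : Sub m n} {σ′ A} k →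
                _≡_ {A = CtxTy} (m , Δ , A) (suc (k * 2) , D k , idTy k) → DiscPeak Δ Δ′ ρ x σ σ′ → SrcIs x A
    peak-zero k eq (discPeak j σ s t) with double-injective {suc j} {k} (cong (λ q → pred (proj₁ q)) eq)
    peak-zero k refl (discPeak j σ s t) | refl = refl
    src-peak : ∀ {d n} {W : Dyck d} k A (p : Peak W) →
               _≡_ {A = CtxTy} (size W , ⌊ W ⌋ , A) (suc (k * 2) , D k , idTy k) → Sub (size W) n → SrcIs (peakVar p) A
    src-peak k A p eq σ = peak-zero k eq (disc-peak p k (cong (λ { (m , Δ , A) → m , Δ }) eq) σ)
    contradiction-at : ∀ A → SrcIs (peakVar q/p) (A [ π p ]ty) → ¬ SrcVar (A [ π q ]ty)
    contradiction-at (var x ─⟨ A ⟩⟶ t) e (y , e′) with lift-q x e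
    ... | refl = peakVar-π q e′

  -- Each result is joinable with the common pruning `u`, but joinability does not compose. One of
  -- the results must actually reduce to `u`, and `one-not-identity` ensures that `prune′` applies
  -- to one of them.
  prune-prune : {Γ : Ctx n} {B : Ty n} (W : Dyck 0) (p q : Peak W) (A : Ty (size W)) (σ : Sub (size W) n) →
                Γ ⊢tm Coh ⌊ W ⌋ A σ ∶ B → dim B ≤ N → ¬ IsIdentity (Coh ⌊ W ⌋ A σ) →
                IsIdentity (peakVar p [ σ ]var) → IsIdentity (peakVar q [ σ ]var) →
                Joinable Γ (Coh ⌊ W // p ⌋ (A [ π p ]ty) (σ //ˢ p)) (Coh ⌊ W // q ⌋ (A [ π q ]ty) (σ //ˢ q))
  prune-prune {n = n} {Γ = Γ} W p q A σ typed le ¬id i j with commute p q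
  ... | inj₁ refl = _ , done , done
  ... | inj₂ c = decide (identity? s) (identity? t)
    where
    open Commuting c
    s t u v : Tm n
    s = Coh ⌊ W // p ⌋ (A [ π p ]ty) (σ //ˢ p)
    t = Coh ⌊ W // q ⌋ (A [ π q ]ty) (σ //ˢ q)
    u = Coh ⌊ (W // p) // q/p ⌋ (A [ π p ]ty [ π q/p ]ty) ((σ //ˢ p) //ˢ q/p)
    v = Coh ⌊ (W // q) // p/q ⌋ (A [ π q ]ty [ π p/q ]ty) ((σ //ˢ q) //ˢ p/q)
    pruned : Pruned 0 (size W) n → Tm n
    pruned (V , ρ , τ) = Coh ⌊ V ⌋ (A [ ρ ]ty) τ
    u≡v : u ≡ v
    u≡v = trans (cong (λ A → Coh _ A _) (sym (ty-∙ A))) (trans (cong pruned (square σ)) (cong (λ A → Coh _ A _) (ty-∙ A)))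
    i′ : IsIdentity (peakVar p/q [ σ //ˢ q ]var)
    i′ = subst IsIdentity (sym (var-p σ)) i
    j′ : IsIdentity (peakVar q/p [ σ //ˢ p ]var)
    j′ = subst IsIdentity (sym (var-q σ)) j
    s⇓u : Joinable Γ s u
    s⇓u = prune-joinable (W // p) q/p (A [ π p ]ty) (σ //ˢ p) (typed-prune W p A σ typed i ¬id) le j′
    t⇓u : Joinable Γ t u
    t⇓u = subst (Joinable Γ t) (sym u≡v)
      (prune-joinable (W // q) p/q (A [ π q ]ty) (σ //ˢ q) (typed-prune W q A σ typed j ¬id) le i′)
    decide : Dec (IsIdentity s) → Dec (IsIdentity t) → Joinable Γ s t
    decide (no ¬s) _ =
      join-⇝* (⇝-rule (inj₂ (inj₁ (prune-peak (W // p) q/p (A [ π p ]ty) (σ //ˢ p) j′ , ¬s))) ◅ done) done (join-sym t⇓u)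
    decide (yes _) (no ¬t) = join-⇝* done
      (subst (Γ ⊢tm t ⇝*_) (sym u≡v)
        (⇝-rule (inj₂ (inj₁ (prune-peak (W // q) p/q (A [ π q ]ty) (σ //ˢ q) i′ , ¬t))) ◅ done)) s⇓u
    decide (yes s-id) (yes t-id) = ⊥-elim (one-not-identity c A σ s-id t-id)

  -- `s [ π p ]tm [ σ //ˢ p ]tm` is only equal to `s [ σ ]tm`, not identical with it; the two
  -- identities are joined through their arguments, one dimension lower.
  prune-ecr : {Γ : Ctx n} {B : Ty n} (W : Dyck 0) (p : Peak W) (s : Tm (size W)) (A : Ty (size W)) (σ : Sub (size W) n) →
              Γ ⊢tm Coh ⌊ W ⌋ (s ─⟨ A ⟩⟶ s) σ ∶ B → dim B ≤ N → IsIdentity (peakVar p [ σ ]var) →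
              Joinable Γ (Coh ⌊ W // p ⌋ ((s ─⟨ A ⟩⟶ s) [ π p ]ty) (σ //ˢ p)) (idTm (A [ σ ]ty) (s [ σ ]tm))
  prune-ecr W p s A σ typed le i with coh-inv typed
  ... | cohInv refl _ (ty-⟶ a b _) c _ e with //ˢ-typed p σ c i
  ...   | _ , eq = join-⇝* (ecr-⇝* ⌊ W // p ⌋ (s [ π p ]tm) (A [ π p ]ty) (σ //ˢ p)) done
    (join-sym (idTm-joinable
      (ty-trans (ty-sym (ty-[]-≈ A eq)) (ty-reflexive (ty-∙ A)))
      (subst (λ t → _ ⊢tm s [ σ ]tm ≈ t) (tm-∙ s) (≈-sym (tm-[]-≈ s eq)))
      (ty-[]-typed a (sub-var c)) (tm-[]-typed b (sub-var c))
      (≤-trans (≤-reflexive (dim-≈ e)) le)))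

  rule-rule : {Γ : Ctx n} {Δ : Ctx m} {A : Ty m} {σ : Sub m n} {B : Ty n} {t u : Tm n} →
              Γ ⊢tm Coh Δ A σ ∶ B → dim B ≤ N → RuleView Γ Δ A σ t → RuleView Γ Δ A σ u → Joinable Γ t u
  rule-rule {Γ = Γ} typed le v w = go typed v w refl
    where
    go : ∀ {m m′} {Δ : Ctx m} {Δ′ : Ctx m′} {A A′ σ σ′ t u} → Γ ⊢tm Coh Δ A σ ∶ _ →
         RuleView Γ Δ A σ t → RuleView Γ Δ′ A′ σ′ u →
         _≡_ {A = CohData _} (m , Δ , A , σ) (m′ , Δ′ , A′ , σ′) → Joinable Γ t u
    go typed (dr-view k σ) (dr-view l τ) eq with double-injective {k} {l} (cong (λ q → pred (proj₁ q)) eq)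
    go typed (dr-view k σ) (dr-view l τ) refl | refl = _ , done , done
    go typed (dr-view k σ) (prune-view W p A τ i j) eq =
      prune-dr-joinable W p A τ k σ (sym eq) (subst WfB eq typed) le i
      where
      WfB : CohData _ → Set
      WfB (m , Δ , A , σ) = Γ ⊢tm Coh Δ A σ ∶ _
    go typed (dr-view k σ) (ecr-view Δ s A τ j) eq = ⊥-elim (U-not-endo {k = k} (cong ctxTy eq))
    go typed (prune-view W p A σ i j) (dr-view l τ) eq = join-sym (prune-dr-joinable W p A σ l τ eq typed le i)
    go typed (prune-view W p A σ i j) (prune-view V q A′ σ′ i′ j′) eq
      with ⌊⌋-injective W V (cong (λ { (m , Δ , _) → m , Δ }) eq)
    go typed (prune-view W p A σ i j) (prune-view V q A′ σ′ i′ j′) refl | refl = prune-prune W p q A σ typed le j i i′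
    go typed (prune-view W p A σ i j) (ecr-view Δ s A′ τ j′) refl = prune-ecr W p s A′ σ typed le i
    go typed (ecr-view Δ s A σ j) (dr-view l τ) eq = ⊥-elim (U-not-endo {k = l} (cong ctxTy (sym eq)))
    go typed (ecr-view Δ s A σ j) (prune-view W p A′ τ i j′) refl = join-sym (prune-ecr W p s A σ typed le i)
    go typed (ecr-view Δ s A σ j) (ecr-view _ _ _ _ _) refl = _ , done , done

  rule-cohTy : {Γ : Ctx n} {Δ : Ctx m} {A A′ : Ty m} {σ : Sub m n} {B : Ty n} {t : Tm n} →
               Γ ⊢tm Coh Δ A′ σ ∶ B → dim B ≤ N → RuleView Γ Δ A σ t → Δ ⊢ty A ⇝ A′ → Joinable Γ t (Coh Δ A′ σ)
  rule-cohTy typed le (dr-view k σ) r = ⊥-elim (VarTy-normal (VarTy-U k) r)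
  rule-cohTy typed le (prune-view W p A σ i j) r =
    join-⇝* (Coh-⇝* (ty-⇝-[] (π p) r ◅ done) done) done (join-sym (prune-joinable W p _ σ typed le i))
  -- Reducing one end destroys the form required by `ecr`; the same reduction at the other end
  -- restores it.
  rule-cohTy typed le (ecr-view Δ s A σ j) (⇝-src {s′ = s′} r) = _ , idTm-⇝* done (tm-⇝-[] σ r ◅ done) ,
    Coh-⇝* (⇝-tgt r ◅ done) done ◅◅ ecr-⇝* Δ s′ A σ
  rule-cohTy typed le (ecr-view Δ s A σ j) (⇝-ty {A′ = A′} r) = _ , idTm-⇝* (ty-⇝-[] σ r ◅ done) done ,
    ecr-⇝* Δ s A′ σ
  rule-cohTy typed le (ecr-view Δ s A σ j) (⇝-tgt {t′ = s′} r) = _ , idTm-⇝* done (tm-⇝-[] σ r ◅ done) ,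
    Coh-⇝* (⇝-src r ◅ done) done ◅◅ ecr-⇝* Δ s′ A σ

  rule-cohSub : {Γ : Ctx n} {Δ : Ctx m} {A : Ty m} {σ τ : Sub m n} {B : Ty n} {t : Tm n} →
                Γ ⊢tm Coh Δ A τ ∶ B → dim B ≤ N → RuleView Γ Δ A σ t → Γ ⊢sub σ ⇝ τ → Joinable Γ t (Coh Δ A τ)
  rule-cohSub typed le (dr-view k σ) r = _ , var-[]-⇝ zero r , dr-⇝ k _ ◅ done
  -- Reducts of identities are identities, so the peak can still be pruned after `σ` has been
  -- reduced.
  rule-cohSub typed le (prune-view W p A σ i j) r =
    join-⇝* (Coh-⇝* done (//ˢ-⇝ p r)) done (join-sym (prune-joinable W p A _ typed le (identity-⇝* i (var-[]-⇝ (peakVar p) r))))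
  rule-cohSub typed le (ecr-view Δ s A σ j) r = _ , idTm-⇝* (ty-[]-⇝ A r) (tm-[]-⇝ s r) , ecr-⇝* Δ s A _

  -- Entries of a substitution may have dimension `N` itself, where confluence is not yet known;
  -- they are handled by structural recursion. The bound `suc N` for types leaves their components
  -- at `N`.
  locally-confluent-ty  : {Γ : Ctx n} (A : Ty n) {B C : Ty n} → Γ ⊢ty A → dim A ≤ suc N →
                          Γ ⊢ty A ⇝ B → Γ ⊢ty A ⇝ C → TyJoinable Γ B C
  locally-confluent     : {Γ : Ctx n} (s : Tm n) {t u : Tm n} {A : Ty n} → Γ ⊢tm s ∶ A → dim A ≤ N →
                          Γ ⊢tm s ⇝ t → Γ ⊢tm s ⇝ u → Joinable Γ t u
  locally-confluent-sub : {Γ : Ctx n} {Δ : Ctx m} (σ : Sub m n) {τ ρ : Sub m n} → Γ ⊢sub σ ∶ Δ → dimCtx Δ ≤ N →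
                          Γ ⊢sub σ ⇝ τ → Γ ⊢sub σ ⇝ ρ → SubJoinable Γ τ ρ
  locally-confluent-ty (s ─⟨ A ⟩⟶ t) (ty-⟶ a b c) le (⇝-src r) (⇝-src r′)
    with locally-confluent s b (≤-pred le) r r′
  ... | _ , p , q = _ , ⟶-⇝* p done done , ⟶-⇝* q done done
  locally-confluent-ty (s ─⟨ A ⟩⟶ t) (ty-⟶ a b c) le (⇝-ty r) (⇝-ty r′)
    with locally-confluent-ty A a (≤-trans (n≤1+n _) le) r r′
  ... | _ , p , q = _ , ⟶-⇝* done p done , ⟶-⇝* done q done
  locally-confluent-ty (s ─⟨ A ⟩⟶ t) (ty-⟶ a b c) le (⇝-tgt r) (⇝-tgt r′)
    with locally-confluent t c (≤-pred le) r r′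
  ... | _ , p , q = _ , ⟶-⇝* done done p , ⟶-⇝* done done q
  locally-confluent-ty (s ─⟨ A ⟩⟶ t) p le (⇝-src r) (⇝-ty r′)  = _ , ⇝-ty r′ ◅ done , ⇝-src r ◅ done
  locally-confluent-ty (s ─⟨ A ⟩⟶ t) p le (⇝-src r) (⇝-tgt r′) = _ , ⇝-tgt r′ ◅ done , ⇝-src r ◅ done
  locally-confluent-ty (s ─⟨ A ⟩⟶ t) p le (⇝-ty r)  (⇝-src r′) = _ , ⇝-src r′ ◅ done , ⇝-ty r ◅ done
  locally-confluent-ty (s ─⟨ A ⟩⟶ t) p le (⇝-ty r)  (⇝-tgt r′) = _ , ⇝-tgt r′ ◅ done , ⇝-ty r ◅ done
  locally-confluent-ty (s ─⟨ A ⟩⟶ t) p le (⇝-tgt r) (⇝-src r′) = _ , ⇝-src r′ ◅ done , ⇝-tgt r ◅ done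
  locally-confluent-ty (s ─⟨ A ⟩⟶ t) p le (⇝-tgt r) (⇝-ty r′)  = _ , ⇝-ty r′ ◅ done , ⇝-tgt r ◅ done
  locally-confluent (var x) p le (⇝-rule (inj₁ ()))
  locally-confluent (var x) p le (⇝-rule (inj₂ (inj₁ (() , _))))
  locally-confluent (var x) p le (⇝-rule (inj₂ (inj₂ (() , _))))
  locally-confluent (Coh Δ A σ) p le (⇝-rule r) (⇝-rule r′) = rule-rule p le (rule-view r) (rule-view r′)
  locally-confluent (Coh Δ A σ) p le (⇝-rule r) r₂@(⇝-cohTy r′) =
    rule-cohTy (tm-⇝-typed p r₂) le (rule-view r) r′
  locally-confluent (Coh Δ A σ) p le (⇝-rule r) r₂@(⇝-cohSub r′) =
    rule-cohSub (tm-⇝-typed p r₂) le (rule-view r) r′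
  locally-confluent (Coh Δ A σ) p le r₁@(⇝-cohTy r) (⇝-rule r′) =
    join-sym (rule-cohTy (tm-⇝-typed p r₁) le (rule-view r′) r)
  locally-confluent (Coh Δ A σ) p le r₁@(⇝-cohSub r) (⇝-rule r′) =
    join-sym (rule-cohSub (tm-⇝-typed p r₁) le (rule-view r′) r)
  locally-confluent (Coh Δ A σ) p le (⇝-cohTy r)  (⇝-cohSub r′) = _ , ⇝-cohSub r′ ◅ done , ⇝-cohTy r ◅ done
  locally-confluent (Coh Δ A σ) p le (⇝-cohSub r) (⇝-cohTy r′)  = _ , ⇝-cohTy r′ ◅ done , ⇝-cohSub r ◅ done
  locally-confluent (Coh Δ A σ) p le (⇝-cohTy r)  (⇝-cohTy r′) with coh-inv p
  ... | cohInv _ _ a _ _ e with locally-confluent-ty A a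
                                  (≤-trans (≤-reflexive (coh-dim-≡ A e)) (≤-trans le (n≤1+n N))) r r′
  ...   | _ , q , q′ = _ , Coh-⇝* q done , Coh-⇝* q′ done
  locally-confluent (Coh Δ A σ) p le (⇝-cohSub r) (⇝-cohSub r′) with coh-inv p
  ... | cohInv refl _ a b o e with locally-confluent-sub σ b
                                  (≤-trans (coh-dim a o) (≤-trans (≤-reflexive (coh-dim-≡ A e)) le)) r r′
  ...   | _ , q , q′ = _ , Coh-⇝* done q , Coh-⇝* done q′
  locally-confluent-sub ⟨ σ , t ⟩ (sub-, a b) le (⇝-init r) (⇝-last r′) = _ , ⇝-last r′ ◅ done , ⇝-init r ◅ done
  locally-confluent-sub ⟨ σ , t ⟩ (sub-, a b) le (⇝-last r) (⇝-init r′) = _ , ⇝-init r′ ◅ done , ⇝-last r ◅ done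
  locally-confluent-sub ⟨ σ , t ⟩ (sub-, a b) le (⇝-init r) (⇝-init r′)
    with locally-confluent-sub σ a (≤-trans (m≤m⊔n _ _) le) r r′
  ... | _ , q , q′ = _ , ⟨,⟩-⇝* q done , ⟨,⟩-⇝* q′ done
  locally-confluent-sub ⟨ σ , t ⟩ (sub-, {Δ = Δ} {A = A} a b) le (⇝-last r) (⇝-last r′)
    with locally-confluent t b (≤-trans (≤-reflexive (dim-[] A)) (≤-trans (m≤n⊔m (dimCtx Δ) _) le)) r r′
  ... | _ , q , q′ = _ , ⟨,⟩-⇝* done q , ⟨,⟩-⇝* done q′

  -- Newman's lemma relative to typing: local confluence is available for typed terms of dimension
  -- at most `N`, so subject reduction accompanies every step.
  newman : {Γ : Ctx n} {s : Tm n} {A : Ty n} → TerminatingTm Γ s → Γ ⊢tm s ∶ A → dim A ≤ N → ConfluentAt Γ s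
  newman _       p le done        q  = _ , q , done
  newman _       p le (r ◅ rs) done  = _ , done , r ◅ rs
  newman (acc f) p le (r ◅ rs) (r′ ◅ rs′) with locally-confluent _ p le r r′
  ... | _ , q , q′ with newman (f r) (tm-⇝-typed p r) le rs q
  ...   | _ , t , t′ with newman (f r′) (tm-⇝-typed p r′) le rs′ (q′ ◅◅ t′)
  ...     | _ , u , u′ = _ , t ◅◅ u′ , u

-- Confluence

confluent-below : ∀ N → ConfluentBelow N
confluent-below zero    p ()
confluent-below (suc N) p (s≤s le) =
  LocalConfluence.newman (confluent-below N) (terminating (suc N) _ p (s≤s le)) p le

theorem4p2p8 : {n : ℕ} (Γ : Ctx n) → Confluent (Reduction.Step su′ Γ)
theorem4p2p8 Γ done rs = _ , rs , done
theorem4p2p8 Γ (r ◅ rs) done = _ , done , r ◅ rs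
theorem4p2p8 Γ {s} (r ◅ rs) (r′ ◅ rs′) with Step.source-wf r
... | A , p with confluent-below (suc (dim A)) p ≤-refl (raw (r ◅ rs)) (raw (r′ ◅ rs′))
  where
  raw : ∀ {s t} → Star (Step Γ) s t → Γ ⊢tm s ⇝* t
  raw = gmap (λ s → s) Step.reduces
-- The joining sequences are untyped; subject reduction restores the well-formedness that `Step`
-- demands at both ends.
... | _ , q , q′ = _ , typed (target r rs) q , typed (target r′ rs′) q′
  where
  target : ∀ {s t u} → Step Γ s t → Star (Step Γ) t u → WellFormed Γ u
  target r done         = Step.target-wf r
  target _ (r ◅ rs)  = target r rs
  typed : ∀ {s t} → WellFormed Γ s → Γ ⊢tm s ⇝* t → Star (Step Γ) s t
  typed wf done = done
  typed (A , p) (r ◅ rs) = mkStep (A , p) (A , p′) r ◅ typed (A , p′) rs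
    where p′ = tm-⇝-typed p r
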